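{- Let $a_1,a_3\in\mathbb{Z}$ and let $E_{a_1,a_3}$ be the elliptic curve over $\mathbb{Q}$ given by $y^2+a_1xy+a_3y=x^3$. Let $p$ be an odd prime at which $E_{a_1,a_3}$ has good reduction, assume $p\nmid a_1$, and let $q=p^e$ satisfy $q\equiv 1\pmod 3$. Let $\rho\in\widehat{\mathbb{F}_q^*}$ be a character of order three and $\epsilon$ the trivial character. Then $$t_q(E_{a_1,a_3})=-q\cdot {}_2F_1\left(\left.\begin{array}{cc}\rho & \rho^2\\ & \epsilon\end{array}\right| 27a_1^{ -3}a_3\right)_q,$$ where $27a_1^{ -3}a_3$ is read in $\mathbb{F}_q$.
   Context: For a prime power $q$, every multiplicative character $\chi$ of $\mathbb{F}_q^*$ is extended to $\mathbb{F}_q$ by $\chi(0)=0$ (also for the trivial character $\epsilon$). For characters $A,B$ define the normalized Jacobi sum $\binom{A}{B}=\frac{B(-1)}{q}\sum_{x\in\mathbb{F}_q}A(x)\bar B(1-x)$. The Gaussian hypergeometric series is ${}_2F_1\left(\left.\begin{array}{cc}A_0 & A_1\\ & B_1\end{array}\right|x\right)_q=\frac{q}{q-1}\sum_{\chi\in\widehat{\mathbb{F}_q^*}}\binom{A_0\chi}{\chi}\binom{A_1\chi}{B_1\chi}\chi(x)$. If $\tilde E_{a_1,a_3}$ denotes the reduction of $E_{a_1,a_3}$ modulo $p$, then $t_q(E_{a_1,a_3})=q+1-\#\tilde E_{a_1,a_3}(\mathbb{F}_q)$, where $\#\tilde E_{a_1,a_3}(\mathbb{F}_q)$ counts projective $\mathbb{F}_q$-points.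 -}

module Defs where

open import Level using (0ℓ)
open import Algebra.Bundles using (CommutativeRing)
open import Data.Nat as ℕ using (ℕ; zero; suc; _<_)
open import Data.Integer as ℤ using (ℤ; +_; -[1+_])
open import Data.Product using (_×_; _,_; ∃-syntax; proj₁; proj₂)
open import Data.List using (List; []; _∷_; length; foldr; filter; cartesianProduct)
open import Data.List.Relation.Unary.All using (All)
open import Data.List.Relation.Unary.Any using (Any)
open import Data.List.Relation.Unary.AllPairs using (AllPairs)
open import Relation.Nullary using (¬_; yes; no)
open import Relation.Binary using (Decidable)

record Field : Set₁ where
  field
    commRing : CommutativeRing 0ℓ 0ℓ
  open CommutativeRing commRing public
  field
    _⁻¹    : Carrier → Carrier
    ⁻¹-inv : ∀ x → ¬ x ≈ 0# → x * (x ⁻¹) ≈ 1#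
    0≉1    : ¬ 0# ≈ 1#

  fromℕ : ℕ → Carrier
  fromℕ zero    = 0#
  fromℕ (suc n) = 1# + fromℕ n

  fromℤ : ℤ → Carrier
  fromℤ (+ n)    = fromℕ n
  fromℤ -[1+ n ] = - fromℕ (suc n)

  pow : Carrier → ℕ → Carrier
  pow x zero    = 1#
  pow x (suc n) = x * pow x n

record FiniteField : Set₁ where
  field
    field' : Field
  open Field field' public
  field
    _≟_      : Decidable _≈_
    elements : List Carrier
    complete : ∀ x → Any (x ≈_) elements
    distinct : AllPairs (λ a b → ¬ a ≈ b) elements

  size : ℕ
  size = length elements

-- A field of characteristic zero (the coefficient field for character values,
-- playing the role of ℂ).
record CharZeroField : Set₁ where
  field
    field' : Field
  open Field field' public
  field
    charZero : ∀ n → ¬ fromℕ (suc n) ≈ 0#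

HasPrimitiveRoot : CharZeroField → ℕ → Set
HasPrimitiveRoot K n = ∃[ ζ ] (pow ζ n ≈ 1# × (∀ k → 0 < k → k < n → ¬ pow ζ k ≈ 1#))
  where open CharZeroField K

module _ (F : FiniteField) (K : CharZeroField) where
  private
    module F = FiniteField F
    module K = CharZeroField K

  Char : Set
  Char = F.Carrier → K.Carrier

  -- multiplicative character of F_q^*, extended by χ(0) = 0
  IsCharacter : Char → Set
  IsCharacter χ =
      (∀ {x y} → x F.≈ y → χ x K.≈ χ y)
    × χ F.0# K.≈ K.0#
    × χ F.1# K.≈ K.1#
    × (∀ x y → χ (x F.* y) K.≈ (χ x K.* χ y))

  _≐_ : Char → Char → Set
  χ ≐ ψ = ∀ x → χ x K.≈ ψ x

  ε : Char
  ε x with x F.≟ F.0#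
  ... | yes _ = K.0#
  ... | no  _ = K.1#

  _·_ : Char → Char → Char
  (χ · ψ) x = χ x K.* ψ x

  -- conjugate (= inverse) character, with value 0 at 0
  bar : Char → Char
  bar χ x with x F.≟ F.0#
  ... | yes _ = K.0#
  ... | no  _ = (χ x) K.⁻¹

  OrderThree : Char → Set
  OrderThree ρ = ((ρ · ρ) · ρ) ≐ ε × ¬ (ρ ≐ ε)

  AllCharacters : List Char → Set
  AllCharacters chars =
      All IsCharacter chars
    × (∀ χ → IsCharacter χ → Any (χ ≐_) chars)
    × AllPairs (λ χ ψ → ¬ (χ ≐ ψ)) chars

  qK : K.Carrier
  qK = K.fromℕ F.size

  sumF : (F.Carrier → K.Carrier) → K.Carrier
  sumF f = foldr (λ x acc → f x K.+ acc) K.0# F.elements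

  sumChars : List Char → (Char → K.Carrier) → K.Carrier
  sumChars chars g = foldr (λ χ acc → g χ K.+ acc) K.0# chars

  jacobi : Char → Char → K.Carrier
  jacobi A B = (B (F.- F.1#) K.* (qK K.⁻¹))
               K.* sumF (λ x → A x K.* bar B (F.1# F.- x))

  hyp2F1 : List Char → Char → Char → Char → F.Carrier → K.Carrier
  hyp2F1 chars A0 A1 B1 x =
    (qK K.* ((qK K.- K.1#) K.⁻¹))
      K.* sumChars chars (λ χ → (jacobi (A0 · χ) χ K.* jacobi (A1 · χ) (B1 · χ)) K.* χ x)

-- Discriminant of y^2 + a1 x y + a3 y = x^3 :  a3^3 (a1^3 - 27 a3)
disc : ℤ → ℤ → ℤ
disc a1 a3 = (a3 ℤ.* a3 ℤ.* a3) ℤ.* (a1 ℤ.* a1 ℤ.* a1 ℤ.- + 27 ℤ.* a3)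

module _ (F : FiniteField) where
  private module F = FiniteField F

  -- number of projective F-points of y^2 + a1 x y + a3 y = x^3
  -- (affine solutions plus the single point at infinity)
  numPoints : ℤ → ℤ → ℕ
  numPoints a1 a3 =
    suc (length (filter (λ (xy : F.Carrier × F.Carrier) →
            let x = proj₁ xy ; y = proj₂ xy in
            ((y F.* y) F.+ (F.fromℤ a1 F.* x F.* y) F.+ (F.fromℤ a3 F.* y))
              F.≟ (x F.* x F.* x))
          (cartesianProduct F.elements F.elements)))

  trace : ℤ → ℤ → ℤ
  trace a1 a3 = (+ F.size ℤ.+ + 1) ℤ.- + numPoints a1 a3

  argument : ℤ → ℤ → F.Carrier
  argument a1 a3 = F.fromℕ 27 F.* F.pow (F.fromℤ a1 F.⁻¹) 3 F.* F.fromℤ a3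

{-# OPTIONS --safe #-}
-- Put λ = 27a₃/a₁³, and let φ be the quadratic character. Orthogonality of the
-- characters (𝔽^* is cyclic) turns −q·₂F₁(λ) into minus the sum of ρ(x)ρ²(y) over
-- the conic λxy = (1 − x)(1 − y); with k = x/y this sum is
-- S = Σ_k ρ(k)φ((k − 1)² + 4λk). Counting in y, the curve has q + A affine
-- points, where after scaling A = Σ_X φ((1 + 3X)² + 4λX³), so the claim is A = S.
--
-- Let σ(k) = (k − 1)²/k, C(s) = s(s + 3)² and G(s) = φ(s(s + 4λ)). With X = 1/s
-- the claim becomes Σ_s G(C(s)) = Σ_s G(s) + Σ_k ρ(k)G(σ(k)), and this holds for
-- every function G. Indeed C(σ(m)) = σ(m³), while s = σ(m) has 1 + φ(s(s + 4))
-- solutions m, and k has 1 + ρ(k) + ρ²(k) cube roots, so summing G(σ(m³)) over m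
-- in two ways gives Σ_s w(s)G(C(s)) = Σ_s w(s)G(s) + 2Σ_k ρ(k)G(σ(k)) for
-- w(s) = 1 + φ(s(s + 4)). For w(s) = 1 − φ(s(s + 4)) one has simply
-- Σ_s w(s)G(C(s)) = Σ_s w(s)G(s), because C permutes the s for which s(s + 4) is
-- a nonsquare: (C(s) − C(t))/(s − t) is a quadratic in t of discriminant
-- −3s(s + 4), and −3 is a square as 𝔽 contains the cube roots of unity.
-- Adding the two identities proves the claim.
module Submission where

open import Defs
open import Data.Nat using (ℕ; _^_; _%_; _∸_)
open import Data.Nat.Primality using (Prime)
open import Data.Integer using (ℤ; +_)
open import Data.Integer.Divisibility using (_∣_)
open import Data.List using (List)
open import Relation.Nullary using (¬_)
open import Relation.Binary.PropositionalEquality using (_≡_; _≢_)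

open import Level using (0ℓ)
open import Algebra.Bundles using (CommutativeMonoid; CommutativeRing)
open import Algebra.Solver.Ring.AlmostCommutativeRing using (fromCommutativeRing; _-Raw-AlmostCommutative⟶_)
import Algebra.Solver.Ring
open import Data.Nat as ℕ using (zero; suc; _≤_; _<_; z≤n; s≤s; NonZero)
import Data.Nat.Properties as ℕₚ
open import Data.Nat.Coprimality using (Coprime; coprime-Bézout)
open import Data.Nat.Divisibility using (divides; _∣?_; ∣⇒≤; ∣1⇒≡1) renaming (_∣_ to _∣ⁿ_)
open import Data.Nat.DivMod using (_/_; m≡m%n+[m/n]*n)
open import Data.Nat.GCD using (gcd; gcd-GCD; module Bézout; gcd[m,n]∣m; gcd[m,n]∣n)
open import Data.Nat.Induction using (<-rec)
open import Data.Nat.ListAction using (product)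
open import Data.Nat.ListAction.Properties using (∈⇒∣product)
open import Data.Nat.Primality using (prime?; prime[2]; prime⇒nonZero; prime⇒nonTrivial; prime⇒irreducible; euclidsLemma; ¬prime[1])
open import Data.Nat.Primality.Factorisation using (factorise; factorisationHasAllPrimeFactors)
open import Data.Integer as ℤ using (-[1+_]; +[1+_]; _⊖_; 0ℤ; 1ℤ)
import Data.Integer.Properties as ℤₚ
open import Data.Maybe using (Maybe; just; nothing)
open import Data.List using ([]; _∷_; length; foldr; map; filter; _++_; cartesianProduct; applyUpTo)
open import Data.List.Properties using (length-map; length-applyUpTo)
open import Data.List.Membership.Propositional using (_∈_)
open import Data.List.Membership.Setoid.Properties using (∈-filter⁺)
open import Data.List.Relation.Unary.All as All using (All; []; _∷_)
import Data.List.Relation.Unary.All.Properties as Allₚ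
open import Data.List.Relation.Unary.Any as Any using (Any; here; there; _─_)
import Data.List.Relation.Unary.Any.Properties as Anyₚ
open import Data.List.Relation.Unary.AllPairs as AllPairs using (AllPairs; []; _∷_)
import Data.List.Relation.Unary.AllPairs.Properties as AllPairsₚ
open import Data.Product using (_×_; _,_; proj₁; proj₂; ∃-syntax)
open import Data.Sum using (_⊎_; inj₁; inj₂)
open import Data.Unit using (⊤; tt)
open import Data.Empty using (⊥-elim)
open import Relation.Nullary using (Dec; yes; no; ¬?)
open import Relation.Nullary.Decidable using (map′; from-yes)
open import Relation.Unary using (Decidable)
open import Relation.Binary using (Symmetric; Transitive)
open import Relation.Binary.PropositionalEquality as ≡ using ()
open import Function using (_∘_)

-- Behind the two weights stand two tori. Solving s = k + 1/k - 2 for k gives k in 𝔽 when s(s + 4)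
-- is a square, and otherwise k of norm one in the quadratic extension; on both sides C is cubing.
-- On 𝔽^*, of order q - 1, cubing is three to one onto its image, and ρ, ρ² detect that image. The
-- norm-one group has order q + 1, which is 2 modulo 3, so cubing is bijective there and no
-- character sum appears. The discriminant argument reads this bijectivity off inside 𝔽, so the
-- extension is never constructed. The passage from the two discriminants to G multiplies by squares
-- that vanish at a few points; the values lost there are restored as explicit correction terms. The
-- coefficient field is not assumed to have an order, a conjugation or a decidable equality. Hence φ
-- is defined by counting, nontriviality of a character is tested at a generator of 𝔽^*, and all
-- case distinctions are made in 𝔽.

-- Lists without repetition up to an equivalence: pigeonhole and permuted sums

AllPairs-mapᴬ : ∀ {A : Set} {P : A → Set} {R S : A → A → Set} → (∀ {x y} → P x → P y → R x y → S x y) →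
  ∀ {xs} → All P xs → AllPairs R xs → AllPairs S xs
AllPairs-mapᴬ f []       []         = []
AllPairs-mapᴬ f (p ∷ ps) (rs ∷ rss) = All.zipWith (λ (p′ , r) → f p p′ r) (ps , rs) ∷ AllPairs-mapᴬ f ps rss

module DistinctLists {A : Set} (_~_ : A → A → Set) (~-sym : Symmetric _~_) (~-trans : Transitive _~_) where

  Distinct : List A → Set
  Distinct = AllPairs (λ x y → ¬ x ~ y)

  _⊑_ : List A → List A → Set
  xs ⊑ ys = All (λ x → Any (x ~_) ys) xs

  length-─ : ∀ {P : A → Set} {xs} (p : Any P xs) → length xs ≡ suc (length (xs ─ p))
  length-─ (here _)  = ≡.refl
  length-─ (there p) = ≡.cong suc (length-─ p)

  Any-─ : ∀ {x y ys} (p : Any (x ~_) ys) → Any (y ~_) ys → ¬ x ~ y → Any (y ~_) (ys ─ p)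
  Any-─ (here x~z) (here y~z) x≁y = ⊥-elim (x≁y (~-trans x~z (~-sym y~z)))
  Any-─ (here _)   (there q)  x≁y = q
  Any-─ (there p)  (here y~z) x≁y = here y~z
  Any-─ (there p)  (there q)  x≁y = there (Any-─ p q x≁y)

  ⊑-─ : ∀ {x xs ys} (p : Any (x ~_) ys) → All (λ y → ¬ x ~ y) xs → xs ⊑ ys → xs ⊑ (ys ─ p)
  ⊑-─ p []            []            = []
  ⊑-─ p (x≁y ∷ x≁xs) (q ∷ xs⊑ys) = Any-─ p q x≁y ∷ ⊑-─ p x≁xs xs⊑ys

  length-≤ : ∀ {xs ys} → Distinct xs → xs ⊑ ys → length xs ≤ length ys
  length-≤ []           []           = z≤n
  length-≤ (x≁xs ∷ dxs) (p ∷ xs⊑ys) =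
    ℕₚ.≤-trans (s≤s (length-≤ dxs (⊑-─ p x≁xs xs⊑ys))) (ℕₚ.≤-reflexive (≡.sym (length-─ p)))

  private
    pred-≤ : ∀ {n x ys} (p : Any (x ~_) ys) → length ys ≤ suc n → length (ys ─ p) ≤ n
    pred-≤ p le = ℕₚ.≤-pred (ℕₚ.≤-trans (ℕₚ.≤-reflexive (≡.sym (length-─ p))) le)

  -- Pigeonhole by deletion: every entry of `xs` removes its match from `ys`, and by the length
  -- bound nothing is left over at the end. Only comparisons with the given `y` have to be decided.
  exhaustive : ∀ {xs ys} → Distinct xs → xs ⊑ ys → length ys ≤ length xs →
               ∀ {y} → Any (y ~_) ys → (∀ {x} → Dec (y ~ x)) → Any (y ~_) xs
  exhaustive {ys = []} [] [] le () _
  exhaustive {x ∷ xs} (x≁xs ∷ dxs) (p ∷ xs⊑ys) le {y} q dec with dec {x}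
  ... | yes y~x = here y~x
  ... | no  y≁x = there (exhaustive dxs (⊑-─ p x≁xs xs⊑ys) (pred-≤ p le) (Any-─ p q (y≁x ∘ ~-sym)) dec)

  module _ (M : CommutativeMonoid 0ℓ 0ℓ) where
    open CommutativeMonoid M renaming (ε to unit; sym to ≈-sym; trans to ≈-trans; refl to ≈-refl)

    private
      ⨁′ : List A → (A → Carrier) → Carrier
      ⨁′ xs f = foldr (λ x acc → f x ∙ acc) unit xs

      ⨁-─ : ∀ {x ys} (f : A → Carrier) → (∀ {a b} → a ~ b → f a ≈ f b) →
             (p : Any (x ~_) ys) → f x ∙ ⨁′ (ys ─ p) f ≈ ⨁′ ys f
      ⨁-─ f f-resp (here x~y) = ∙-congʳ (f-resp x~y)
      ⨁-─ {x} {y ∷ ys} f f-resp (there p) =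
        ≈-trans (≈-sym (assoc _ _ _)) (≈-trans (∙-congʳ (comm _ _))
          (≈-trans (assoc _ _ _) (∙-congˡ (⨁-─ f f-resp p))))

    -- By the length bound the inclusion is a permutation up to `~`. Reindexing along an injective
    -- map reduces to this, because the image list is again distinct and has the same length.
    ⨁-perm : ∀ {xs ys} (f : A → Carrier) → (∀ {a b} → a ~ b → f a ≈ f b) →
              Distinct xs → xs ⊑ ys → length ys ≤ length xs → ⨁′ xs f ≈ ⨁′ ys f
    ⨁-perm {[]} {[]} f f-resp [] [] le = ≈-refl
    ⨁-perm {x ∷ xs} f f-resp (x≁xs ∷ dxs) (p ∷ xs⊑ys) le =
      ≈-trans (∙-congˡ (⨁-perm f f-resp dxs (⊑-─ p x≁xs xs⊑ys) (pred-≤ p le))) (⨁-─ f f-resp p)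

    -- No decidability of ~ is needed: the position of a is given and the other
    -- entries differ from it by distinctness.
    ⨁-single : ∀ {a xs} {P : A → Set} (f : A → Carrier) → (∀ {x} → a ~ x → f x ≈ f a) →
                (∀ {x} → P x → ¬ a ~ x → f x ≈ unit) →
                All P xs → Any (a ~_) xs → Distinct xs → ⨁′ xs f ≈ f a
    ⨁-single {a} {P = P} f f-resp vanish = go
      where
      go-none : ∀ {x xs} → a ~ x → All P xs → All (λ y → ¬ x ~ y) xs → ⨁′ xs f ≈ unit
      go-none a~x []       []          = ≈-refl
      go-none a~x (p ∷ ps) (x≁y ∷ ns) =
        ≈-trans (∙-cong (vanish p (λ a~y → x≁y (~-trans (~-sym a~x) a~y))) (go-none a~x ps ns)) (identityˡ _)
      misses : ∀ {x xs} → All (λ y → ¬ x ~ y) xs → Any (a ~_) xs → ¬ a ~ x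
      misses (x≁y ∷ _) (here a~y) a~x = x≁y (~-trans (~-sym a~x) a~y)
      misses (_ ∷ ns)  (there q)  a~x = misses ns q a~x
      go : ∀ {xs} → All P xs → Any (a ~_) xs → Distinct xs → ⨁′ xs f ≈ f a
      go (p ∷ ps) (here a~x) (ns ∷ _)  = ≈-trans (∙-cong (f-resp a~x) (go-none a~x ps ns)) (identityʳ _)
      go (p ∷ ps) (there q)  (ns ∷ ds) = ≈-trans (∙-cong (vanish p (misses ns q)) (go ps q ds)) (identityˡ _)

-- Finite sums and products in a commutative monoid

module BigOp (M : CommutativeMonoid 0ℓ 0ℓ) where
  open CommutativeMonoid M renaming (ε to unit)
  open import Algebra.Properties.CommutativeSemigroup commutativeSemigroup using (interchange)

  module _ {A : Set} where

    ⨁ : List A → (A → Carrier) → Carrier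
    ⨁ xs f = foldr (λ x acc → f x ∙ acc) unit xs

    ⨁-congᴬ : ∀ {xs f g} → All (λ x → f x ≈ g x) xs → ⨁ xs f ≈ ⨁ xs g
    ⨁-congᴬ []       = refl
    ⨁-congᴬ (e ∷ es) = ∙-cong e (⨁-congᴬ es)

    ⨁-cong : ∀ xs {f g} → (∀ x → f x ≈ g x) → ⨁ xs f ≈ ⨁ xs g
    ⨁-cong xs e = ⨁-congᴬ (All.universal e xs)

    ⨁-∙ : ∀ xs f g → ⨁ xs (λ x → f x ∙ g x) ≈ ⨁ xs f ∙ ⨁ xs g
    ⨁-∙ []       f g = sym (identityˡ unit)
    ⨁-∙ (x ∷ xs) f g = trans (∙-congˡ (⨁-∙ xs f g)) (interchange _ _ _ _)

    ⨁-unit : ∀ xs → ⨁ xs (λ _ → unit) ≈ unit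
    ⨁-unit []       = refl
    ⨁-unit (x ∷ xs) = trans (identityˡ _) (⨁-unit xs)

    ⨁-++ : ∀ xs ys f → ⨁ (xs ++ ys) f ≈ ⨁ xs f ∙ ⨁ ys f
    ⨁-++ []       ys f = sym (identityˡ _)
    ⨁-++ (x ∷ xs) ys f = trans (∙-congˡ (⨁-++ xs ys f)) (sym (assoc _ _ _))

  ⨁-map : ∀ {A B : Set} (h : A → B) xs f → ⨁ (map h xs) f ≈ ⨁ xs (f ∘ h)
  ⨁-map h []       f = refl
  ⨁-map h (x ∷ xs) f = ∙-congˡ (⨁-map h xs f)

  ⨁-swap : ∀ {A B : Set} (xs : List A) (ys : List B) (f : A → B → Carrier) →
            ⨁ xs (λ x → ⨁ ys (f x)) ≈ ⨁ ys (λ y → ⨁ xs (λ x → f x y))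
  ⨁-swap []       ys f = sym (⨁-unit ys)
  ⨁-swap (x ∷ xs) ys f = trans (∙-congˡ (⨁-swap xs ys f)) (sym (⨁-∙ ys _ _))

  ⨁-cartesianProduct : ∀ {A B : Set} (xs : List A) (ys : List B) f →
    ⨁ (cartesianProduct xs ys) f ≈ ⨁ xs (λ x → ⨁ ys (λ y → f (x , y)))
  ⨁-cartesianProduct []       ys f = refl
  ⨁-cartesianProduct (x ∷ xs) ys f =
    trans (⨁-++ (map (x ,_) ys) _ f) (∙-cong (⨁-map (x ,_) ys f) (⨁-cartesianProduct xs ys f))

-- Field arithmetic: the image of the integers, polynomial identities, powers

module FieldProperties (𝔽 : Field) where
  open Field 𝔽
  open import Algebra.Properties.Ring ring
  open import Relation.Binary.Reasoning.Setoid setoid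

  fromℕ-+ : ∀ m n → fromℕ (m ℕ.+ n) ≈ fromℕ m + fromℕ n
  fromℕ-+ zero    n = sym (+-identityˡ _)
  fromℕ-+ (suc m) n = trans (+-congˡ (fromℕ-+ m n)) (sym (+-assoc _ _ _))

  fromℕ-* : ∀ m n → fromℕ (m ℕ.* n) ≈ fromℕ m * fromℕ n
  fromℕ-* zero    n = sym (zeroˡ _)
  fromℕ-* (suc m) n = begin
    fromℕ (n ℕ.+ m ℕ.* n)               ≈⟨ fromℕ-+ n (m ℕ.* n) ⟩
    fromℕ n + fromℕ (m ℕ.* n)           ≈⟨ +-cong (sym (*-identityˡ _)) (fromℕ-* m n) ⟩
    1# * fromℕ n + fromℕ m * fromℕ n    ≈⟨ sym (distribʳ _ _ _) ⟩
    (1# + fromℕ m) * fromℕ n            ∎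

  fromℤ-⊖ : ∀ m n → fromℤ (m ⊖ n) ≈ fromℕ m - fromℕ n
  fromℤ-⊖ m zero = begin
    fromℤ (m ⊖ 0)  ≡⟨ ≡.cong fromℤ (ℤₚ.⊖-≥ {m} z≤n) ⟩
    fromℕ m        ≈⟨ sym (+-identityʳ _) ⟩
    fromℕ m + 0#   ≈⟨ +-congˡ (sym -0#≈0#) ⟩
    fromℕ m - 0#   ∎
  fromℤ-⊖ zero    (suc n) = sym (+-identityˡ _)
  fromℤ-⊖ (suc m) (suc n) = begin
    fromℤ (suc m ⊖ suc n)                ≡⟨ ≡.cong fromℤ (ℤₚ.[1+m]⊖[1+n]≡m⊖n m n) ⟩
    fromℤ (m ⊖ n)                        ≈⟨ fromℤ-⊖ m n ⟩
    fromℕ m - fromℕ n                    ≈⟨ sym (+-identityˡ _) ⟩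
    0# + (fromℕ m - fromℕ n)             ≈⟨ +-congʳ (sym (-‿inverseʳ 1#)) ⟩
    (1# - 1#) + (fromℕ m - fromℕ n)      ≈⟨ interchange _ _ _ _ ⟩
    fromℕ (suc m) + (- 1# - fromℕ n)     ≈⟨ +-congˡ (-‿+-comm _ _) ⟩
    fromℕ (suc m) - fromℕ (suc n)        ∎
    where
    open import Algebra.Properties.CommutativeSemigroup +-commutativeSemigroup using (interchange)

  fromℤ-neg : ∀ i → fromℤ (ℤ.- i) ≈ - fromℤ i
  fromℤ-neg (+ zero)  = sym -0#≈0#
  fromℤ-neg +[1+ n ]  = refl
  fromℤ-neg -[1+ n ]  = sym (-‿involutive _)

  fromℤ-+ : ∀ i j → fromℤ (i ℤ.+ j) ≈ fromℤ i + fromℤ j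
  fromℤ-+ (+ m)    (+ n)    = fromℕ-+ m n
  fromℤ-+ (+ m)    -[1+ n ] = fromℤ-⊖ m (suc n)
  fromℤ-+ -[1+ m ] (+ n)    = trans (fromℤ-⊖ n (suc m)) (+-comm _ _)
  fromℤ-+ -[1+ m ] -[1+ n ] = begin
    - fromℕ (suc (suc (m ℕ.+ n)))        ≡⟨ ≡.cong (λ k → - fromℕ (suc k)) (≡.sym (ℕₚ.+-suc m n)) ⟩
    - fromℕ (suc m ℕ.+ suc n)            ≈⟨ -‿cong (fromℕ-+ (suc m) (suc n)) ⟩
    - (fromℕ (suc m) + fromℕ (suc n))    ≈⟨ sym (-‿+-comm _ _) ⟩
    - fromℕ (suc m) - fromℕ (suc n)      ∎

  fromℤ-pos* : ∀ m j → fromℤ (+ m ℤ.* j) ≈ fromℕ m * fromℤ j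
  fromℤ-pos* m (+ n) = trans (reflexive (≡.cong fromℤ (≡.sym (ℤₚ.pos-* m n)))) (fromℕ-* m n)
  fromℤ-pos* m -[1+ n ] = begin
    fromℤ (+ m ℤ.* ℤ.- + suc n)        ≡⟨ ≡.cong fromℤ (≡.sym (ℤₚ.neg-distribʳ-* (+ m) (+ suc n))) ⟩
    fromℤ (ℤ.- (+ m ℤ.* + suc n))      ≈⟨ fromℤ-neg (+ m ℤ.* + suc n) ⟩
    - fromℤ (+ m ℤ.* + suc n)          ≈⟨ -‿cong (fromℤ-pos* m (+ suc n)) ⟩
    - (fromℕ m * fromℕ (suc n))        ≈⟨ -‿distribʳ-* _ _ ⟩
    fromℕ m * - fromℕ (suc n)          ∎

  fromℤ-* : ∀ i j → fromℤ (i ℤ.* j) ≈ fromℤ i * fromℤ j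
  fromℤ-* (+ m)    j = fromℤ-pos* m j
  fromℤ-* -[1+ m ] j = begin
    fromℤ (ℤ.- + suc m ℤ.* j)          ≡⟨ ≡.cong fromℤ (≡.sym (ℤₚ.neg-distribˡ-* (+ suc m) j)) ⟩
    fromℤ (ℤ.- (+ suc m ℤ.* j))        ≈⟨ fromℤ-neg (+ suc m ℤ.* j) ⟩
    - fromℤ (+ suc m ℤ.* j)            ≈⟨ -‿cong (fromℤ-pos* (suc m) j) ⟩
    - (fromℕ (suc m) * fromℤ j)        ≈⟨ -‿distribˡ-* _ _ ⟩
    - fromℕ (suc m) * fromℤ j          ∎

  -- Agrees with fromℤ, but sends 1 to 1# itself (not to 1# + 0#), so that
  -- the solver's constant con (+ 1) denotes 1#.
  coeff : ℤ → Carrier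
  coeff (+ 1)    = 1#
  coeff -[1+ 0 ] = - 1#
  coeff i        = fromℤ i

  coeff≈fromℤ : ∀ i → coeff i ≈ fromℤ i
  coeff≈fromℤ (+ 0)          = refl
  coeff≈fromℤ (+ 1)          = sym (+-identityʳ 1#)
  coeff≈fromℤ +[1+ suc n ]   = refl
  coeff≈fromℤ -[1+ 0 ]       = -‿cong (sym (+-identityʳ 1#))
  coeff≈fromℤ -[1+ suc n ]   = refl

  private
    coeff-hom : CommutativeRing.rawRing ℤₚ.+-*-commutativeRing -Raw-AlmostCommutative⟶ fromCommutativeRing commRing
    coeff-hom = record
      { ⟦_⟧    = coeff
      ; +-homo = λ i j → trans (coeff≈fromℤ (i ℤ.+ j)) (trans (fromℤ-+ i j)
                   (sym (+-cong (coeff≈fromℤ i) (coeff≈fromℤ j))))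
      ; *-homo = λ i j → trans (coeff≈fromℤ (i ℤ.* j)) (trans (fromℤ-* i j)
                   (sym (*-cong (coeff≈fromℤ i) (coeff≈fromℤ j))))
      ; -‿homo = λ i → trans (coeff≈fromℤ (ℤ.- i)) (trans (fromℤ-neg i) (sym (-‿cong (coeff≈fromℤ i))))
      ; 0-homo = refl
      ; 1-homo = refl
      }

    coeff-≟ : ∀ i j → Maybe (coeff i ≈ coeff j)
    coeff-≟ i j with i ℤ.≟ j
    ... | yes i≡j = just (reflexive (≡.cong coeff i≡j))
    ... | no _    = nothing

  open Algebra.Solver.Ring _ _ coeff-hom coeff-≟ public
    using (solve; _:=_; con; _:+_; _:*_; _:-_; :-_)

  x-y≈0⇒x≈y : ∀ {x y} → x - y ≈ 0# → x ≈ y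
  x-y≈0⇒x≈y {x} {y} e = begin
    x            ≈⟨ solve 2 (λ x y → x := (x :- y) :+ y) refl x y ⟩
    (x - y) + y  ≈⟨ +-congʳ e ⟩
    0# + y       ≈⟨ +-identityˡ y ⟩
    y            ∎

  x≈y⇒x-y≈0 : ∀ {x y} → x ≈ y → x - y ≈ 0#
  x≈y⇒x-y≈0 {x} {y} e = trans (+-congʳ e) (-‿inverseʳ y)

  -- A certificate of ideal membership: `a - b` is a multiple of the known zero `l - r`, and what
  -- remains is a polynomial identity for the solver. The explicit cofactors passed to `lincomb` and
  -- `lincomb₂` below are the quotients of such divisions.
  lincomb : ∀ c {a b l r} → l ≈ r → a - b ≈ c * (l - r) → a ≈ b
  lincomb c e h = x-y≈0⇒x≈y (trans h (trans (*-congˡ (x≈y⇒x-y≈0 e)) (zeroʳ c)))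

  lincomb₂ : ∀ c d {a b l r l′ r′} → l ≈ r → l′ ≈ r′ → a - b ≈ c * (l - r) + d * (l′ - r′) → a ≈ b
  lincomb₂ c d e e′ h = x-y≈0⇒x≈y (trans h (trans
    (+-cong (trans (*-congˡ (x≈y⇒x-y≈0 e)) (zeroʳ c)) (trans (*-congˡ (x≈y⇒x-y≈0 e′)) (zeroʳ d)))
    (+-identityˡ 0#)))

  *-cancelˡ-≉0 : ∀ {x y z} → ¬ x ≈ 0# → x * y ≈ x * z → y ≈ z
  *-cancelˡ-≉0 {x} {y} {z} x≉0 e = begin
    y                 ≈⟨ lincomb (- y) (⁻¹-inv x x≉0)
                           (solve 3 (λ x i y → y :- i :* (x :* y) := :- y :* (x :* i :- con (+ 1))) refl x (x ⁻¹) y) ⟩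
    x ⁻¹ * (x * y)    ≈⟨ *-congˡ e ⟩
    x ⁻¹ * (x * z)    ≈⟨ lincomb z (⁻¹-inv x x≉0)
                           (solve 3 (λ x i z → i :* (x :* z) :- z := z :* (x :* i :- con (+ 1))) refl x (x ⁻¹) z) ⟩
    z                 ∎

  x*y≈0⇒y≈0 : ∀ {x y} → ¬ x ≈ 0# → x * y ≈ 0# → y ≈ 0#
  x*y≈0⇒y≈0 {x} x≉0 e = *-cancelˡ-≉0 x≉0 (trans e (sym (zeroʳ x)))

  x*y≉0 : ∀ {x y} → ¬ x ≈ 0# → ¬ y ≈ 0# → ¬ x * y ≈ 0#
  x*y≉0 x≉0 y≉0 e = y≉0 (x*y≈0⇒y≈0 x≉0 e)

  x*y≈1⇒x≉0 : ∀ {x y} → x * y ≈ 1# → ¬ x ≈ 0#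
  x*y≈1⇒x≉0 {x} {y} e x≈0 = 0≉1 (trans (sym (zeroˡ y)) (trans (*-congʳ (sym x≈0)) e))

  ⁻¹-unique : ∀ {x y} → x * y ≈ 1# → x ⁻¹ ≈ y
  ⁻¹-unique {x} e = *-cancelˡ-≉0 x≉0 (trans (⁻¹-inv x x≉0) (sym e))
    where x≉0 = x*y≈1⇒x≉0 e

  x-y≉0 : ∀ {x y} → ¬ x ≈ y → ¬ x - y ≈ 0#
  x-y≉0 x≉y e = x≉y (x-y≈0⇒x≈y e)

  pow-cong : ∀ {x y} n → x ≈ y → pow x n ≈ pow y n
  pow-cong zero    e = refl
  pow-cong (suc n) e = *-cong e (pow-cong n e)

  pow-1# : ∀ n → pow 1# n ≈ 1#
  pow-1# zero    = refl
  pow-1# (suc n) = trans (*-identityˡ _) (pow-1# n)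

  pow-+ : ∀ x m n → pow x (m ℕ.+ n) ≈ pow x m * pow x n
  pow-+ x zero    n = sym (*-identityˡ _)
  pow-+ x (suc m) n = trans (*-congˡ (pow-+ x m n)) (sym (*-assoc _ _ _))

  pow-* : ∀ x m n → pow x (m ℕ.* n) ≈ pow (pow x n) m
  pow-* x zero    n = refl
  pow-* x (suc m) n = trans (pow-+ x n (m ℕ.* n)) (*-congˡ (pow-* x m n))

  pow-*′ : ∀ x m n → pow x (m ℕ.* n) ≈ pow (pow x m) n
  pow-*′ x m n = trans (reflexive (≡.cong (pow x) (ℕₚ.*-comm m n))) (pow-* x n m)

  pow-distrib : ∀ x y n → pow (x * y) n ≈ pow x n * pow y n
  pow-distrib x y zero    = sym (*-identityˡ 1#)
  pow-distrib x y (suc n) = trans (*-congˡ (pow-distrib x y n))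
    (solve 4 (λ x y p q → (x :* y) :* (p :* q) := (x :* p) :* (y :* q)) refl x y (pow x n) (pow y n))

  pow-multiple : ∀ {x n} m → pow x n ≈ 1# → pow x (m ℕ.* n) ≈ 1#
  pow-multiple {x} {n} m e = trans (pow-* x m n) (trans (pow-cong m e) (pow-1# m))

  pow-≉0 : ∀ {x} n → ¬ x ≈ 0# → ¬ pow x n ≈ 0#
  pow-≉0 zero    x≉0 e = 0≉1 (sym e)
  pow-≉0 (suc n) x≉0 = x*y≉0 x≉0 (pow-≉0 n x≉0)

  fromℕ-^ : ∀ m n → fromℕ (m ^ n) ≈ pow (fromℕ m) n
  fromℕ-^ m zero    = +-identityʳ 1#
  fromℕ-^ m (suc n) = trans (fromℕ-* m (m ^ n)) (*-congˡ (fromℕ-^ m n))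

  pow-∸ : ∀ {x i j} → ¬ x ≈ 0# → i ≤ j → pow x i ≈ pow x j → pow x (j ∸ i) ≈ 1#
  pow-∸ {x} {i} {j} x≉0 i≤j e = *-cancelˡ-≉0 (pow-≉0 i x≉0) (begin
    pow x i * pow x (j ∸ i)    ≈⟨ sym (pow-+ x i (j ∸ i)) ⟩
    pow x (i ℕ.+ (j ∸ i))      ≡⟨ ≡.cong (pow x) (ℕₚ.m+[n∸m]≡n i≤j) ⟩
    pow x j                    ≈⟨ sym e ⟩
    pow x i                    ≈⟨ sym (*-identityʳ _) ⟩
    pow x i * 1#               ∎)

  -- The exponents that send `x` to 1 are closed under differences. Both forms of `Bézout.Identity`
  -- keep the exponents in ℕ, so no inverse of `x` is taken.
  pow-bezout : ∀ {x a b d} → Bézout.Identity d a b → pow x a ≈ 1# → pow x b ≈ 1# → pow x d ≈ 1#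
  pow-bezout {x} {a} {b} {d} (Bézout.+- u v eq) ea eb = begin
    pow x d                          ≈⟨ sym (*-identityʳ _) ⟩
    pow x d * 1#                     ≈⟨ *-congˡ (sym (pow-multiple v eb)) ⟩
    pow x d * pow x (v ℕ.* b)        ≈⟨ sym (pow-+ x d (v ℕ.* b)) ⟩
    pow x (d ℕ.+ v ℕ.* b)            ≡⟨ ≡.cong (pow x) eq ⟩
    pow x (u ℕ.* a)                  ≈⟨ pow-multiple u ea ⟩
    1#                               ∎
  pow-bezout (Bézout.-+ u v eq) ea eb = pow-bezout (Bézout.+- v u eq) eb ea

-- Divisibility by primes and prime powers

prime∣prime⇒≡ : ∀ {r s} → Prime r → Prime s → r ∣ⁿ s → r ≡ s
prime∣prime⇒≡ pr ps r∣s with prime⇒irreducible ps r∣s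
... | inj₁ ≡.refl = ⊥-elim (¬prime[1] pr)
... | inj₂ r≡s    = r≡s

prime∣prime^⇒≡ : ∀ {r s} → Prime r → Prime s → ∀ k → r ∣ⁿ s ^ k → r ≡ s
prime∣prime^⇒≡ pr ps zero    r∣1 = ⊥-elim (¬prime[1] (≡.subst Prime (∣1⇒≡1 r∣1) pr))
prime∣prime^⇒≡ {s = s} pr ps (suc k) r∣s^ with euclidsLemma s (s ^ k) pr r∣s^
... | inj₁ r∣s   = prime∣prime⇒≡ pr ps r∣s
... | inj₂ r∣s^k = prime∣prime^⇒≡ pr ps k r∣s^k

prime∤⇒coprime : ∀ {r n} → Prime r → ¬ r ∣ⁿ n → Coprime r n
prime∤⇒coprime pr r∤n (d∣r , d∣n) with prime⇒irreducible pr d∣r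
... | inj₁ d≡1    = d≡1
... | inj₂ ≡.refl = ⊥-elim (r∤n d∣n)

primeDivisor : ∀ c → .{{NonZero c}} → c ≢ 1 → ∃[ r ] (Prime r × r ∣ⁿ c)
primeDivisor c c≢1 with factorise c
... | record { factors = [] ; isFactorisation = c≡1 } = ⊥-elim (c≢1 c≡1)
... | record { factors = r ∷ rs ; isFactorisation = c≡ ; factorsPrime = pr ∷ _ } =
  r , pr , divides (product rs) (≡.trans c≡ (ℕₚ.*-comm r (product rs)))

splitPrimePower : ∀ {r} → Prime r → ∀ n → 0 < n → ∃[ m ] ∃[ k ] (n ≡ m ℕ.* r ^ k × ¬ r ∣ⁿ m)
splitPrimePower {r} pr = <-rec _ step
  where
  step : ∀ n → (∀ {m} → m < n → 0 < m → ∃[ u ] ∃[ k ] (m ≡ u ℕ.* r ^ k × ¬ r ∣ⁿ u)) →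
         0 < n → ∃[ u ] ∃[ k ] (n ≡ u ℕ.* r ^ k × ¬ r ∣ⁿ u)
  step n rec 0<n with r ∣? n
  ... | no r∤n = n , 0 , ≡.sym (ℕₚ.*-identityʳ n) , r∤n
  step .(zero ℕ.* r) rec () | yes (divides zero ≡.refl)
  step .(suc q ℕ.* r) rec 0<n | yes (divides (suc q) ≡.refl) =
    let u , k , e , r∤u = rec (ℕₚ.m<m*n (suc q) r (ℕ.nonTrivial⇒n>1 r)) (s≤s z≤n)
    in u , suc k , ≡.trans (≡.cong (ℕ._* r) e) (≡.trans (ℕₚ.*-assoc u (r ^ k) r) (≡.cong (u ℕ.*_) (ℕₚ.*-comm (r ^ k) r))) , r∤u
    where
    open import Data.Nat.Primality using (prime⇒nonTrivial)
    instance _ = prime⇒nonTrivial pr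

-- Finite fields: permutations of the elements, roots of polynomials, cyclicity of the unit group

module FiniteFieldProperties (F : FiniteField) where
  open FiniteField F
  open FieldProperties field' public
  open DistinctLists _≈_ sym trans public
  open import Relation.Binary.Reasoning.Setoid setoid

  zero-product : ∀ {x y} → x * y ≈ 0# → x ≈ 0# ⊎ y ≈ 0#
  zero-product {x} e with x ≟ 0#
  ... | yes x≈0 = inj₁ x≈0
  ... | no  x≉0 = inj₂ (x*y≈0⇒y≈0 x≉0 e)

  -- Abstract, so that a case split on x ≟ 0# elsewhere leaves inv x folded.
  abstract
    inv : Carrier → Carrier
    inv x with x ≟ 0#
    ... | yes _ = 0#
    ... | no  _ = x ⁻¹

    inv-inverse : ∀ {x} → ¬ x ≈ 0# → x * inv x ≈ 1#
    inv-inverse {x} x≉0 with x ≟ 0#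
    ... | yes x≈0 = ⊥-elim (x≉0 x≈0)
    ... | no  x≉0 = ⁻¹-inv x x≉0

    inv-0 : ∀ {x} → x ≈ 0# → inv x ≈ 0#
    inv-0 {x} x≈0 with x ≟ 0#
    ... | yes _   = refl
    ... | no  x≉0 = ⊥-elim (x≉0 x≈0)

  inv-unique : ∀ {x y} → x * y ≈ 1# → inv x ≈ y
  inv-unique e = *-cancelˡ-≉0 x≉0 (trans (inv-inverse x≉0) (sym e))
    where x≉0 = x*y≈1⇒x≉0 e

  inv-cong : ∀ {x y} → x ≈ y → inv x ≈ inv y
  inv-cong {x} {y} x≈y with y ≟ 0#
  ... | yes y≈0 = trans (inv-0 (trans x≈y y≈0)) (sym (inv-0 y≈0))
  ... | no  y≉0 = inv-unique (trans (*-congʳ x≈y) (inv-inverse y≉0))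

  inv-≉0 : ∀ {x} → ¬ x ≈ 0# → ¬ inv x ≈ 0#
  inv-≉0 x≉0 = x*y≈1⇒x≉0 (trans (*-comm _ _) (inv-inverse x≉0))

  -- Sending 0 to 0 makes inversion a permutation of the whole field, so sums over `elements` can be
  -- reindexed by it without removing a point.
  inv-involutive : ∀ x → inv (inv x) ≈ x
  inv-involutive x with x ≟ 0#
  ... | yes x≈0 = trans (inv-0 (inv-0 x≈0)) (sym x≈0)
  ... | no  x≉0 = inv-unique (trans (*-comm _ _) (inv-inverse x≉0))

  inv-injective : ∀ {x y} → inv x ≈ inv y → x ≈ y
  inv-injective {x} {y} e = trans (sym (inv-involutive x)) (trans (inv-cong e) (inv-involutive y))

  all-elements : ∀ xs → xs ⊑ elements
  all-elements = All.universal complete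

  module _ (M : CommutativeMonoid 0ℓ 0ℓ) where
    private module M = CommutativeMonoid M
    open BigOp M

    ⨁-reindex : ∀ (h : Carrier → Carrier) → (∀ {x y} → h x ≈ h y → x ≈ y) →
                 (f : Carrier → M.Carrier) → (∀ {x y} → x ≈ y → f x M.≈ f y) →
                 ⨁ elements f M.≈ ⨁ elements (f ∘ h)
    ⨁-reindex h h-inj f f-resp = M.trans
      (M.sym (⨁-perm M f f-resp (AllPairsₚ.map⁺ (AllPairs.map (_∘ h-inj) distinct)) (all-elements _)
        (ℕₚ.≤-reflexive (≡.sym (length-map h elements)))))
      (⨁-map h elements f)

  -- Translation by 1 permutes the field, so the sum of all elements does not change when `size`
  -- copies of 1 are added to it.
  fromℕ-size : fromℕ size ≈ 0#
  fromℕ-size = lincomb (- 1#) shift (solve 2 (λ q s → q :- con 0ℤ := :- con 1ℤ :* (s :- (q :+ s))) refl (fromℕ size) total)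
    where
    open BigOp +-commutativeMonoid
    total = ⨁ elements (λ x → x)
    count : ∀ (xs : List Carrier) → ⨁ xs (λ _ → 1#) ≈ fromℕ (length xs)
    count []       = refl
    count (x ∷ xs) = +-congˡ (count xs)
    1+-injective : ∀ {x y} → 1# + x ≈ 1# + y → x ≈ y
    1+-injective {x} {y} e = lincomb 1# e (solve 2 (λ x y → x :- y := con 1ℤ :* ((con 1ℤ :+ x) :- (con 1ℤ :+ y))) refl x y)
    shift : total ≈ fromℕ size + total
    shift = begin
      total                                     ≈⟨ ⨁-reindex +-commutativeMonoid (λ x → 1# + x) 1+-injective (λ x → x) (λ e → e) ⟩
      ⨁ elements (λ x → 1# + x)                ≈⟨ ⨁-∙ elements (λ _ → 1#) (λ x → x) ⟩
      ⨁ elements (λ _ → 1#) + total            ≈⟨ +-congʳ (count elements) ⟩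
      fromℕ size + total                        ∎

  units : List Carrier
  units = filter (λ x → ¬? (x ≟ 0#)) elements

  units-≉0 : All (λ x → ¬ x ≈ 0#) units
  units-≉0 = Allₚ.all-filter _ elements

  units-complete : ∀ {x} → ¬ x ≈ 0# → Any (x ≈_) units
  units-complete {x} x≉0 = ∈-filter⁺ setoid _ (λ e x≉0 → x≉0 ∘ trans e) (complete x) x≉0

  units-distinct : Distinct units
  units-distinct = AllPairsₚ.filter⁺ _ distinct

  order : ℕ
  order = length units

  size≡suc-order : size ≡ suc order
  size≡suc-order = ℕₚ.≤-antisym
    (length-≤ distinct (All.universal 0-or-unit elements))
    (length-≤ (All.map (_∘ sym) units-≉0 ∷ units-distinct) (all-elements _))
    where
    0-or-unit : ∀ x → Any (x ≈_) (0# ∷ units)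
    0-or-unit x with x ≟ 0#
    ... | yes x≈0 = here x≈0
    ... | no  x≉0 = there (units-complete x≉0)

  0<order : 0 < order
  0<order = nonempty (units-complete (0≉1 ∘ sym))
    where
    nonempty : ∀ {xs} → Any (1# ≈_) xs → 0 < length xs
    nonempty (here _)  = s≤s z≤n
    nonempty (there _) = s≤s z≤n

  -- Multiplication by `x` permutes the units, hence fixes their product, while pulling out the
  -- factors contributes `pow x order`.
  fermat : ∀ {x} → ¬ x ≈ 0# → pow x order ≈ 1#
  fermat {x} x≉0 = *-cancelˡ-≉0 (Π≉0 units-≉0) (begin
    Π units * pow x order        ≈⟨ *-comm _ _ ⟩
    pow x order * Π units        ≈⟨ sym (Π-scale units) ⟩
    ⨁ units (x *_)              ≈⟨ sym (⨁-map (x *_) units (λ u → u)) ⟩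
    Π (map (x *_) units)         ≈⟨ ⨁-perm *-commutativeMonoid (λ u → u) (λ e → e)
                                      (AllPairsₚ.map⁺ (AllPairs.map (_∘ *-cancelˡ-≉0 x≉0) units-distinct))
                                      (Allₚ.map⁺ (All.map (λ u≉0 → units-complete (x*y≉0 x≉0 u≉0)) units-≉0))
                                      (ℕₚ.≤-reflexive (≡.sym (length-map (x *_) units))) ⟩
    Π units                      ≈⟨ sym (*-identityʳ _) ⟩
    Π units * 1#                 ∎)
    where
    open BigOp *-commutativeMonoid
    Π : List Carrier → Carrier
    Π xs = ⨁ xs (λ u → u)
    Π≉0 : ∀ {xs} → All (λ u → ¬ u ≈ 0#) xs → ¬ Π xs ≈ 0#
    Π≉0 []         = 0≉1 ∘ sym
    Π≉0 (u≉0 ∷ us) = x*y≉0 u≉0 (Π≉0 us)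
    Π-scale : ∀ xs → ⨁ xs (x *_) ≈ pow x (length xs) * Π xs
    Π-scale []       = sym (*-identityˡ 1#)
    Π-scale (u ∷ xs) = trans (*-congˡ (Π-scale xs))
      (solve 4 (λ x u p q → (x :* u) :* (p :* q) := (x :* p) :* (u :* q)) refl x u (pow x (length xs)) (Π xs))

  -- Horner form keeps the degree in the index and the polynomial only through its values, which is
  -- all that a count of roots needs.
  data Monic : ℕ → (Carrier → Carrier) → Set where
    one    : ∀ {f} → (∀ x → f x ≈ 1#) → Monic 0 f
    horner : ∀ {n f} c g → Monic n g → (∀ x → f x ≈ c + x * g x) → Monic (suc n) f

  monic-+ : ∀ {n g h} r → Monic (suc n) g → Monic n h → Monic (suc n) (λ x → g x + r * h x)
  monic-+ {g = g} {h} r (horner c g′ m eg) (one eh) = horner (c + r) g′ m λ x →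
    trans (+-cong (eg x) (*-congˡ (eh x)))
      (solve 4 (λ c x g r → (c :+ x :* g) :+ r :* con 1ℤ := (c :+ r) :+ x :* g) refl c x (g′ x) r)
    where open import Data.Integer using (+_)
  monic-+ {g = g} {h} r (horner c g′ m eg) (horner d h′ m′ eh) =
    horner (c + r * d) (λ x → g′ x + r * h′ x) (monic-+ r m m′) λ x →
      trans (+-cong (eg x) (*-congˡ (eh x)))
        (solve 6 (λ c x g r d h → (c :+ x :* g) :+ r :* (d :+ x :* h) := (c :+ r :* d) :+ x :* (g :+ r :* h))
          refl c x (g′ x) r d (h′ x))

  -- Synthetic division: if f(x) = c + x g(x), then f(x) - f(r) = (x - r) g(x) + r (g(x) - g(r)),
  -- and the last difference is divisible by induction.
  monic-quotient : ∀ {n f} → Monic (suc n) f → ∀ r →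
    ∃[ q ] (Monic n q × (∀ x → f x - f r ≈ (x - r) * q x))
  monic-quotient (horner c g (one eg) ef) r = g , one eg , λ x →
    trans (+-cong (trans (ef x) (+-congˡ (*-congˡ (eg x)))) (-‿cong (trans (ef r) (+-congˡ (*-congˡ (eg r))))))
      (trans (solve 3 (λ c x r → (c :+ x :* con 1ℤ) :- (c :+ r :* con 1ℤ) := (x :- r) :* con 1ℤ) refl c x r)
        (*-congˡ (sym (eg x))))
    where open import Data.Integer using (+_)
  monic-quotient {f = f} (horner c g m@(horner _ _ _ _) ef) r =
    let q , mq , eq = monic-quotient m r in
    (λ x → g x + r * q x) , monic-+ r m mq , λ x →
      lincomb₂ 1# 1# (+-cong (ef x) (-‿cong (ef r))) (*-congˡ {r} (eq x))
        (solve 8 (λ fx fr c x r gx gr qx →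
            (fx :- fr) :- (x :- r) :* (gx :+ r :* qx) :=
            con 1ℤ :* ((fx :- fr) :- ((c :+ x :* gx) :- (c :+ r :* gr))) :+
            con 1ℤ :* (r :* (gx :- gr) :- r :* ((x :- r) :* qx)))
          refl (f x) (f r) c x r (g x) (g r) (q x))
    where open import Data.Integer using (+_)

  roots-bound : ∀ {n f} → Monic n f → ∀ {xs} → Distinct xs → All (λ x → f x ≈ 0#) xs → length xs ≤ n
  roots-bound m [] [] = z≤n
  roots-bound (one e) (_ ∷ _) (r0 ∷ _) = ⊥-elim (0≉1 (trans (sym r0) (e _)))
  roots-bound {f = f} m@(horner _ _ _ _) {r ∷ xs} (r≉xs ∷ dxs) (r0 ∷ xs0) =
    let q , mq , eq = monic-quotient m r in
    s≤s (roots-bound mq dxs (All.zipWith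
      (λ {x} (r≉x , x0) → x*y≈0⇒y≈0 (x-y≉0 (r≉x ∘ sym))
        (trans (sym (eq x)) (trans (+-cong x0 (-‿cong r0)) (-‿inverseʳ 0#)))) (r≉xs , xs0)))

  pow-monic : ∀ n → Monic n (λ x → pow x n)
  pow-monic zero    = one (λ _ → refl)
  pow-monic (suc n) = horner 0# _ (pow-monic n) (λ x → sym (+-identityˡ _))

  -- The polynomial x^d - 1 has at most d roots, fewer than there are units.
  ∃-pow≉1 : ∀ {d} → d < order → 0 < d → ∃[ x ] (¬ x ≈ 0# × ¬ pow x d ≈ 1#)
  ∃-pow≉1 {suc d} d<N _ with All.all? (λ x → pow x (suc d) ≟ 1#) units
  ... | yes all = ⊥-elim (ℕₚ.<⇒≱ d<N (roots-bound
          (horner (- 1#) (λ x → pow x d) (pow-monic d) (λ x → refl)) units-distinct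
          (All.map (λ {x} e → trans (+-congˡ e) (-‿inverseˡ 1#)) all)))
  ... | no ¬all = go units-≉0 (Allₚ.¬All⇒Any¬ (λ x → pow x (suc d) ≟ 1#) units ¬all)
    where
    go : ∀ {xs} → All (λ x → ¬ x ≈ 0#) xs → Any (λ x → ¬ pow x (suc d) ≈ 1#) xs → ∃[ x ] (¬ x ≈ 0# × ¬ pow x (suc d) ≈ 1#)
    go (x≉0 ∷ _) (here p)  = _ , x≉0 , p
    go (_ ∷ xs)  (there p) = go xs p

  -- g is tested against the prime divisors of the group order lying in rs only.
  HasOrderAt : List ℕ → Carrier → Set
  HasOrderAt rs g = ∀ {r} m → r ∈ rs → order ≡ m ℕ.* r → ¬ pow g m ≈ 1#

  -- Write the group order as M r^k with r not dividing M, and take y = x^M for an x with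
  -- x^(order/r) ≠ 1. If y^(order/r) were 1, then x^(order/r) would be killed by both M and r, which
  -- are coprime. Any other prime s dividing the order divides M, so that y^(order/s) is a power of
  -- x^order.
  primePart : ∀ {r} → Prime r → r ∣ⁿ order →
    ∃[ y ] (¬ y ≈ 0# × (∀ m → order ≡ m ℕ.* r → ¬ pow y m ≈ 1#)
            × (∀ {s} m → Prime s → s ≢ r → order ≡ m ℕ.* s → pow y m ≈ 1#))
  primePart {r} pr (divides m₀ N≡) with splitPrimePower pr order 0<order
  ... | M , k , N≡M*r^k , r∤M = y , pow-≉0 M x≉0 , ≉1 , ≈1
    where
    instance
      _ = prime⇒nonZero pr
    open import Data.Nat.Primality using (prime⇒nonTrivial)
    0<m₀ : 0 < m₀
    0<m₀ = ℕₚ.n≢0⇒n>0 λ m₀≡0 → ℕₚ.<⇒≢ 0<order (≡.sym (≡.trans N≡ (≡.cong (ℕ._* r) m₀≡0)))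
    m₀<N : m₀ < order
    m₀<N = ≡.subst (m₀ <_) (≡.sym N≡) (ℕₚ.m<m*n m₀ r {{ℕ.>-nonZero 0<m₀}} (ℕ.nonTrivial⇒n>1 r {{prime⇒nonTrivial pr}}))
    nonroot = ∃-pow≉1 m₀<N 0<m₀
    x    = proj₁ nonroot
    x≉0  = proj₁ (proj₂ nonroot)
    x^≉1 = proj₂ (proj₂ nonroot)
    y = pow x M
    ≉1 : ∀ m → order ≡ m ℕ.* r → ¬ pow y m ≈ 1#
    ≉1 m e y^m≈1 with ℕₚ.*-cancelʳ-≡ m₀ m r (≡.trans (≡.sym N≡) e)
    ... | ≡.refl = x^≉1 (trans (sym (*-identityʳ _)) (pow-bezout (coprime-Bézout (prime∤⇒coprime pr r∤M))
                     (trans (sym (pow-*′ x m r)) (trans (reflexive (≡.cong (pow x) (≡.sym e))) (fermat x≉0)))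
                     (trans (sym (pow-*′ x m M)) (trans (pow-* x m M) y^m≈1))))
    ≈1 : ∀ {s} m → Prime s → s ≢ r → order ≡ m ℕ.* s → pow y m ≈ 1#
    ≈1 {s} m ps s≢r e with euclidsLemma M (r ^ k) ps (divides m (≡.trans (≡.sym N≡M*r^k) e))
    ... | inj₂ s∣r^k = ⊥-elim (s≢r (prime∣prime^⇒≡ ps pr k s∣r^k))
    ... | inj₁ (divides M′ M≡M′*s) = begin
      pow (pow x M) m                ≈⟨ sym (pow-* x m M) ⟩
      pow x (m ℕ.* M)                ≡⟨ ≡.cong (pow x) exponents ⟩
      pow x (M′ ℕ.* order)           ≈⟨ pow-multiple M′ (fermat x≉0) ⟩
      1#                             ∎
      where
      exponents : m ℕ.* M ≡ M′ ℕ.* order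
      exponents = ≡.trans (≡.cong (m ℕ.*_) M≡M′*s) (≡.trans (≡.sym (ℕₚ.*-assoc m M′ s))
        (≡.trans (≡.cong (ℕ._* s) (ℕₚ.*-comm m M′)) (≡.trans (ℕₚ.*-assoc M′ m s) (≡.cong (M′ ℕ.*_) (≡.sym e)))))

  -- One prime is treated at a time. If `g` fails the test at `r`, it is multiplied by the element
  -- of `primePart`, which repairs this test and contributes the factor 1 to the tests at all other
  -- primes.
  hasOrderAt : ∀ {rs} → All Prime rs → All (_∣ⁿ order) rs → ∃[ g ] (¬ g ≈ 0# × HasOrderAt rs g)
  hasOrderAt [] [] = 1# , 0≉1 ∘ sym , λ _ ()
  hasOrderAt {r ∷ rs} (pr ∷ prs) (r∣N@(divides m₀ N≡) ∷ rs∣N) with hasOrderAt prs rs∣N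
  ... | g , g≉0 , hg with pow g m₀ ≟ 1#
  ... | no  g^≉1 = g , g≉0 , λ where
        m (here ≡.refl) e → g^≉1 ∘ trans (reflexive (≡.cong (pow g)
          (ℕₚ.*-cancelʳ-≡ m₀ m r {{prime⇒nonZero pr}} (≡.trans (≡.sym N≡) e))))
        m (there s∈rs) → hg m s∈rs
  ... | yes g^≈1 with primePart pr r∣N
  ... | y , y≉0 , ≉1 , ≈1 = g * y , x*y≉0 g≉0 y≉0 , λ where
        m (here ≡.refl) e e′ → ≉1 m e (trans (sym (*-identityˡ _)) (trans (*-congʳ (sym
          (trans (reflexive (≡.cong (pow g) (ℕₚ.*-cancelʳ-≡ m m₀ r {{prime⇒nonZero pr}} (≡.trans (≡.sym e) N≡)))) g^≈1)))
          (trans (sym (pow-distrib g y m)) e′)))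
        {s} m (there s∈rs) e e′ →
          hg m s∈rs e (trans (sym (*-identityʳ _)) (trans
            (*-congˡ (sym (≈1 m (All.lookup prs s∈rs)
              -- The list may repeat a prime. If `r` occurs again in `rs`, then `g` already passes
              -- the test at `r`, contrary to `g^≈1`.
              (λ { ≡.refl → hg m₀ s∈rs N≡ g^≈1 }) e)))
            (trans (sym (pow-distrib g y m)) e′)))

  IsGenerator : Carrier → Set
  IsGenerator g = ¬ g ≈ 0# × (∀ j → pow g j ≈ 1# → order ∣ⁿ j)

  -- Abstract to keep conversion checking from unfolding the search for a generator.
  abstract
    generator : ∃[ g ] IsGenerator g
    generator with factorise order {{ℕ.>-nonZero 0<order}}
    ... | record { factors = rs ; isFactorisation = N≡ ; factorsPrime = prs }
      with hasOrderAt prs (All.tabulate (λ r∈rs → ≡.subst (_ ∣ⁿ_) (≡.sym N≡) (∈⇒∣product r∈rs)))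
    ... | g , g≉0 , hg = g , g≉0 , order∣
      where
      -- With d = gcd(j, order) also g^d = 1. If the cofactor c = order/d had a prime divisor r,
      -- then order/r would be a multiple of d, and `g` would fail its test at r.
      order∣ : ∀ j → pow g j ≈ 1# → order ∣ⁿ j
      order∣ j e with gcd[m,n]∣n j order
      ... | divides c N≡c*d with c ℕ.≟ 1
      ... | yes ≡.refl = ≡.subst (_∣ⁿ j) (≡.sym (≡.trans N≡c*d (ℕₚ.*-identityˡ _))) (gcd[m,n]∣m j order)
      ... | no  c≢1 with primeDivisor c {{ℕ.≢-nonZero λ { ≡.refl → ℕₚ.<⇒≢ 0<order (≡.sym N≡c*d) }}} c≢1
      ... | r , pr , divides c′ c≡c′*r =
        ⊥-elim (hg (c′ ℕ.* gcd j order)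
          (factorisationHasAllPrimeFactors pr (divides (c′ ℕ.* gcd j order) (≡.trans (≡.sym N≡) order≡)) prs)
          order≡
          (pow-multiple c′ (pow-bezout (Bézout.identity (gcd-GCD j order)) e (fermat g≉0))))
        where
        order≡ : order ≡ c′ ℕ.* gcd j order ℕ.* r
        order≡ = ≡.trans N≡c*d (≡.trans (≡.cong (ℕ._* gcd j order) c≡c′*r) (≡.trans (ℕₚ.*-assoc c′ r _)
          (≡.trans (≡.cong (c′ ℕ.*_) (ℕₚ.*-comm r _)) (≡.sym (ℕₚ.*-assoc c′ _ r)))))

    -- The first `order` powers of a generator are distinct units, hence by pigeonhole all of them.
    log : ∀ {g} → IsGenerator g → ∀ {x} → ¬ x ≈ 0# → ∃[ i ] (i < order × x ≈ pow g i)
    log {g} (g≉0 , order∣) {x} x≉0 =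
      Anyₚ.applyUpTo⁻ (pow g) (exhaustive {powers} {units} powers-distinct
            (Allₚ.applyUpTo⁺₂ (pow g) order (λ i → units-complete (pow-≉0 i g≉0)))
            (ℕₚ.≤-reflexive (≡.sym (length-applyUpTo (pow g) order)))
            (units-complete x≉0) (x ≟ _))
      where
      powers : List Carrier
      powers = applyUpTo (pow g) order
      powers-distinct : Distinct powers
      powers-distinct = AllPairsₚ.applyUpTo⁺₁ (pow g) order λ {i} {j} i<j j<N e →
        ℕₚ.<⇒≱ (ℕₚ.≤-<-trans (ℕₚ.m∸n≤m j i) j<N)
          (∣⇒≤ {{ℕ.>-nonZero (ℕₚ.m<n⇒0<n∸m i<j)}} (order∣ (j ∸ i) (pow-∸ g≉0 (ℕₚ.<⇒≤ i<j) e)))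

-- Sums over the finite field, the quadratic character, values of multiplicative characters

module Sums (𝔽 : FiniteField) (𝕂 : CharZeroField) where
  module F where
    open FiniteField 𝔽 public renaming (_≟_ to infix 4 _≟_)
    open FiniteFieldProperties 𝔽 public
  open CharZeroField 𝕂 public
  open FieldProperties field' public
  open BigOp +-commutativeMonoid public
  open import Relation.Binary.Reasoning.Setoid setoid

  Respectful : (F.Carrier → Carrier) → Set
  Respectful f = ∀ {x y} → x F.≈ y → f x ≈ f y

  ∑ : (F.Carrier → Carrier) → Carrier
  ∑ = ⨁ F.elements

  ∑-cong : ∀ {f g} → (∀ x → f x ≈ g x) → ∑ f ≈ ∑ g
  ∑-cong = ⨁-cong F.elements

  ∑-+ : ∀ f g → ∑ (λ x → f x + g x) ≈ ∑ f + ∑ g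
  ∑-+ = ⨁-∙ F.elements

  ∑-swap : ∀ (f : F.Carrier → F.Carrier → Carrier) → ∑ (λ x → ∑ (f x)) ≈ ∑ (λ y → ∑ (λ x → f x y))
  ∑-swap = ⨁-swap F.elements F.elements

  ⨁-*ˡ : ∀ {A : Set} c (xs : List A) f → ⨁ xs (λ x → c * f x) ≈ c * ⨁ xs f
  ⨁-*ˡ c []       f = sym (zeroʳ c)
  ⨁-*ˡ c (x ∷ xs) f = trans (+-congˡ (⨁-*ˡ c xs f)) (sym (distribˡ _ _ _))

  ∑-*ˡ : ∀ c f → ∑ (λ x → c * f x) ≈ c * ∑ f
  ∑-*ˡ c = ⨁-*ˡ c F.elements

  ∑-*ʳ : ∀ c f → ∑ (λ x → f x * c) ≈ ∑ f * c
  ∑-*ʳ c f = trans (∑-cong (λ x → *-comm _ _)) (trans (∑-*ˡ c f) (*-comm _ _))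

  ⨁-1 : ∀ {A : Set} (xs : List A) → ⨁ xs (λ _ → 1#) ≈ fromℕ (length xs)
  ⨁-1 []       = refl
  ⨁-1 (x ∷ xs) = +-congˡ (⨁-1 xs)

  q : Carrier
  q = fromℕ F.size

  ∑-1 : ∑ (λ _ → 1#) ≈ q
  ∑-1 = ⨁-1 F.elements

  ∑-reindex : ∀ h → (∀ {x y} → h x F.≈ h y → x F.≈ y) → ∀ {f} → Respectful f → ∑ f ≈ ∑ (f ∘ h)
  ∑-reindex h h-inj {f} = F.⨁-reindex +-commutativeMonoid h h-inj f

  𝟙 : ∀ {P : Set} → Dec P → Carrier
  𝟙 (yes _) = 1#
  𝟙 (no _)  = 0#

  𝟙-yes : ∀ {P : Set} (d : Dec P) → P → 𝟙 d ≈ 1#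
  𝟙-yes (yes _) p = refl
  𝟙-yes (no ¬p) p = ⊥-elim (¬p p)

  𝟙-no : ∀ {P : Set} (d : Dec P) → ¬ P → 𝟙 d ≈ 0#
  𝟙-no (yes p) ¬p = ⊥-elim (¬p p)
  𝟙-no (no _)  ¬p = refl

  𝟙-cong : ∀ {P Q : Set} (d : Dec P) (e : Dec Q) → (P → Q) → (Q → P) → 𝟙 d ≈ 𝟙 e
  𝟙-cong (yes p) e f g = sym (𝟙-yes e (f p))
  𝟙-cong (no ¬p) e f g = sym (𝟙-no e (¬p ∘ g))

  ∑-δ : ∀ a {f} → Respectful f → ∑ (λ x → 𝟙 (x F.≟ a) * f x) ≈ f a
  ∑-δ a {f} f-resp = begin
    ∑ (λ x → 𝟙 (x F.≟ a) * f x)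
      ≈⟨ F.⨁-single +-commutativeMonoid {P = λ _ → ⊤} _
           (λ {x} a≈x → *-cong (𝟙-cong (x F.≟ a) (a F.≟ a) (λ _ → F.refl) (λ _ → F.sym a≈x)) (f-resp (F.sym a≈x)))
           (λ {x} _ a≉x → trans (*-congʳ (𝟙-no (x F.≟ a) (a≉x ∘ F.sym))) (zeroˡ _))
           (All.universal (λ _ → tt) F.elements) (F.complete a) F.distinct ⟩
    𝟙 (a F.≟ a) * f a   ≈⟨ *-congʳ (𝟙-yes (a F.≟ a) F.refl) ⟩
    1# * f a            ≈⟨ *-identityˡ _ ⟩
    f a                 ∎

  ∑-𝟙 : ∀ a → ∑ (λ x → 𝟙 (x F.≟ a)) ≈ 1#
  ∑-𝟙 a = trans (∑-cong (λ x → sym (*-identityʳ _))) (∑-δ a (λ _ → refl))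

  ∑-𝟙-*ʳ : ∀ a c → ∑ (λ x → 𝟙 (x F.≟ a) * c) ≈ c
  ∑-𝟙-*ʳ a c = trans (∑-*ʳ c _) (trans (*-congʳ (∑-𝟙 a)) (*-identityˡ c))

  ∑-fibres : ∀ (w : F.Carrier → Carrier) (h : F.Carrier → F.Carrier) {H} → Respectful H →
    ∑ (λ m → w m * H (h m)) ≈ ∑ (λ s → H s * ∑ (λ m → w m * 𝟙 (s F.≟ h m)))
  ∑-fibres w h {H} H-resp = begin
    ∑ (λ m → w m * H (h m))
      ≈⟨ ∑-cong (λ m → *-congˡ (sym (∑-δ (h m) H-resp))) ⟩
    ∑ (λ m → w m * ∑ (λ s → 𝟙 (s F.≟ h m) * H s))
      ≈⟨ ∑-cong (λ m → sym (∑-*ˡ (w m) _)) ⟩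
    ∑ (λ m → ∑ (λ s → w m * (𝟙 (s F.≟ h m) * H s)))
      ≈⟨ ∑-swap _ ⟩
    ∑ (λ s → ∑ (λ m → w m * (𝟙 (s F.≟ h m) * H s)))
      ≈⟨ ∑-cong (λ s → ∑-cong (λ m →
           solve 3 (λ w i h → w :* (i :* h) := h :* (w :* i)) refl (w m) (𝟙 (s F.≟ h m)) (H s))) ⟩
    ∑ (λ s → ∑ (λ m → H s * (w m * 𝟙 (s F.≟ h m))))
      ≈⟨ ∑-cong (λ s → ∑-*ˡ (H s) _) ⟩
    ∑ (λ s → H s * ∑ (λ m → w m * 𝟙 (s F.≟ h m))) ∎

  IsSquare : F.Carrier → Set
  IsSquare x = ∃[ y ] y F.* y F.≈ x

  any-element? : ∀ {P : F.Carrier → Set} → (∀ {x y} → x F.≈ y → P x → P y) → (∀ x → Dec (P x)) → Dec (∃[ x ] P x)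
  any-element? P-resp P? = map′ (λ p → Any.lookup p , Anyₚ.lookup-result p)
    (λ (x , px) → Any.map (λ x≈y → P-resp x≈y px) (F.complete x)) (Any.any? P? F.elements)
    where import Data.List.Relation.Unary.Any.Properties as Anyₚ

  isSquare? : ∀ x → Dec (IsSquare x)
  isSquare? x = any-element? (λ y≈z → F.trans (F.sym (F.*-cong y≈z y≈z))) (λ y → y F.* y F.≟ x)

  -- The quadratic character, through its characterisation by numbers of square roots.
  φ : F.Carrier → Carrier
  φ x = ∑ (λ y → 𝟙 (y F.* y F.≟ x)) - 1#

  φ-resp : Respectful φ
  φ-resp {x} {y} x≈y = +-congʳ (∑-cong (λ z → 𝟙-cong (z F.* z F.≟ x) (z F.* z F.≟ y)
    (λ e → F.trans e x≈y) (λ e → F.trans e (F.sym x≈y))))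

  φ-scale : ∀ {a} x → ¬ a F.≈ F.0# → φ (a F.* a F.* x) ≈ φ x
  φ-scale {a} x a≉0 = +-congʳ (trans
    (∑-reindex (a F.*_) (F.*-cancelˡ-≉0 a≉0)
      (λ {y} {z} y≈z → 𝟙-cong (y F.* y F.≟ _) (z F.* z F.≟ _)
        (F.trans (F.sym (F.*-cong y≈z y≈z))) (F.trans (F.*-cong y≈z y≈z))))
    (∑-cong (λ y → 𝟙-cong (a F.* y F.* (a F.* y) F.≟ _) (y F.* y F.≟ x)
      (λ e → F.*-cancelˡ-≉0 (F.x*y≉0 a≉0 a≉0) (F.trans (sq a y) e))
      (λ e → F.trans (F.sym (sq a y)) (F.*-congˡ e)))))
    where
    sq : ∀ a y → a F.* a F.* (y F.* y) F.≈ a F.* y F.* (a F.* y)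
    sq a y = F.solve 2 (λ a y → a F.:* a F.:* (y F.:* y) F.:= a F.:* y F.:* (a F.:* y)) F.refl a y

  -- Every `y` is a square root of exactly one `x`, so the root counts add up to q, and subtracting
  -- 1 for each `x` leaves nothing.
  ∑-φ : ∑ φ ≈ 0#
  ∑-φ = begin
    ∑ φ
      ≈⟨ ∑-+ _ _ ⟩
    ∑ (λ x → ∑ (λ y → 𝟙 (y F.* y F.≟ x))) + ∑ (λ _ → - 1#)
      ≈⟨ +-congʳ (∑-swap _) ⟩
    ∑ (λ y → ∑ (λ x → 𝟙 (y F.* y F.≟ x))) + ∑ (λ _ → - 1#)
      ≈⟨ +-congʳ (∑-cong (λ y → trans
           (∑-cong (λ x → 𝟙-cong (y F.* y F.≟ x) (x F.≟ y F.* y) F.sym F.sym)) (∑-𝟙 (y F.* y)))) ⟩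
    ∑ (λ _ → 1#) + ∑ (λ _ → - 1#)
      ≈⟨ sym (∑-+ _ _) ⟩
    ∑ (λ _ → 1# - 1#)
      ≈⟨ trans (∑-cong (λ _ → -‿inverseʳ 1#)) (⨁-unit F.elements) ⟩
    0# ∎

  ∑-φ-affine : ∀ a {c} → ¬ c F.≈ F.0# → ∑ (λ x → φ (a F.+ c F.* x)) ≈ 0#
  ∑-φ-affine a {c} c≉0 = trans (sym (∑-reindex (λ x → a F.+ c F.* x)
    (λ {x} {y} e → F.*-cancelˡ-≉0 c≉0 (F.lincomb F.1# e
      (F.solve 3 (λ a u v → u F.:- v F.:= F.con 1ℤ F.:* ((a F.:+ u) F.:- (a F.:+ v))) F.refl a (c F.* x) (c F.* y))))
    φ-resp)) ∑-φ

  module OddCharacteristic (2≉0 : ¬ F.fromℕ 2 F.≈ F.0#) where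

    4≉0 : ¬ F.fromℕ 4 F.≈ F.0#
    4≉0 = F.x*y≉0 2≉0 2≉0 ∘ F.trans (F.sym (F.fromℕ-* 2 2))

    φ-4 : ∀ x → φ (F.fromℕ 4 F.* x) ≈ φ x
    φ-4 x = trans (φ-resp (F.*-congʳ (F.fromℕ-* 2 2))) (φ-scale x 2≉0)

    count-quadratic : ∀ b c → ∑ (λ y → 𝟙 (y F.* y F.+ b F.* y F.≟ c)) ≈ 1# + φ (b F.* b F.+ F.fromℕ 4 F.* c)
    count-quadratic b c = begin
      ∑ (λ y → 𝟙 (y F.* y F.+ b F.* y F.≟ c))
        ≈⟨ ∑-cong (λ y → 𝟙-cong (y F.* y F.+ b F.* y F.≟ c) (complete-square y F.* complete-square y F.≟ D)
             (λ e → F.lincomb (F.fromℕ 4) e (identity y))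
             (λ e → F.*-cancelˡ-≉0 4≉0 (F.lincomb F.1# e (identity′ y)))) ⟩
      ∑ (λ y → 𝟙 (complete-square y F.* complete-square y F.≟ D))
        ≈⟨ sym (∑-reindex complete-square
             (λ {x} {y} e → F.*-cancelˡ-≉0 2≉0 (F.lincomb F.1# e
               (F.solve 3 (λ b u v → u F.:- v F.:= F.con 1ℤ F.:* ((u F.:+ b) F.:- (v F.:+ b))) F.refl b _ _)))
             (λ {y} {z} y≈z → 𝟙-cong (y F.* y F.≟ D) (z F.* z F.≟ D)
               (F.trans (F.sym (F.*-cong y≈z y≈z))) (F.trans (F.*-cong y≈z y≈z)))) ⟩
      ∑ (λ y → 𝟙 (y F.* y F.≟ D))
        ≈⟨ solve 1 (λ t → t := con 1ℤ :+ (t :- con 1ℤ)) refl _ ⟩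
      1# + φ D ∎
      where
      D = b F.* b F.+ F.fromℕ 4 F.* c
      complete-square : F.Carrier → F.Carrier
      complete-square y = F.fromℕ 2 F.* y F.+ b
      identity : ∀ y → complete-square y F.* complete-square y F.- D F.≈ F.fromℕ 4 F.* ((y F.* y F.+ b F.* y) F.- c)
      identity y = F.solve 3 (λ b c y → (F.con (+ 2) F.:* y F.:+ b) F.:* (F.con (+ 2) F.:* y F.:+ b) F.:- (b F.:* b F.:+ F.con (+ 4) F.:* c)
        F.:= F.con (+ 4) F.:* ((y F.:* y F.:+ b F.:* y) F.:- c)) F.refl b c y
      identity′ : ∀ y → F.fromℕ 4 F.* (y F.* y F.+ b F.* y) F.- F.fromℕ 4 F.* c F.≈ F.1# F.* (complete-square y F.* complete-square y F.- D)
      identity′ y = F.solve 3 (λ b c y → F.con (+ 4) F.:* (y F.:* y F.:+ b F.:* y) F.:- F.con (+ 4) F.:* c F.:=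
        F.con 1ℤ F.:* ((F.con (+ 2) F.:* y F.:+ b) F.:* (F.con (+ 2) F.:* y F.:+ b) F.:- (b F.:* b F.:+ F.con (+ 4) F.:* c))) F.refl b c y

    φ-0 : ∀ {x} → x F.≈ F.0# → φ x ≈ 0#
    φ-0 {x} x≈0 = trans (+-congʳ (trans (∑-cong (λ y → 𝟙-cong (y F.* y F.≟ x) (y F.≟ F.0#)
        (λ e → root (F.zero-product (F.trans e x≈0)))
        (λ e → F.trans (F.*-congʳ e) (F.trans (F.zeroˡ y) (F.sym x≈0)))))
      (∑-𝟙 F.0#))) (-‿inverseʳ 1#)
      where
      root : ∀ {y} → y F.≈ F.0# ⊎ y F.≈ F.0# → y F.≈ F.0#
      root (inj₁ e) = e
      root (inj₂ e) = e

    φ-nonsquare : ∀ {x} → ¬ IsSquare x → φ x ≈ - 1#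
    φ-nonsquare {x} ¬sq = trans (+-congʳ (trans
      (∑-cong (λ y → 𝟙-no (y F.* y F.≟ x) (λ e → ¬sq (y , e)))) (⨁-unit F.elements))) (+-identityˡ _)

    φ-square : ∀ {x} → IsSquare x → ¬ x F.≈ F.0# → φ x ≈ 1#
    φ-square {x} (a , a²≈x) x≉0 = begin
      ∑ (λ y → 𝟙 (y F.* y F.≟ x)) - 1#
        ≈⟨ +-congʳ (trans (∑-cong two-roots) (trans (∑-+ _ _) (+-cong (∑-𝟙 a) (∑-𝟙 (F.- a))))) ⟩
      (1# + 1#) - 1#
        ≈⟨ solve 0 ((con 1ℤ :+ con 1ℤ) :- con 1ℤ := con 1ℤ) refl ⟩
      1# ∎
      where
      a≉0 : ¬ a F.≈ F.0#
      a≉0 e = x≉0 (F.trans (F.sym a²≈x) (F.trans (F.*-congʳ e) (F.zeroˡ a)))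
      a≉-a : ¬ a F.≈ F.- a
      a≉-a e = F.x*y≉0 2≉0 a≉0 (F.lincomb F.1# e
        (F.solve 1 (λ a → F.con (+ 2) F.:* a F.:- F.con 0ℤ F.:= F.con 1ℤ F.:* (a F.:- F.:- a)) F.refl a))
      two-roots : ∀ y → 𝟙 (y F.* y F.≟ x) ≈ 𝟙 (y F.≟ a) + 𝟙 (y F.≟ F.- a)
      two-roots y with y F.≟ a | y F.≟ F.- a
      ... | yes e | yes e′ = ⊥-elim (a≉-a (F.trans (F.sym e) e′))
      ... | yes e | no _ = trans (𝟙-yes (y F.* y F.≟ x) (F.trans (F.*-cong e e) a²≈x)) (sym (+-identityʳ 1#))
      ... | no _ | yes e = trans (𝟙-yes (y F.* y F.≟ x) (F.trans (F.*-cong e e) (F.trans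
              (F.solve 1 (λ a → F.:- a F.:* F.:- a F.:= a F.:* a) F.refl a) a²≈x))) (sym (+-identityˡ 1#))
      ... | no n | no n′ = trans (𝟙-no (y F.* y F.≟ x) neither) (sym (+-identityˡ 0#))
        where
        neither : ¬ y F.* y F.≈ x
        neither e with F.zero-product {y F.- a} {y F.+ a} (F.lincomb F.1# (F.trans e (F.sym a²≈x))
          (F.solve 2 (λ y a → (y F.:- a) F.:* (y F.:+ a) F.:- F.con 0ℤ F.:= F.con 1ℤ F.:* (y F.:* y F.:- a F.:* a)) F.refl y a))
        ... | inj₁ e₁ = n (F.x-y≈0⇒x≈y e₁)
        ... | inj₂ e₂ = n′ (F.lincomb F.1# e₂
          (F.solve 2 (λ y a → y F.:- F.:- a F.:= F.con 1ℤ F.:* ((y F.:+ a) F.:- F.con 0ℤ)) F.refl y a))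

  module CharacterProperties {χ : F.Carrier → Carrier} (χ-char : IsCharacter 𝔽 𝕂 χ) where

    χ-resp : Respectful χ
    χ-resp = proj₁ χ-char

    χ-0 : ∀ {x} → x F.≈ F.0# → χ x ≈ 0#
    χ-0 e = trans (χ-resp e) (proj₁ (proj₂ χ-char))

    χ-1 : ∀ {x} → x F.≈ F.1# → χ x ≈ 1#
    χ-1 e = trans (χ-resp e) (proj₁ (proj₂ (proj₂ χ-char)))

    χ-* : ∀ x y → χ (x F.* y) ≈ χ x * χ y
    χ-* = proj₂ (proj₂ (proj₂ χ-char))

    χ-inverse : ∀ {k} → ¬ k F.≈ F.0# → χ k * χ (F.inv k) ≈ 1#
    χ-inverse {k} k≉0 = trans (sym (χ-* k (F.inv k))) (χ-1 (F.inv-inverse k≉0))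

    χ-pow : ∀ x n → χ (F.pow x n) ≈ pow (χ x) n
    χ-pow x zero    = χ-1 F.refl
    χ-pow x (suc n) = trans (χ-* x (F.pow x n)) (*-congˡ (χ-pow x n))

    χ-neg1² : χ (F.- F.1#) * χ (F.- F.1#) ≈ 1#
    χ-neg1² = trans (sym (χ-* _ _)) (χ-1 (F.solve 0 (F.:- F.con 1ℤ F.:* F.:- F.con 1ℤ F.:= F.con 1ℤ) F.refl))

    bar≈inv : ∀ z → bar 𝔽 𝕂 χ z ≈ χ (F.inv z)
    bar≈inv z with z F.≟ F.0#
    ... | yes z≈0 = sym (χ-0 (F.inv-0 z≈0))
    ... | no  z≉0 = ⁻¹-unique (χ-inverse z≉0)

-- The cubic transformation of sums over s

module CubicTransformation (𝔽 : FiniteField) (𝕂 : CharZeroField) where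
  open Sums 𝔽 𝕂
  open import Relation.Binary.Reasoning.Setoid setoid

  σ : F.Carrier → F.Carrier
  σ k = (k F.- F.1#) F.* (k F.- F.1#) F.* F.inv k

  -- In the coordinates s = k + 1/k − 2 this is the map k ↦ k³, that is the
  -- Dickson polynomial of degree three.
  C : F.Carrier → F.Carrier
  C s = s F.* ((s F.+ F.fromℕ 3) F.* (s F.+ F.fromℕ 3))

  -- The discriminant of m² - (s + 2)m + 1, whose roots are the nonzero m with σ(m) = s.
  Δ : F.Carrier → F.Carrier
  Δ s = s F.* (s F.+ F.fromℕ 4)

  -- Since `inv` sends 0 to 0, also `σ` does; this weight removes the spurious preimage m = 0 of s =
  -- 0.
  𝟙≉0 : F.Carrier → Carrier
  𝟙≉0 m = 𝟙 (¬? (m F.≟ F.0#))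

  σ-resp : ∀ {k l} → k F.≈ l → σ k F.≈ σ l
  σ-resp e = F.*-cong (F.*-cong (F.+-congʳ e) (F.+-congʳ e)) (F.inv-cong e)

  C-resp : ∀ {s t} → s F.≈ t → C s F.≈ C t
  C-resp e = F.*-cong e (F.*-cong (F.+-congʳ e) (F.+-congʳ e))

  Δ-resp : ∀ {s t} → s F.≈ t → Δ s F.≈ Δ t
  Δ-resp e = F.*-cong e (F.+-congʳ e)

  -- Here σ(m) + 3 = (m² + m + 1)/m, so C(σ(m)) is the square of (m - 1)(m² + m + 1) = m³ - 1,
  -- divided by m³.
  C-σ : ∀ {m} → ¬ m F.≈ F.0# → C (σ m) F.≈ σ (m F.* m F.* m)
  C-σ {m} m≉0 = F.trans (F.*-congˡ (F.*-cong σ+3 σ+3)) (F.trans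
      (F.solve 2 (λ m i → let m-1 = m F.:- F.con 1ℤ ; n = m F.:* m F.:+ m F.:+ F.con 1ℤ ; m³-1 = m F.:* m F.:* m F.:- F.con 1ℤ in
        m-1 F.:* m-1 F.:* i F.:* ((n F.:* i) F.:* (n F.:* i)) F.:= m³-1 F.:* m³-1 F.:* (i F.:* i F.:* i)) F.refl m i)
      (F.*-congˡ (F.sym (F.inv-unique mi³))))
    where
    i = F.inv m
    mi : m F.* i F.≈ F.1#
    mi = F.inv-inverse m≉0
    σ+3 : σ m F.+ F.fromℕ 3 F.≈ (m F.* m F.+ m F.+ F.1#) F.* i
    σ+3 = F.lincomb (F.- F.fromℕ 3) mi (F.solve 2 (λ m i →
      (m F.:- F.con 1ℤ) F.:* (m F.:- F.con 1ℤ) F.:* i F.:+ F.con (+ 3) F.:- (m F.:* m F.:+ m F.:+ F.con 1ℤ) F.:* i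
        F.:= F.:- F.con (+ 3) F.:* (m F.:* i F.:- F.con 1ℤ)) F.refl m i)
    mi³ : m F.* m F.* m F.* (i F.* i F.* i) F.≈ F.1#
    mi³ = F.lincomb (m F.* i F.* (m F.* i) F.+ m F.* i F.+ F.1#) mi (F.solve 2 (λ m i →
      m F.:* m F.:* m F.:* (i F.:* i F.:* i) F.:- F.con 1ℤ F.:=
        (m F.:* i F.:* (m F.:* i) F.:+ m F.:* i F.:+ F.con 1ℤ) F.:* (m F.:* i F.:- F.con 1ℤ)) F.refl m i)

  -- For s = σ(m) this reads (m³ - 1/m³)² = (m² + 1 + 1/m²)² (m - 1/m)², with m² + 1 + 1/m² = (s +
  -- 2)² - 1. It shows that `C` preserves the square class of `Δ` away from s = -1 and s = -3.
  Δ-C : ∀ s → Δ (C s) F.≈ ((s F.+ F.fromℕ 3) F.* (s F.+ F.1#)) F.* ((s F.+ F.fromℕ 3) F.* (s F.+ F.1#)) F.* Δ s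
  Δ-C s = F.solve 1 (λ s → let c = s F.:* ((s F.:+ F.con (+ 3)) F.:* (s F.:+ F.con (+ 3)))
                               z = (s F.:+ F.con (+ 3)) F.:* (s F.:+ F.con 1ℤ) in
    c F.:* (c F.:+ F.con (+ 4)) F.:= z F.:* z F.:* (s F.:* (s F.:+ F.con (+ 4)))) F.refl s

  isSquare-divide : ∀ {z x} → ¬ z F.≈ F.0# → IsSquare (z F.* z F.* x) → IsSquare x
  isSquare-divide {z} {x} z≉0 (y , e) = y F.* i , F.lincomb₂ (i F.* i) ((z F.* i F.+ F.1#) F.* x) e (F.inv-inverse z≉0)
    (F.solve 4 (λ x y z i → (y F.:* i) F.:* (y F.:* i) F.:- x F.:=
      i F.:* i F.:* (y F.:* y F.:- z F.:* z F.:* x) F.:+ (z F.:* i F.:+ F.con 1ℤ) F.:* x F.:* (z F.:* i F.:- F.con 1ℤ)) F.refl x y z i)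
    where i = F.inv z

  isSquare-resp : ∀ {x y} → x F.≈ y → IsSquare x → IsSquare y
  isSquare-resp x≈y (a , e) = a , F.trans e x≈y

  module _ (2≉0 : ¬ F.fromℕ 2 F.≈ F.0#) where
    open OddCharacteristic 2≉0

    ∑-σ : ∀ {H} → Respectful H → ∑ (λ m → 𝟙≉0 m * H (σ m)) ≈ ∑ (λ s → H s * (1# + φ (Δ s)))
    ∑-σ {H} H-resp = trans (∑-fibres 𝟙≉0 σ H-resp) (∑-cong (λ s → *-congˡ (fibre s)))
      where
      fibre : ∀ s → ∑ (λ m → 𝟙≉0 m * 𝟙 (s F.≟ σ m)) ≈ 1# + φ (Δ s)
      fibre s = begin
        ∑ (λ m → 𝟙≉0 m * 𝟙 (s F.≟ σ m))
          ≈⟨ ∑-cong pointwise ⟩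
        ∑ (λ m → 𝟙 (m F.* m F.+ b F.* m F.≟ F.- F.1#))
          ≈⟨ count-quadratic b (F.- F.1#) ⟩
        1# + φ (b F.* b F.+ F.fromℕ 4 F.* F.- F.1#)
          ≈⟨ +-congˡ (φ-resp (F.solve 1 (λ s → (F.:- (s F.:+ F.con (+ 2))) F.:* (F.:- (s F.:+ F.con (+ 2))) F.:+ F.con (+ 4) F.:* F.:- F.con 1ℤ
               F.:= s F.:* (s F.:+ F.con (+ 4))) F.refl s)) ⟩
        1# + φ (Δ s) ∎
        where
        b = F.- (s F.+ F.fromℕ 2)
        pointwise : ∀ m → 𝟙≉0 m * 𝟙 (s F.≟ σ m) ≈ 𝟙 (m F.* m F.+ b F.* m F.≟ F.- F.1#)
        pointwise m with m F.≟ F.0#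
        ... | yes m≈0 = trans (zeroˡ _) (sym (𝟙-no (m F.* m F.+ b F.* m F.≟ F.- F.1#) λ e →
                F.0≉1 (F.lincomb₂ (F.- F.1#) (m F.+ b) e m≈0 (F.solve 2 (λ m b → F.con 0ℤ F.:- F.con 1ℤ F.:=
                  F.:- F.con 1ℤ F.:* ((m F.:* m F.:+ b F.:* m) F.:- F.:- F.con 1ℤ) F.:+ (m F.:+ b) F.:* (m F.:- F.con 0ℤ)) F.refl m b))))
        ... | no m≉0 = trans (*-identityˡ _) (𝟙-cong (s F.≟ σ m) (m F.* m F.+ b F.* m F.≟ F.- F.1#)
                (λ e → F.lincomb₂ (F.- m) (F.- (m-1 F.* m-1)) e mi
                  (F.solve 3 (λ s m i → let m-1 = m F.:- F.con 1ℤ in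
                    m F.:* m F.:+ F.:- (s F.:+ F.con (+ 2)) F.:* m F.:- F.:- F.con 1ℤ F.:=
                    F.:- m F.:* (s F.:- m-1 F.:* m-1 F.:* i) F.:+ F.:- (m-1 F.:* m-1) F.:* (m F.:* i F.:- F.con 1ℤ)) F.refl s m i))
                (λ e → F.*-cancelˡ-≉0 m≉0 (F.lincomb₂ (F.- F.1#) (F.- (m-1 F.* m-1)) e mi
                  (F.solve 3 (λ s m i → let m-1 = m F.:- F.con 1ℤ in
                    m F.:* s F.:- m F.:* (m-1 F.:* m-1 F.:* i) F.:=
                    F.:- F.con 1ℤ F.:* (m F.:* m F.:+ F.:- (s F.:+ F.con (+ 2)) F.:* m F.:- F.:- F.con 1ℤ)
                      F.:+ F.:- (m-1 F.:* m-1) F.:* (m F.:* i F.:- F.con 1ℤ)) F.refl s m i))))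
          where
          i = F.inv m
          m-1 = m F.- F.1#
          mi = F.inv-inverse m≉0

    module _ {d : F.Carrier} (d²≈-3 : d F.* d F.≈ F.- F.fromℕ 3) (d≉0 : ¬ d F.≈ F.0#) where

      private
        Nonsplit : F.Carrier → Set
        Nonsplit s = ¬ IsSquare (Δ s)

        nonsplit-resp : ∀ {s t} → s F.≈ t → Nonsplit s → Nonsplit t
        nonsplit-resp e ns = ns ∘ isSquare-resp (F.sym (Δ-resp e))

        -- Δ(−1) = Δ(−3) = −3
        nonsplit-C : ∀ {s} → Nonsplit s → Nonsplit (C s)
        nonsplit-C {s} ns sq = ns (isSquare-divide (F.x*y≉0
          (λ e → ns (d , F.lincomb₂ F.1# (F.- (s F.+ F.1#)) d²≈-3 e (F.solve 2 (λ s d →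
            d F.:* d F.:- s F.:* (s F.:+ F.con (+ 4)) F.:= F.con 1ℤ F.:* (d F.:* d F.:- F.:- F.con (+ 3))
              F.:+ F.:- (s F.:+ F.con 1ℤ) F.:* (s F.:+ F.con (+ 3) F.:- F.con 0ℤ)) F.refl s d)))
          (λ e → ns (d , F.lincomb₂ F.1# (F.- (s F.+ F.fromℕ 3)) d²≈-3 e (F.solve 2 (λ s d →
            d F.:* d F.:- s F.:* (s F.:+ F.con (+ 4)) F.:= F.con 1ℤ F.:* (d F.:* d F.:- F.:- F.con (+ 3))
              F.:+ F.:- (s F.:+ F.con (+ 3)) F.:* (s F.:+ F.con 1ℤ F.:- F.con 0ℤ)) F.refl s d))))
          (isSquare-resp (Δ-C s) sq))

        -- (C s − C t)/(s − t) is a quadratic in t of discriminant −3 Δ(s).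
        C-injective : ∀ {s t} → Nonsplit s → C s F.≈ C t → s F.≈ t
        C-injective {s} {t} ns e with s F.≟ t
        ... | yes s≈t = s≈t
        ... | no  s≉t = ⊥-elim (ns (isSquare-divide d≉0 (w , F.lincomb₂ (F.fromℕ 4) (F.- Δ s) Q≈0 d²≈-3
                (F.solve 3 (λ s t d → let w = F.con (+ 2) F.:* t F.:+ s F.:+ F.con (+ 6)
                                          Δs = s F.:* (s F.:+ F.con (+ 4)) in
                  w F.:* w F.:- d F.:* d F.:* Δs F.:=
                  F.con (+ 4) F.:* ((s F.:* s F.:+ s F.:* t F.:+ t F.:* t F.:+ F.con (+ 6) F.:* (s F.:+ t) F.:+ F.con (+ 9)) F.:- F.con 0ℤ)
                    F.:+ F.:- Δs F.:* (d F.:* d F.:- F.:- F.con (+ 3))) F.refl s t d))))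
          where
          w = F.fromℕ 2 F.* t F.+ s F.+ F.fromℕ 6
          Q = s F.* s F.+ s F.* t F.+ t F.* t F.+ F.fromℕ 6 F.* (s F.+ t) F.+ F.fromℕ 9
          Q≈0 : Q F.≈ F.0#
          Q≈0 = F.x*y≈0⇒y≈0 (F.x-y≉0 s≉t) (F.lincomb F.1# e (F.solve 2 (λ s t →
            (s F.:- t) F.:* (s F.:* s F.:+ s F.:* t F.:+ t F.:* t F.:+ F.con (+ 6) F.:* (s F.:+ t) F.:+ F.con (+ 9)) F.:- F.con 0ℤ
            F.:= F.con 1ℤ F.:* (s F.:* ((s F.:+ F.con (+ 3)) F.:* (s F.:+ F.con (+ 3))) F.:-
                                t F.:* ((t F.:+ F.con (+ 3)) F.:* (t F.:+ F.con (+ 3))))) F.refl s t))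

        -- Extending `C` by the identity from the nonsplit points gives an injective self-map of the
        -- whole field, so that `∑-reindex` applies and surjectivity never has to be proved.
        h : F.Carrier → F.Carrier
        h s with isSquare? (Δ s)
        ... | yes _ = s
        ... | no _  = C s

        h-injective : ∀ {s t} → h s F.≈ h t → s F.≈ t
        h-injective {s} {t} e with isSquare? (Δ s) | isSquare? (Δ t)
        ... | yes _  | yes _  = e
        ... | yes sq | no ns  = ⊥-elim (nonsplit-resp (F.sym e) (nonsplit-C ns) sq)
        ... | no ns  | yes sq = ⊥-elim (nonsplit-resp e (nonsplit-C ns) sq)
        ... | no ns  | no _   = C-injective ns e

      ∑-nonsplit : ∀ {G} → Respectful G →
        ∑ (λ s → G (C s) * (1# - φ (Δ s))) ≈ ∑ (λ s → G s * (1# - φ (Δ s)))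
      ∑-nonsplit {G} G-resp = sym (trans
        (∑-reindex h h-injective (λ e → *-cong (G-resp e) (+-congˡ (-‿cong (φ-resp (Δ-resp e))))))
        (∑-cong pointwise))
        where
        pointwise : ∀ s → G (h s) * (1# - φ (Δ (h s))) ≈ G (C s) * (1# - φ (Δ s))
        pointwise s with isSquare? (Δ s)
        ... | no ns  = *-congˡ (+-congˡ (-‿cong (trans (φ-nonsquare (nonsplit-C ns)) (sym (φ-nonsquare ns)))))
        ... | yes sq with Δ s F.≟ F.0#
        -- The weight is 1 here and does not vanish, but C(s) - s = (s + 2)Δ(s), so `C` fixes both
        -- such points, s = 0 and s = -4.
        ... | yes Δ≈0 = *-congʳ (G-resp (F.sym (F.lincomb (s F.+ F.fromℕ 2) Δ≈0 (F.solve 1 (λ s →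
                s F.:* ((s F.:+ F.con (+ 3)) F.:* (s F.:+ F.con (+ 3))) F.:- s F.:=
                (s F.:+ F.con (+ 2)) F.:* (s F.:* (s F.:+ F.con (+ 4)) F.:- F.con 0ℤ)) F.refl s))))
        ... | no Δ≉0 = trans (vanish (G s)) (sym (vanish (G (C s))))
          where
          vanish : ∀ x → x * (1# - φ (Δ s)) ≈ 0#
          vanish x = trans (*-congˡ (trans (+-congˡ (-‿cong (φ-square sq Δ≉0))) (-‿inverseʳ 1#))) (zeroʳ x)

      module _ {ρ : F.Carrier → Carrier} (ρ-char : IsCharacter 𝔽 𝕂 ρ)
               (ρ³≈1 : ∀ {k} → ¬ k F.≈ F.0# → ρ k * ρ k * ρ k ≈ 1#)
               (cubeRoots : ∀ {k} → ¬ k F.≈ F.0# → ∑ (λ m → 𝟙 (m F.* m F.* m F.≟ k)) ≈ 1# + ρ k + ρ k * ρ k) where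

        open CharacterProperties ρ-char renaming (χ-resp to ρ-resp; χ-0 to ρ-0; χ-inverse to ρ-inverse)

        ρ-inv : ∀ {k} → ¬ k F.≈ F.0# → ρ (F.inv k) ≈ ρ k * ρ k
        ρ-inv {k} k≉0 = lincomb₂ (- ρ (F.inv k)) (ρ k * ρ k) (ρ³≈1 k≉0)
          (ρ-inverse k≉0)
          (solve 2 (λ r i → i :- r :* r := :- i :* (r :* r :* r :- con 1ℤ) :+ r :* r :* (r :* i :- con 1ℤ)) refl (ρ k) (ρ (F.inv k)))

        module _ {G : F.Carrier → Carrier} (G-resp : Respectful G) where

          T : Carrier
          T = ∑ (λ k → ρ k * G (σ k))

          -- The involution k ↦ 1/k fixes σ(k) and interchanges ρ and ρ². Hence the two nontrivial
          -- terms of the cube root count give the same sum `T`.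
          ∑-ρ² : ∑ (λ k → ρ k * ρ k * G (σ k)) ≈ T
          ∑-ρ² = sym (trans (∑-reindex F.inv F.inv-injective (λ e → *-cong (ρ-resp e) (G-resp (σ-resp e)))) (∑-cong pointwise))
            where
            pointwise : ∀ k → ρ (F.inv k) * G (σ (F.inv k)) ≈ ρ k * ρ k * G (σ k)
            pointwise k with k F.≟ F.0#
            ... | yes k≈0 = trans (trans (*-congʳ (ρ-0 (F.inv-0 k≈0))) (zeroˡ _))
                    (sym (trans (*-congʳ (trans (*-congʳ (ρ-0 k≈0)) (zeroˡ _))) (zeroˡ _)))
            ... | no k≉0 = *-cong (ρ-inv k≉0) (G-resp (F.trans (F.*-congˡ (F.inv-involutive k))
                    (F.lincomb (i F.- k) (F.inv-inverse k≉0) (F.solve 2 (λ k i →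
                      (i F.:- F.con 1ℤ) F.:* (i F.:- F.con 1ℤ) F.:* k F.:- (k F.:- F.con 1ℤ) F.:* (k F.:- F.con 1ℤ) F.:* i F.:=
                      (i F.:- k) F.:* (k F.:* i F.:- F.con 1ℤ)) F.refl k i))))
              where
              i = F.inv k

          ∑-cube : ∑ (λ m → 𝟙≉0 m * G (C (σ m))) ≈ ∑ (λ k → 𝟙≉0 k * G (σ k)) + (T + T)
          ∑-cube = begin
            ∑ (λ m → 𝟙≉0 m * G (C (σ m)))
              ≈⟨ ∑-cong at-cube ⟩
            ∑ (λ m → 𝟙≉0 m * G (σ (m F.* m F.* m)))
              ≈⟨ ∑-fibres 𝟙≉0 (λ m → m F.* m F.* m) (λ e → G-resp (σ-resp e)) ⟩
            ∑ (λ k → G (σ k) * ∑ (λ m → 𝟙≉0 m * 𝟙 (k F.≟ m F.* m F.* m)))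
              ≈⟨ ∑-cong fibre ⟩
            ∑ (λ k → 𝟙≉0 k * G (σ k) + (ρ k * G (σ k) + ρ k * ρ k * G (σ k)))
              ≈⟨ trans (∑-+ _ _) (+-congˡ (trans (∑-+ _ _) (+-congˡ ∑-ρ²))) ⟩
            ∑ (λ k → 𝟙≉0 k * G (σ k)) + (T + T) ∎
            where
            at-cube : ∀ m → 𝟙≉0 m * G (C (σ m)) ≈ 𝟙≉0 m * G (σ (m F.* m F.* m))
            at-cube m with m F.≟ F.0#
            ... | yes _  = trans (zeroˡ _) (sym (zeroˡ _))
            ... | no m≉0 = *-congˡ (G-resp (C-σ m≉0))
            fibre : ∀ k → G (σ k) * ∑ (λ m → 𝟙≉0 m * 𝟙 (k F.≟ m F.* m F.* m)) ≈
                          𝟙≉0 k * G (σ k) + (ρ k * G (σ k) + ρ k * ρ k * G (σ k))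
            fibre k with k F.≟ F.0#
            ... | yes k≈0 = trans (*-congˡ (trans (∑-cong no-root) (⨁-unit F.elements)))
                    (sym (trans (+-congˡ (+-cong (*-congʳ (ρ-0 k≈0)) (*-congʳ (*-congʳ (ρ-0 k≈0)))))
                      (solve 2 (λ g r → con 0ℤ :* g :+ (con 0ℤ :* g :+ con 0ℤ :* r :* g) := g :* con 0ℤ) refl (G (σ k)) (ρ k))))
              where
              no-root : ∀ m → 𝟙≉0 m * 𝟙 (k F.≟ m F.* m F.* m) ≈ 0#
              no-root m with m F.≟ F.0#
              ... | yes _  = zeroˡ _
              ... | no m≉0 = trans (*-congˡ (𝟙-no (k F.≟ m F.* m F.* m)
                      (λ e → F.x*y≉0 (F.x*y≉0 m≉0 m≉0) m≉0 (F.trans (F.sym e) k≈0)))) (zeroʳ _)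
            ... | no k≉0 = trans (*-congˡ (trans (∑-cong root) (cubeRoots k≉0)))
                    (solve 2 (λ g r → g :* (con 1ℤ :+ r :+ r :* r) := con 1ℤ :* g :+ (r :* g :+ r :* r :* g)) refl (G (σ k)) (ρ k))
              where
              root : ∀ m → 𝟙≉0 m * 𝟙 (k F.≟ m F.* m F.* m) ≈ 𝟙 (m F.* m F.* m F.≟ k)
              root m with m F.≟ F.0#
              ... | yes m≈0 = trans (zeroˡ _) (sym (𝟙-no (m F.* m F.* m F.≟ k)
                      (λ e → k≉0 (F.trans (F.sym e) (F.trans (F.*-congˡ m≈0) (F.zeroʳ _))))))
              ... | no _    = trans (*-identityˡ _) (𝟙-cong (k F.≟ m F.* m F.* m) (m F.* m F.* m F.≟ k) F.sym F.sym)

          private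
            2*∑ : ∀ (f w : F.Carrier → Carrier) → ∑ (λ s → f s * (1# + w s)) + ∑ (λ s → f s * (1# - w s)) ≈ fromℕ 2 * ∑ f
            2*∑ f w = trans (sym (∑-+ _ _)) (trans
              (∑-cong (λ s → solve 2 (λ f w → f :* (con 1ℤ :+ w) :+ f :* (con 1ℤ :- w) := con (+ 2) :* f) refl (f s) (w s)))
              (∑-*ˡ (fromℕ 2) f))

          cubicTransformation : ∑ (λ s → G (C s)) ≈ ∑ G + T
          cubicTransformation = *-cancelˡ-≉0 (charZero 1) (begin
            fromℕ 2 * ∑ (λ s → G (C s))
              ≈⟨ sym (2*∑ (G ∘ C) (φ ∘ Δ)) ⟩
            ∑ (λ s → G (C s) * (1# + φ (Δ s))) + ∑ (λ s → G (C s) * (1# - φ (Δ s)))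
              ≈⟨ +-cong (sym (∑-σ (G-resp ∘ C-resp))) (∑-nonsplit G-resp) ⟩
            ∑ (λ m → 𝟙≉0 m * G (C (σ m))) + ∑ (λ s → G s * (1# - φ (Δ s)))
              ≈⟨ +-congʳ (trans ∑-cube (+-congʳ (∑-σ G-resp))) ⟩
            (∑ (λ s → G s * (1# + φ (Δ s))) + (T + T)) + ∑ (λ s → G s * (1# - φ (Δ s)))
              ≈⟨ solve 3 (λ a b t → (a :+ (t :+ t)) :+ b := (a :+ b) :+ con (+ 2) :* t) refl _ _ T ⟩
            (∑ (λ s → G s * (1# + φ (Δ s))) + ∑ (λ s → G s * (1# - φ (Δ s)))) + fromℕ 2 * T
              ≈⟨ +-congʳ (2*∑ G (φ ∘ Δ)) ⟩
            fromℕ 2 * ∑ G + fromℕ 2 * T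
              ≈⟨ sym (distribˡ _ _ _) ⟩
            fromℕ 2 * (∑ G + T) ∎)

-- The point count: from the cubic discriminant to the conic discriminant

module WeierstrassCount (𝔽 : FiniteField) (𝕂 : CharZeroField) where
  open Sums 𝔽 𝕂
  open CubicTransformation 𝔽 𝕂
  open import Relation.Binary.Reasoning.Setoid setoid

  -- Discriminants of the cubic, as a quadratic in y, and of the conic
  -- (λ − 1)ky² + (1 + k)y = 1 that λxy = (1 − x)(1 − y) becomes for x = ky.
  cubicDiscriminant : F.Carrier → F.Carrier → F.Carrier
  cubicDiscriminant l X = (F.1# F.+ F.fromℕ 3 F.* X) F.* (F.1# F.+ F.fromℕ 3 F.* X) F.+ F.fromℕ 4 F.* (l F.* (X F.* X F.* X))

  conicDiscriminant : F.Carrier → F.Carrier → F.Carrier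
  conicDiscriminant l k = (k F.- F.1#) F.* (k F.- F.1#) F.+ F.fromℕ 4 F.* l F.* k

  cubicDiscriminant-resp : ∀ {l x y} → x F.≈ y → cubicDiscriminant l x F.≈ cubicDiscriminant l y
  cubicDiscriminant-resp e = F.+-cong (F.*-cong e′ e′) (F.*-congˡ (F.*-congˡ (F.*-cong (F.*-cong e e) e)))
    where e′ = F.+-congˡ (F.*-congˡ e)

  module _ (2≉0 : ¬ F.fromℕ 2 F.≈ F.0#) where
    open OddCharacteristic 2≉0

    φ-1 : φ F.1# ≈ 1#
    φ-1 = φ-square (F.1# , F.*-identityˡ F.1#) (F.0≉1 ∘ F.sym)

    -- For s ≠ 0 the argument is s²(1 + m/s), so the summand is φ(1 + m/s). Over all s, with 1/0
    -- read as 0, these affine values sum to 0; the term φ(1) = 1 at s = 0 is the one that is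
    -- missing on the left.
    ∑-φ-quadratic : ∀ {m} → ¬ m F.≈ F.0# → ∑ (λ s → φ (s F.* (s F.+ m))) ≈ - 1#
    ∑-φ-quadratic {m} m≉0 = lincomb 1#
      (trans (sym (trans (∑-+ _ _) (+-congˡ (∑-𝟙 F.0#)))) (trans (∑-cong pointwise)
        (trans (sym (∑-reindex F.inv F.inv-injective (λ e → φ-resp (F.+-congˡ (F.*-congˡ e))))) (∑-φ-affine F.1# m≉0))))
      (solve 1 (λ t → t :- :- con 1ℤ := con 1ℤ :* ((t :+ con 1ℤ) :- con 0ℤ)) refl _)
      where
      pointwise : ∀ s → φ (s F.* (s F.+ m)) + 𝟙 (s F.≟ F.0#) ≈ φ (F.1# F.+ m F.* F.inv s)
      pointwise s with s F.≟ F.0#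
      ... | yes s≈0 = trans (+-congʳ (φ-0 (F.trans (F.*-congʳ s≈0) (F.zeroˡ _)))) (trans (+-identityˡ 1#)
              (trans (sym φ-1) (φ-resp (F.sym (F.trans (F.+-congˡ (F.trans (F.*-congˡ (F.inv-0 s≈0)) (F.zeroʳ m))) (F.+-identityʳ F.1#))))))
      ... | no s≉0 = trans (+-identityʳ _) (trans (sym (φ-scale _ (F.inv-≉0 s≉0)))
              (φ-resp (F.lincomb (s F.* i F.+ F.1# F.+ i F.* m) (F.inv-inverse s≉0) (F.solve 3 (λ s i m →
                i F.:* i F.:* (s F.:* (s F.:+ m)) F.:- (F.con 1ℤ F.:+ m F.:* i) F.:=
                (s F.:* i F.:+ F.con 1ℤ F.:+ i F.:* m) F.:* (s F.:* i F.:- F.con 1ℤ)) F.refl s i m))))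
        where i = F.inv s

    module _ {d : F.Carrier} (d²≈-3 : d F.* d F.≈ F.- F.fromℕ 3) (d≉0 : ¬ d F.≈ F.0#) where

      3≉0 : ¬ F.fromℕ 3 F.≈ F.0#
      3≉0 e = F.x*y≉0 d≉0 d≉0 (F.lincomb₂ F.1# (F.- F.1#) d²≈-3 e (F.solve 2 (λ d t →
        d F.:* d F.:- F.con 0ℤ F.:= F.con 1ℤ F.:* (d F.:* d F.:- F.:- t) F.:+ F.:- F.con 1ℤ F.:* (t F.:- F.con 0ℤ)) F.refl d (F.fromℕ 3)))

      module _ {l : F.Carrier} (l≉0 : ¬ l F.≈ F.0#) where

        G : F.Carrier → Carrier
        G s = φ (s F.* (s F.+ F.fromℕ 4 F.* l))

        G-resp : Respectful G
        G-resp e = φ-resp (F.*-cong e (F.+-congʳ e))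

        G-0 : ∀ {s} → s F.≈ F.0# → G s ≈ 0#
        G-0 e = φ-0 (F.trans (F.*-congʳ e) (F.zeroˡ _))

        -- Put X = 1/s. Multiplying the discriminant by s⁴ gives s(C(s) + 4λ), and a further factor
        -- (s + 3)² gives C(s)(C(s) + 4λ). The scalings fail at s = 0 and s = -3, where `G (C s)` is
        -- 0: the true values there are φ(1) = 1 and φ(-12λ) = φ(λ), as -3 is a square.
        ∑-cubicDiscriminant : ∑ (φ ∘ cubicDiscriminant l) ≈ 1# + (∑ (G ∘ C) + φ l)
        ∑-cubicDiscriminant = trans (∑-reindex F.inv F.inv-injective (φ-resp ∘ cubicDiscriminant-resp)) (trans (∑-cong pointwise)
          (trans (∑-+ _ _) (+-cong (∑-𝟙 F.0#) (trans (∑-+ _ _) (+-congˡ (∑-𝟙-*ʳ (F.- F.fromℕ 3) (φ l)))))))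
          where
          invert : ∀ {s} → ¬ s F.≈ F.0# → φ (cubicDiscriminant l (F.inv s)) ≈ φ (s F.* (C s F.+ F.fromℕ 4 F.* l))
          invert {s} s≉0 = trans (sym (φ-scale _ (F.x*y≉0 s≉0 s≉0))) (φ-resp (F.lincomb
            (F.fromℕ 6 F.* (s F.* s F.* s) F.+ F.fromℕ 9 F.* (s F.* s) F.* (s F.* i F.+ F.1#)
              F.+ F.fromℕ 4 F.* l F.* s F.* (s F.* i F.* (s F.* i) F.+ s F.* i F.+ F.1#)) (F.inv-inverse s≉0)
            (F.solve 3 (λ s i l → let t = F.con 1ℤ F.:+ F.con (+ 3) F.:* i in
              s F.:* s F.:* (s F.:* s) F.:* (t F.:* t F.:+ F.con (+ 4) F.:* (l F.:* (i F.:* i F.:* i)))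
                F.:- s F.:* (s F.:* ((s F.:+ F.con (+ 3)) F.:* (s F.:+ F.con (+ 3))) F.:+ F.con (+ 4) F.:* l) F.:=
              (F.con (+ 6) F.:* (s F.:* s F.:* s) F.:+ F.con (+ 9) F.:* (s F.:* s) F.:* (s F.:* i F.:+ F.con 1ℤ)
                F.:+ F.con (+ 4) F.:* l F.:* s F.:* (s F.:* i F.:* (s F.:* i) F.:+ s F.:* i F.:+ F.con 1ℤ))
              F.:* (s F.:* i F.:- F.con 1ℤ)) F.refl s i l)))
            where i = F.inv s
          pointwise : ∀ s → φ (cubicDiscriminant l (F.inv s)) ≈ 𝟙 (s F.≟ F.0#) + (G (C s) + 𝟙 (s F.≟ F.- F.fromℕ 3) * φ l)
          pointwise s with s F.≟ F.0# | s F.≟ F.- F.fromℕ 3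
          ... | yes s≈0 | yes s≈-3 = ⊥-elim (3≉0 (F.lincomb₂ (F.- F.1#) F.1# s≈0 s≈-3 (F.solve 2 (λ s t →
                  t F.:- F.con 0ℤ F.:= F.:- F.con 1ℤ F.:* (s F.:- F.con 0ℤ) F.:+ F.con 1ℤ F.:* (s F.:- F.:- t)) F.refl s (F.fromℕ 3))))
          ... | yes s≈0 | no _ = begin
                φ (cubicDiscriminant l (F.inv s))
                  ≈⟨ φ-resp (F.trans (cubicDiscriminant-resp (F.inv-0 s≈0)) (F.solve 1 (λ l → let t = F.con 1ℤ F.:+ F.con (+ 3) F.:* F.con 0ℤ in
                       t F.:* t F.:+ F.con (+ 4) F.:* (l F.:* (F.con 0ℤ F.:* F.con 0ℤ F.:* F.con 0ℤ)) F.:= F.con 1ℤ) F.refl l)) ⟩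
                φ F.1#
                  ≈⟨ φ-1 ⟩
                1#
                  ≈⟨ solve 1 (λ p → con 1ℤ := con 1ℤ :+ (con 0ℤ :+ con 0ℤ :* p)) refl (φ l) ⟩
                1# + (0# + 0# * φ l)
                  ≈⟨ +-congˡ (+-congʳ (sym (G-0 (F.trans (F.*-congʳ s≈0) (F.zeroˡ _))))) ⟩
                1# + (G (C s) + 0# * φ l) ∎
          ... | no s≉0 | yes s≈-3 = begin
                φ (cubicDiscriminant l (F.inv s))
                  ≈⟨ invert s≉0 ⟩
                φ (s F.* (C s F.+ F.fromℕ 4 F.* l))
                  ≈⟨ φ-resp (F.lincomb₂ (s F.* s F.* (s F.+ F.fromℕ 3) F.+ F.fromℕ 4 F.* l) (F.- (F.fromℕ 4 F.* l)) s≈-3 d²≈-3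
                       (F.solve 3 (λ s d l → s F.:* (s F.:* ((s F.:+ F.con (+ 3)) F.:* (s F.:+ F.con (+ 3))) F.:+ F.con (+ 4) F.:* l)
                         F.:- (F.con (+ 2) F.:* d) F.:* (F.con (+ 2) F.:* d) F.:* l F.:=
                         (s F.:* s F.:* (s F.:+ F.con (+ 3)) F.:+ F.con (+ 4) F.:* l) F.:* (s F.:- F.:- F.con (+ 3))
                           F.:+ F.:- (F.con (+ 4) F.:* l) F.:* (d F.:* d F.:- F.:- F.con (+ 3))) F.refl s d l)) ⟩
                φ ((F.fromℕ 2 F.* d) F.* (F.fromℕ 2 F.* d) F.* l)
                  ≈⟨ φ-scale l (F.x*y≉0 2≉0 d≉0) ⟩
                φ l
                  ≈⟨ solve 1 (λ p → p := con 0ℤ :+ (con 0ℤ :+ con 1ℤ :* p)) refl (φ l) ⟩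
                0# + (0# + 1# * φ l)
                  ≈⟨ +-congˡ (+-congʳ (sym (G-0 (F.lincomb (s F.* (s F.+ F.fromℕ 3)) s≈-3 (F.solve 1 (λ s →
                       s F.:* ((s F.:+ F.con (+ 3)) F.:* (s F.:+ F.con (+ 3))) F.:- F.con 0ℤ F.:=
                       s F.:* (s F.:+ F.con (+ 3)) F.:* (s F.:- F.:- F.con (+ 3))) F.refl s))))) ⟩
                0# + (G (C s) + 1# * φ l) ∎
          ... | no s≉0 | no s≉-3 = begin
                φ (cubicDiscriminant l (F.inv s))
                  ≈⟨ invert s≉0 ⟩
                φ (s F.* (C s F.+ F.fromℕ 4 F.* l))
                  ≈⟨ sym (φ-scale _ (λ e → s≉-3 (F.lincomb F.1# e (F.solve 1 (λ s →
                       s F.:- F.:- F.con (+ 3) F.:= F.con 1ℤ F.:* (s F.:+ F.con (+ 3) F.:- F.con 0ℤ)) F.refl s)))) ⟩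
                φ ((s F.+ F.fromℕ 3) F.* (s F.+ F.fromℕ 3) F.* (s F.* (C s F.+ F.fromℕ 4 F.* l)))
                  ≈⟨ φ-resp (F.solve 3 (λ s z t → z F.:* z F.:* (s F.:* t) F.:= s F.:* (z F.:* z) F.:* t) F.refl
                       s (s F.+ F.fromℕ 3) (C s F.+ F.fromℕ 4 F.* l)) ⟩
                G (C s)
                  ≈⟨ solve 2 (λ g p → g := con 0ℤ :+ (g :+ con 0ℤ :* p)) refl _ (φ l) ⟩
                0# + (G (C s) + 0# * φ l) ∎

        module _ {ρ : F.Carrier → Carrier} (ρ-char : IsCharacter 𝔽 𝕂 ρ)
                 (ρ³≈1 : ∀ {k} → ¬ k F.≈ F.0# → ρ k * ρ k * ρ k ≈ 1#)
                 (cubeRoots : ∀ {k} → ¬ k F.≈ F.0# → ∑ (λ m → 𝟙 (m F.* m F.* m F.≟ k)) ≈ 1# + ρ k + ρ k * ρ k) where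

          -- Multiplying by (k - 1)²/k² turns the discriminant into σ(k)(σ(k) + 4λ). Only k = 1 is
          -- lost: there σ is 0 but the discriminant is 4λ. At k = 0 both sides vanish with ρ.
          ∑-conicDiscriminant : ∑ (λ k → ρ k * φ (conicDiscriminant l k)) ≈ ∑ (λ k → ρ k * G (σ k)) + φ l
          ∑-conicDiscriminant = trans (∑-cong pointwise) (trans (∑-+ _ _) (+-congˡ (∑-𝟙-*ʳ F.1# (φ l))))
            where
            pointwise : ∀ k → ρ k * φ (conicDiscriminant l k) ≈ ρ k * G (σ k) + 𝟙 (k F.≟ F.1#) * φ l
            pointwise k with k F.≟ F.0# | k F.≟ F.1#
            ... | yes k≈0 | yes k≈1 = ⊥-elim (F.0≉1 (F.trans (F.sym k≈0) k≈1))
            ... | yes k≈0 | no _ = trans (*-congʳ ρ≈0) (trans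
                    (solve 3 (λ a b c → con 0ℤ :* a := con 0ℤ :* b :+ con 0ℤ :* c) refl _ _ (φ l)) (+-congʳ (*-congʳ (sym ρ≈0))))
              where ρ≈0 = trans (proj₁ ρ-char k≈0) (proj₁ (proj₂ ρ-char))
            ... | no _ | yes k≈1 = trans (*-cong ρ≈1 (trans (φ-resp (F.lincomb (k F.- F.1# F.+ F.fromℕ 4 F.* l) k≈1 (F.solve 2 (λ k l →
                    ((k F.:- F.con 1ℤ) F.:* (k F.:- F.con 1ℤ) F.:+ F.con (+ 4) F.:* l F.:* k) F.:- F.con (+ 4) F.:* l F.:=
                    (k F.:- F.con 1ℤ F.:+ F.con (+ 4) F.:* l) F.:* (k F.:- F.con 1ℤ)) F.refl k l))) (φ-4 l)))
                  (trans (solve 2 (λ r p → con 1ℤ :* p := r :* con 0ℤ :+ con 1ℤ :* p) refl (ρ k) (φ l))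
                    (+-congʳ (*-congˡ (sym (G-0 (F.lincomb ((k F.- F.1#) F.* F.inv k) k≈1 (F.solve 2 (λ k i →
                      (k F.:- F.con 1ℤ) F.:* (k F.:- F.con 1ℤ) F.:* i F.:- F.con 0ℤ F.:=
                      (k F.:- F.con 1ℤ) F.:* i F.:* (k F.:- F.con 1ℤ)) F.refl k (F.inv k))))))))
              where ρ≈1 = trans (proj₁ ρ-char k≈1) (proj₁ (proj₂ (proj₂ ρ-char)))
            ... | no k≉0 | no k≉1 = trans (*-congˡ (trans (sym (φ-scale _ (F.x*y≉0 (F.x-y≉0 k≉1) (F.inv-≉0 k≉0))))
                    (φ-resp (F.lincomb (F.fromℕ 4 F.* l F.* ((k F.- F.1#) F.* (k F.- F.1#)) F.* i) (F.inv-inverse k≉0)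
                      (F.solve 3 (λ k i l → let k-1 = k F.:- F.con 1ℤ ; s = k-1 F.:* k-1 F.:* i in
                        (k-1 F.:* i) F.:* (k-1 F.:* i) F.:* (k-1 F.:* k-1 F.:+ F.con (+ 4) F.:* l F.:* k) F.:- s F.:* (s F.:+ F.con (+ 4) F.:* l) F.:=
                        F.con (+ 4) F.:* l F.:* (k-1 F.:* k-1) F.:* i F.:* (k F.:* i F.:- F.con 1ℤ)) F.refl k i l)))))
                  (solve 2 (λ g p → g := g :+ con 0ℤ :* p) refl _ (φ l))
              where i = F.inv k

          -- The corrections balance: φ(λ) stands on both sides, and the 1 coming from X = 0 is
          -- offset by the value -1 of the sum of `G`.
          cubic≈conic : ∑ (φ ∘ cubicDiscriminant l) ≈ ∑ (λ k → ρ k * φ (conicDiscriminant l k))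
          cubic≈conic = begin
            ∑ (φ ∘ cubicDiscriminant l)
              ≈⟨ ∑-cubicDiscriminant ⟩
            1# + (∑ (G ∘ C) + φ l)
              ≈⟨ +-congˡ (+-congʳ (trans (cubicTransformation 2≉0 d²≈-3 d≉0 ρ-char ρ³≈1 cubeRoots G-resp)
                   (+-congʳ (∑-φ-quadratic (F.x*y≉0 4≉0 l≉0))))) ⟩
            1# + ((- 1# + T-sum) + φ l)
              ≈⟨ solve 2 (λ t p → con 1ℤ :+ ((:- con 1ℤ :+ t) :+ p) := t :+ p) refl T-sum (φ l) ⟩
            T-sum + φ l
              ≈⟨ sym ∑-conicDiscriminant ⟩
            ∑ (λ k → ρ k * φ (conicDiscriminant l k)) ∎
            where T-sum = ∑ (λ k → ρ k * G (σ k))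

      -- As a quadratic in y the equation has discriminant (a₁x + a₃)² + 4x³. The substitution x =
      -- (3a₃/a₁)X makes this a₃²((1 + 3X)² + 4λX³); the cube of the factor 3 is the origin of the
      -- 27 in λ.
      affinePoints : ∀ {a₁ a₃ b} → a₁ F.* b F.≈ F.1# → ¬ a₃ F.≈ F.0# →
        ∑ (λ x → ∑ (λ y → 𝟙 (y F.* y F.+ a₁ F.* x F.* y F.+ a₃ F.* y F.≟ x F.* x F.* x)))
          ≈ q + ∑ (φ ∘ cubicDiscriminant (F.fromℕ 27 F.* F.pow b 3 F.* a₃))
      affinePoints {a₁} {a₃} {b} a₁b≈1 a₃≉0 = begin
        ∑ (λ x → ∑ (λ y → 𝟙 (y F.* y F.+ a₁ F.* x F.* y F.+ a₃ F.* y F.≟ x F.* x F.* x)))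
          ≈⟨ ∑-cong (λ x → trans (∑-cong (λ y → 𝟙-cong (y F.* y F.+ a₁ F.* x F.* y F.+ a₃ F.* y F.≟ x F.* x F.* x)
               (y F.* y F.+ (a₁ F.* x F.+ a₃) F.* y F.≟ x F.* x F.* x)
               (F.trans (collect x y)) (F.trans (F.sym (collect x y))))) (count-quadratic (a₁ F.* x F.+ a₃) (x F.* x F.* x))) ⟩
        ∑ (λ x → 1# + φ (D x))
          ≈⟨ trans (∑-+ _ _) (+-congʳ ∑-1) ⟩
        q + ∑ (φ ∘ D)
          ≈⟨ +-congˡ (∑-reindex (c F.*_) (F.*-cancelˡ-≉0 c≉0) (φ-resp ∘ D-resp)) ⟩
        q + ∑ (λ X → φ (D (c F.* X)))
          ≈⟨ +-congˡ (∑-cong (λ X → trans (φ-resp (normalise X)) (φ-scale _ a₃≉0))) ⟩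
        q + ∑ (φ ∘ cubicDiscriminant (F.fromℕ 27 F.* F.pow b 3 F.* a₃)) ∎
        where
        D : F.Carrier → F.Carrier
        D x = (a₁ F.* x F.+ a₃) F.* (a₁ F.* x F.+ a₃) F.+ F.fromℕ 4 F.* (x F.* x F.* x)
        D-resp : ∀ {x y} → x F.≈ y → D x F.≈ D y
        D-resp e = F.+-cong (F.*-cong e′ e′) (F.*-congˡ (F.*-cong (F.*-cong e e) e))
          where e′ = F.+-congʳ (F.*-congˡ e)
        c = F.fromℕ 3 F.* a₃ F.* b
        c≉0 : ¬ c F.≈ F.0#
        c≉0 = F.x*y≉0 (F.x*y≉0 3≉0 a₃≉0) (F.x*y≈1⇒x≉0 (F.trans (F.*-comm b a₁) a₁b≈1))
        collect : ∀ x y → y F.* y F.+ (a₁ F.* x F.+ a₃) F.* y F.≈ y F.* y F.+ a₁ F.* x F.* y F.+ a₃ F.* y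
        collect x y = F.solve 4 (λ a₁ a₃ x y → y F.:* y F.:+ (a₁ F.:* x F.:+ a₃) F.:* y F.:=
          y F.:* y F.:+ a₁ F.:* x F.:* y F.:+ a₃ F.:* y) F.refl a₁ a₃ x y
        normalise : ∀ X → D (c F.* X) F.≈ a₃ F.* a₃ F.* cubicDiscriminant (F.fromℕ 27 F.* F.pow b 3 F.* a₃) X
        normalise X = F.lincomb (a₃ F.* a₃ F.* (F.fromℕ 3 F.* X) F.* (F.fromℕ 3 F.* (a₁ F.* b) F.* X F.+ F.fromℕ 3 F.* X F.+ F.fromℕ 2)) a₁b≈1
          (F.solve 4 (λ a₁ a₃ b X →
            let x = F.con (+ 3) F.:* a₃ F.:* b F.:* X
                t = F.con 1ℤ F.:+ F.con (+ 3) F.:* X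
                l = F.con (+ 27) F.:* (b F.:* (b F.:* (b F.:* F.con 1ℤ))) F.:* a₃ in
            ((a₁ F.:* x F.:+ a₃) F.:* (a₁ F.:* x F.:+ a₃) F.:+ F.con (+ 4) F.:* (x F.:* x F.:* x))
              F.:- a₃ F.:* a₃ F.:* (t F.:* t F.:+ F.con (+ 4) F.:* (l F.:* (X F.:* X F.:* X))) F.:=
            a₃ F.:* a₃ F.:* (F.con (+ 3) F.:* X) F.:* (F.con (+ 3) F.:* (a₁ F.:* b) F.:* X F.:+ F.con (+ 3) F.:* X F.:+ F.con (+ 2))
              F.:* (a₁ F.:* b F.:- F.con 1ℤ)) F.refl a₁ a₃ b X)

-- Multiplicative characters: orthogonality, and cube roots counted by ρ

module Characters (𝔽 : FiniteField) (𝕂 : CharZeroField) where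
  open Sums 𝔽 𝕂
  open import Relation.Binary.Reasoning.Setoid setoid

  Charᶜ = Char 𝔽 𝕂
  εᶜ = ε 𝔽 𝕂
  _≐ᶜ_ = _≐_ 𝔽 𝕂
  _·ᶜ_ = _·_ 𝔽 𝕂
  Is = IsCharacter 𝔽 𝕂

  open DistinctLists {A = Charᶜ} _≐ᶜ_ (λ e x → sym (e x)) (λ e e′ x → trans (e x) (e′ x))
    using () renaming (⨁-perm to ⨁-permᶜ; ⨁-single to ⨁-singleᶜ)

  ε-0 : ∀ {x} → x F.≈ F.0# → εᶜ x ≈ 0#
  ε-0 {x} x≈0 with x F.≟ F.0#
  ... | yes _  = refl
  ... | no x≉0 = ⊥-elim (x≉0 x≈0)

  ε-unit : ∀ {x} → ¬ x F.≈ F.0# → εᶜ x ≈ 1#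
  ε-unit {x} x≉0 with x F.≟ F.0#
  ... | yes x≈0 = ⊥-elim (x≉0 x≈0)
  ... | no _    = refl

  ε-char : Is εᶜ
  ε-char = resp , ε-0 F.refl , ε-unit (F.0≉1 ∘ F.sym) , mult
    where
    resp : Respectful εᶜ
    resp {x} {y} x≈y with x F.≟ F.0#
    ... | yes x≈0 = sym (ε-0 (F.trans (F.sym x≈y) x≈0))
    ... | no x≉0  = sym (ε-unit (x≉0 ∘ F.trans x≈y))
    mult : ∀ x y → εᶜ (x F.* y) ≈ εᶜ x * εᶜ y
    mult x y with x F.≟ F.0# | y F.≟ F.0#
    ... | yes x≈0 | _       = trans (ε-0 (F.trans (F.*-congʳ x≈0) (F.zeroˡ y))) (sym (zeroˡ _))
    ... | no _    | yes y≈0 = trans (ε-0 (F.trans (F.*-congˡ y≈0) (F.zeroʳ x))) (sym (zeroʳ _))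
    ... | no x≉0  | no y≉0  = trans (ε-unit (F.x*y≉0 x≉0 y≉0)) (sym (*-identityˡ 1#))

  ·-char : ∀ {χ ψ} → Is χ → Is ψ → Is (χ ·ᶜ ψ)
  ·-char {χ} {ψ} c c′ =
    (λ e → *-cong (X.χ-resp e) (Y.χ-resp e)) ,
    trans (*-congʳ (X.χ-0 F.refl)) (zeroˡ _) ,
    trans (*-cong (X.χ-1 F.refl) (Y.χ-1 F.refl)) (*-identityˡ 1#) ,
    (λ x y → trans (*-cong (X.χ-* x y) (Y.χ-* x y))
      (solve 4 (λ a b c d → (a :* b) :* (c :* d) := (a :* c) :* (b :* d)) refl (χ x) (χ y) (ψ x) (ψ y)))
    where
    module X = CharacterProperties c
    module Y = CharacterProperties c′

  ε-· : ∀ {χ} → Is χ → (εᶜ ·ᶜ χ) ≐ᶜ χ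
  ε-· {χ} c x with x F.≟ F.0#
  ... | yes x≈0 = trans (zeroˡ _) (sym (CharacterProperties.χ-0 c x≈0))
  ... | no _    = *-identityˡ _

  g : F.Carrier
  g = proj₁ F.generator

  g-generator : F.IsGenerator g
  g-generator = proj₂ F.generator

  g≉0 : ¬ g F.≈ F.0#
  g≉0 = proj₁ g-generator

  χ-g≈1⇒trivial : ∀ {χ} → Is χ → χ g ≈ 1# → χ ≐ᶜ εᶜ
  χ-g≈1⇒trivial {χ} c e x with x F.≟ F.0#
  ... | yes x≈0 = χ-0 x≈0
    where open CharacterProperties c
  ... | no x≉0 =
    let i , _ , x≈g^i = F.log g-generator x≉0
    in trans (χ-resp x≈g^i) (trans (χ-pow g i) (trans (pow-cong i e) (pow-1# i)))
    where open CharacterProperties c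

  order : Carrier
  order = fromℕ F.order

  q≈1+order : q ≈ 1# + order
  q≈1+order = reflexive (≡.cong fromℕ F.size≡suc-order)

  ∑-ε : ∑ εᶜ ≈ order
  ∑-ε = lincomb₂ 1# 1#
    (trans (sym (trans (∑-+ _ _) (+-congˡ (∑-𝟙 F.0#)))) (trans (∑-cong pointwise) ∑-1)) q≈1+order
    (solve 3 (λ t q n → t :- n := con 1ℤ :* ((t :+ con 1ℤ) :- q) :+ con 1ℤ :* (q :- (con 1ℤ :+ n))) refl (∑ εᶜ) q order)
    where
    pointwise : ∀ x → εᶜ x + 𝟙 (x F.≟ F.0#) ≈ 1#
    pointwise x with x F.≟ F.0#
    ... | yes _ = +-identityˡ 1#
    ... | no _  = +-identityʳ 1#

  x≈c*x⇒x≈0 : ∀ {c x} → ¬ c ≈ 1# → x ≈ c * x → x ≈ 0#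
  x≈c*x⇒x≈0 {c} {x} c≉1 e = x*y≈0⇒y≈0 (x-y≉0 c≉1) (lincomb (- 1#) e
    (solve 2 (λ c x → (c :- con 1ℤ) :* x :- con 0ℤ := :- con 1ℤ :* (x :- c :* x)) refl c x))

  -- Scaling the variable by `g` multiplies the sum by `χ g`. A point with value other than 1 cannot
  -- be searched for without deciding equality in the coefficient field, but the generator is always
  -- such a point.
  ∑-nontrivial : ∀ {χ} → Is χ → ¬ χ ≐ᶜ εᶜ → ∑ χ ≈ 0#
  ∑-nontrivial {χ} c χ≢ε = x≈c*x⇒x≈0 (χ≢ε ∘ χ-g≈1⇒trivial c)
    (trans (∑-reindex (g F.*_) (F.*-cancelˡ-≉0 g≉0) χ-resp) (trans (∑-cong (χ-* g)) (∑-*ˡ (χ g) χ)))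
    where open CharacterProperties c

  module Orthogonality {ζ : Carrier} (ζ^N≈1 : pow ζ F.order ≈ 1#)
    (ζ-primitive : ∀ k → 0 < k → k < F.order → ¬ pow ζ k ≈ 1#)
    {chars : List Charᶜ} (chars-all : AllCharacters 𝔽 𝕂 chars) where

    private
      transfer-≤ : ∀ {i j} → i ≤ j → F.pow g i F.≈ F.pow g j → pow ζ i ≈ pow ζ j
      transfer-≤ {i} {j} i≤j e with proj₂ g-generator (j ∸ i) (F.pow-∸ g≉0 i≤j e)
      ... | divides m j-i≡m*N = begin
        pow ζ i                     ≈⟨ sym (*-identityʳ _) ⟩
        pow ζ i * 1#                ≈⟨ *-congˡ (sym (pow-multiple m ζ^N≈1)) ⟩
        pow ζ i * pow ζ (m ℕ.* F.order) ≡⟨ ≡.cong (λ k → pow ζ i * pow ζ k) (≡.sym j-i≡m*N) ⟩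
        pow ζ i * pow ζ (j ∸ i)     ≈⟨ sym (pow-+ ζ i (j ∸ i)) ⟩
        pow ζ (i ℕ.+ (j ∸ i))       ≡⟨ ≡.cong (pow ζ) (ℕₚ.m+[n∸m]≡n i≤j) ⟩
        pow ζ j                     ∎

      transfer : ∀ {i j} → F.pow g i F.≈ F.pow g j → pow ζ i ≈ pow ζ j
      transfer {i} {j} e with ℕₚ.≤-total i j
      ... | inj₁ i≤j = transfer-≤ {i} {j} i≤j e
      ... | inj₂ j≤i = sym (transfer-≤ {j} {i} j≤i (F.sym e))

    -- The faithful character that sends g^i to ζ^i. Its value at any unit t ≠ 1 differs from 1,
    -- which is what the twisting argument for orthogonality requires.
    χ₁ : Charᶜ
    χ₁ x with x F.≟ F.0#
    ... | yes _  = 0#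
    ... | no x≉0 = pow ζ (proj₁ (F.log g-generator x≉0))

    χ₁-0 : ∀ {x} → x F.≈ F.0# → χ₁ x ≈ 0#
    χ₁-0 {x} x≈0 with x F.≟ F.0#
    ... | yes _  = refl
    ... | no x≉0 = ⊥-elim (x≉0 x≈0)

    χ₁-pow : ∀ {x} i → x F.≈ F.pow g i → χ₁ x ≈ pow ζ i
    χ₁-pow {x} i x≈g^i with x F.≟ F.0#
    ... | yes x≈0 = ⊥-elim (F.pow-≉0 i g≉0 (F.trans (F.sym x≈g^i) x≈0))
    ... | no x≉0 with F.log g-generator x≉0
    ... | j , _ , x≈g^j = transfer {j} {i} (F.trans (F.sym x≈g^j) x≈g^i)

    χ₁-char : Is χ₁
    χ₁-char = resp , χ₁-0 F.refl , χ₁-pow 0 F.refl , mult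
      where
      resp : Respectful χ₁
      resp {x} {y} x≈y = by-cases (y F.≟ F.0#)
        where
        by-cases : Dec (y F.≈ F.0#) → χ₁ x ≈ χ₁ y
        by-cases (yes y≈0) = trans (χ₁-0 (F.trans x≈y y≈0)) (sym (χ₁-0 y≈0))
        by-cases (no y≉0) = let i , _ , e = F.log g-generator y≉0 in
          trans (χ₁-pow i (F.trans x≈y e)) (sym (χ₁-pow i e))
      mult : ∀ x y → χ₁ (x F.* y) ≈ χ₁ x * χ₁ y
      mult x y = by-cases (x F.≟ F.0#) (y F.≟ F.0#)
        where
        by-cases : Dec (x F.≈ F.0#) → Dec (y F.≈ F.0#) → χ₁ (x F.* y) ≈ χ₁ x * χ₁ y
        by-cases (yes x≈0) _ = trans (χ₁-0 (F.trans (F.*-congʳ x≈0) (F.zeroˡ y))) (sym (trans (*-congʳ (χ₁-0 x≈0)) (zeroˡ _)))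
        by-cases (no _) (yes y≈0) = trans (χ₁-0 (F.trans (F.*-congˡ y≈0) (F.zeroʳ x))) (sym (trans (*-congˡ (χ₁-0 y≈0)) (zeroʳ _)))
        by-cases (no x≉0) (no y≉0) =
          let i , _ , e  = F.log g-generator x≉0
              j , _ , e′ = F.log g-generator y≉0
          in trans (χ₁-pow (i ℕ.+ j) (F.trans (F.*-cong e e′) (F.sym (F.pow-+ g i j))))
               (trans (pow-+ ζ i j) (sym (*-cong (χ₁-pow i e) (χ₁-pow j e′))))

    χ₁-separates : ∀ {t} → ¬ t F.≈ F.0# → ¬ t F.≈ F.1# → ¬ χ₁ t ≈ 1#
    χ₁-separates t≉0 t≉1 e with F.log g-generator t≉0
    ... | zero  , _   , t≈1   = t≉1 t≈1
    ... | suc i , i<N , t≈g^i = ζ-primitive (suc i) (s≤s z≤n) i<N (trans (sym (χ₁-pow (suc i) t≈g^i)) e)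

    private
      chars-are : All Is chars
      chars-are = proj₁ chars-all

      at : F.Carrier → Carrier
      at t = ⨁ chars (λ χ → χ t)

      at-0 : ∀ {t} → t F.≈ F.0# → at t ≈ 0#
      at-0 t≈0 = trans (⨁-congᴬ (All.map (λ c → CharacterProperties.χ-0 c t≈0) chars-are)) (⨁-unit chars)

      at-1 : ∀ {t} → t F.≈ F.1# → at t ≈ fromℕ (length chars)
      at-1 t≈1 = trans (⨁-congᴬ (All.map (λ c → CharacterProperties.χ-1 c t≈1) chars-are)) (⨁-1 chars)

      -- Twisting by `χ₁` permutes the characters and multiplies their sum at `t` by `χ₁ t`, which
      -- is not 1.
      at-other : ∀ {t} → ¬ t F.≈ F.0# → ¬ t F.≈ F.1# → at t ≈ 0#
      at-other {t} t≉0 t≉1 = x≈c*x⇒x≈0 (χ₁-separates t≉0 t≉1) (trans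
        (sym (⨁-permᶜ +-commutativeMonoid (λ χ → χ t) (λ e → e t) twisted-distinct twisted-⊑
          (ℕₚ.≤-reflexive (≡.sym (length-map (χ₁ ·ᶜ_) chars)))))
        (trans (⨁-map (χ₁ ·ᶜ_) chars (λ χ → χ t)) (⨁-*ˡ (χ₁ t) chars (λ χ → χ t))))
        where
        module X = CharacterProperties χ₁-char
        cancel : ∀ {χ ψ} → Is χ → Is ψ → (χ₁ ·ᶜ χ) ≐ᶜ (χ₁ ·ᶜ ψ) → χ ≐ᶜ ψ
        cancel c c′ e x with x F.≟ F.0#
        ... | yes x≈0 = trans (CharacterProperties.χ-0 c x≈0) (sym (CharacterProperties.χ-0 c′ x≈0))
        ... | no x≉0  = *-cancelˡ-≉0 (x*y≈1⇒x≉0 (X.χ-inverse x≉0)) (e x)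
        twisted-distinct : AllPairs (λ χ ψ → ¬ χ ≐ᶜ ψ) (map (χ₁ ·ᶜ_) chars)
        twisted-distinct = AllPairsₚ.map⁺ (AllPairs-mapᴬ (λ c c′ ¬e e → ¬e (cancel c c′ e)) chars-are (proj₂ (proj₂ chars-all)))
        twisted-⊑ : All (λ χ → Any (χ ≐ᶜ_) chars) (map (χ₁ ·ᶜ_) chars)
        twisted-⊑ = Allₚ.map⁺ (All.map (λ c → proj₁ (proj₂ chars-all) _ (·-char χ₁-char c)) chars-are)

      at-𝟙 : ∀ t → at t ≈ 𝟙 (t F.≟ F.1#) * fromℕ (length chars)
      at-𝟙 t with t F.≟ F.1#
      ... | yes t≈1 = trans (at-1 t≈1) (sym (*-identityˡ _))
      ... | no t≉1 with t F.≟ F.0#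
      ... | yes t≈0 = trans (at-0 t≈0) (sym (zeroˡ _))
      ... | no t≉0  = trans (at-other t≉0 t≉1) (sym (zeroˡ _))

    -- Both sides count: sum χ(t) over all t and χ.
    length-chars : fromℕ (length chars) ≈ order
    length-chars = begin
      fromℕ (length chars)
        ≈⟨ sym (∑-𝟙-*ʳ F.1# _) ⟩
      ∑ (λ t → 𝟙 (t F.≟ F.1#) * fromℕ (length chars))
        ≈⟨ ∑-cong (sym ∘ at-𝟙) ⟩
      ∑ at
        ≈⟨ ⨁-swap F.elements chars (λ t χ → χ t) ⟩
      ⨁ chars ∑
        ≈⟨ ⨁-singleᶜ +-commutativeMonoid ∑ (λ e → ∑-cong (sym ∘ e))
             (λ c ε≢χ → ∑-nontrivial c (λ e → ε≢χ (sym ∘ e)))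
             chars-are (proj₁ (proj₂ chars-all) εᶜ ε-char) (proj₂ (proj₂ chars-all)) ⟩
      ∑ εᶜ
        ≈⟨ ∑-ε ⟩
      order ∎

    orthogonality : ∀ t → ⨁ chars (λ χ → χ t) ≈ order * 𝟙 (t F.≟ F.1#)
    orthogonality t = trans (at-𝟙 t) (trans (*-congˡ length-chars) (*-comm _ _))

  module CubicCharacter {ρ : Charᶜ} (ρ-char : Is ρ) (ρ-three : OrderThree 𝔽 𝕂 ρ) where
    open CharacterProperties ρ-char using () renaming (χ-resp to ρ-resp; χ-* to ρ-*; χ-pow to ρ-pow)

    ρ³≈1 : ∀ {k} → ¬ k F.≈ F.0# → ρ k * ρ k * ρ k ≈ 1#
    ρ³≈1 {k} k≉0 = trans (proj₁ ρ-three k) (ε-unit k≉0)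

    -- Write k = g^i. If 3 did not divide i, then ρ(g)³ = 1 and ρ(g)^i = 1 would force ρ(g) = 1,
    -- making ρ trivial.
    ρ≈1⇒cube : ∀ {k} → ¬ k F.≈ F.0# → ρ k ≈ 1# → ∃[ m ] m F.* m F.* m F.≈ k
    ρ≈1⇒cube {k} k≉0 e with F.log g-generator k≉0
    ... | i , _ , k≈g^i with 3 ∣? i
    ... | yes (divides j ≡.refl) = F.pow g j , F.trans
            (F.solve 1 (λ x → x F.:* x F.:* x F.:= x F.:* (x F.:* (x F.:* F.con 1ℤ))) F.refl (F.pow g j))
            (F.trans (F.sym (F.pow-*′ g j 3)) (F.sym k≈g^i))
    ... | no 3∤i = ⊥-elim (proj₂ ρ-three (χ-g≈1⇒trivial ρ-char (trans (sym (*-identityʳ _))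
            (pow-bezout (coprime-Bézout (prime∤⇒coprime 3-prime 3∤i))
              (trans (solve 1 (λ x → x :* (x :* (x :* con 1ℤ)) := x :* x :* x) refl (ρ g)) (ρ³≈1 g≉0))
              (trans (sym (ρ-pow g i)) (trans (ρ-resp (F.sym k≈g^i)) e))))))
      where
      3-prime : Prime 3
      3-prime = from-yes (prime? 3)

    module _ {ω : F.Carrier} (ω²+ω+1≈0 : ω F.* ω F.+ ω F.+ F.1# F.≈ F.0#) (ω≉1 : ¬ ω F.≈ F.1#) where

      private
        ω³≈1 : ω F.* ω F.* ω F.≈ F.1#
        ω³≈1 = F.lincomb (ω F.- F.1#) ω²+ω+1≈0 (F.solve 1 (λ w → w F.:* w F.:* w F.:- F.con 1ℤ F.:=
          (w F.:- F.con 1ℤ) F.:* (w F.:* w F.:+ w F.:+ F.con 1ℤ F.:- F.con 0ℤ)) F.refl ω)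

        ω²≉1 : ¬ ω F.* ω F.≈ F.1#
        ω²≉1 e = ω≉1 (F.lincomb₂ F.1# (F.- ω) ω³≈1 e (F.solve 1 (λ w → w F.:- F.con 1ℤ F.:=
          F.con 1ℤ F.:* (w F.:* w F.:* w F.:- F.con 1ℤ) F.:+ F.:- w F.:* (w F.:* w F.:- F.con 1ℤ)) F.refl ω))

        ω²≉ω : ¬ ω F.* ω F.≈ ω
        ω²≉ω e = ω≉1 (F.sym (F.lincomb₂ (F.- F.1#) (ω F.+ F.1#) ω³≈1 e (F.solve 1 (λ w → F.con 1ℤ F.:- w F.:=
          F.:- F.con 1ℤ F.:* (w F.:* w F.:* w F.:- F.con 1ℤ) F.:+ (w F.:+ F.con 1ℤ) F.:* (w F.:* w F.:- w)) F.refl ω)))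

        rootsOfUnity : ∀ z → 𝟙 (z F.* z F.* z F.≟ F.1#) ≈ 𝟙 (z F.≟ F.1#) + (𝟙 (z F.≟ ω) + 𝟙 (z F.≟ ω F.* ω))
        rootsOfUnity z with z F.≟ F.1# | z F.≟ ω | z F.≟ ω F.* ω
        ... | yes e | yes e′ | _ = ⊥-elim (ω≉1 (F.trans (F.sym e′) e))
        ... | yes e | no _ | yes e′ = ⊥-elim (ω²≉1 (F.trans (F.sym e′) e))
        ... | no _ | yes e | yes e′ = ⊥-elim (ω²≉ω (F.trans (F.sym e′) e))
        ... | yes e | no _ | no _ = trans (𝟙-yes (z F.* z F.* z F.≟ F.1#) (F.trans (F.*-cong (F.*-cong e e) e)
                (F.solve 0 (F.con 1ℤ F.:* F.con 1ℤ F.:* F.con 1ℤ F.:= F.con 1ℤ) F.refl)))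
                (solve 0 (con 1ℤ := con 1ℤ :+ (con 0ℤ :+ con 0ℤ)) refl)
        ... | no _ | yes e | no _ = trans (𝟙-yes (z F.* z F.* z F.≟ F.1#) (F.trans (F.*-cong (F.*-cong e e) e) ω³≈1))
                (solve 0 (con 1ℤ := con 0ℤ :+ (con 1ℤ :+ con 0ℤ)) refl)
        ... | no _ | no _ | yes e = trans (𝟙-yes (z F.* z F.* z F.≟ F.1#) (F.trans (F.*-cong (F.*-cong e e) e)
                (F.lincomb (ω F.* ω F.* ω F.+ F.1#) ω³≈1 (F.solve 1 (λ w → w F.:* w F.:* (w F.:* w) F.:* (w F.:* w) F.:- F.con 1ℤ F.:=
                  (w F.:* w F.:* w F.:+ F.con 1ℤ) F.:* (w F.:* w F.:* w F.:- F.con 1ℤ)) F.refl ω))))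
                (solve 0 (con 1ℤ := con 0ℤ :+ (con 0ℤ :+ con 1ℤ)) refl)
        ... | no n₁ | no n₂ | no n₃ = trans (𝟙-no (z F.* z F.* z F.≟ F.1#) (λ e →
                F.x*y≉0 (F.x*y≉0 (F.x-y≉0 n₁) (F.x-y≉0 n₂)) (F.x-y≉0 n₃)
                  (F.lincomb₂ F.1# ((z F.- F.1#) F.* (ω F.- F.1# F.- z)) e ω²+ω+1≈0 (F.solve 2 (λ z w →
                    (z F.:- F.con 1ℤ) F.:* (z F.:- w) F.:* (z F.:- w F.:* w) F.:- F.con 0ℤ F.:=
                    F.con 1ℤ F.:* (z F.:* z F.:* z F.:- F.con 1ℤ)
                      F.:+ (z F.:- F.con 1ℤ) F.:* (w F.:- F.con 1ℤ F.:- z) F.:* (w F.:* w F.:+ w F.:+ F.con 1ℤ F.:- F.con 0ℤ)) F.refl z ω))))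
                (solve 0 (con 0ℤ := con 0ℤ :+ (con 0ℤ :+ con 0ℤ)) refl)

      -- Now ρ(k) ≠ 1, so 1 + ρ(k) + ρ(k)² vanishes as the other factor of ρ(k)³ - 1. Being a cube
      -- is decided in the finite field, since ρ(k) = 1 cannot be decided directly.
      noncube-cubeRoots : ∀ {k} → ¬ k F.≈ F.0# → ¬ (∃[ m ] m F.* m F.* m F.≈ k) →
        ∑ (λ m → 𝟙 (m F.* m F.* m F.≟ k)) ≈ 1# + ρ k + ρ k * ρ k
      noncube-cubeRoots {k} k≉0 ¬cube = trans (trans (∑-cong (λ m → 𝟙-no (m F.* m F.* m F.≟ k) (λ e → ¬cube (m , e)))) (⨁-unit F.elements))
              (sym (x*y≈0⇒y≈0 (x-y≉0 (¬cube ∘ ρ≈1⇒cube k≉0)) (lincomb 1# (ρ³≈1 k≉0)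
                (solve 1 (λ r → (r :- con 1ℤ) :* (con 1ℤ :+ r :+ r :* r) :- con 0ℤ := con 1ℤ :* (r :* r :* r :- con 1ℤ)) refl (ρ k)))))

      cube-cubeRoots : ∀ {k} → ¬ k F.≈ F.0# → (∃[ m ] m F.* m F.* m F.≈ k) →
        ∑ (λ m → 𝟙 (m F.* m F.* m F.≟ k)) ≈ 1# + ρ k + ρ k * ρ k
      cube-cubeRoots {k} k≉0 (a , a³≈k) = begin
        ∑ (λ m → 𝟙 (m F.* m F.* m F.≟ k))
          ≈⟨ ∑-reindex (a F.*_) (F.*-cancelˡ-≉0 a≉0) (λ {x} {y} x≈y → 𝟙-cong (x F.* x F.* x F.≟ k) (y F.* y F.* y F.≟ k)
               (F.trans (F.sym (cube-cong x≈y))) (F.trans (cube-cong x≈y))) ⟩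
        ∑ (λ z → 𝟙 (a F.* z F.* (a F.* z) F.* (a F.* z) F.≟ k))
          ≈⟨ ∑-cong (λ z → trans (𝟙-cong (a F.* z F.* (a F.* z) F.* (a F.* z) F.≟ k) (z F.* z F.* z F.≟ F.1#)
               (λ e → F.*-cancelˡ-≉0 k≉0 (F.trans (F.sym (scaled z)) (F.trans e (F.sym (F.*-identityʳ k)))))
               (λ e → F.trans (scaled z) (F.trans (F.*-congˡ e) (F.*-identityʳ k)))) (rootsOfUnity z)) ⟩
        ∑ (λ z → 𝟙 (z F.≟ F.1#) + (𝟙 (z F.≟ ω) + 𝟙 (z F.≟ ω F.* ω)))
          ≈⟨ trans (∑-+ _ _) (+-cong (∑-𝟙 F.1#) (trans (∑-+ _ _) (+-cong (∑-𝟙 ω) (∑-𝟙 (ω F.* ω))))) ⟩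
        1# + (1# + 1#)
          ≈⟨ solve 0 (con 1ℤ :+ (con 1ℤ :+ con 1ℤ) := con 1ℤ :+ con 1ℤ :+ con 1ℤ :* con 1ℤ) refl ⟩
        1# + 1# + 1# * 1#
          ≈⟨ +-cong (+-congˡ (sym ρk≈1)) (*-cong (sym ρk≈1) (sym ρk≈1)) ⟩
        1# + ρ k + ρ k * ρ k ∎
        where
        cube-cong : ∀ {x y} → x F.≈ y → x F.* x F.* x F.≈ y F.* y F.* y
        cube-cong e = F.*-cong (F.*-cong e e) e
        a≉0 : ¬ a F.≈ F.0#
        a≉0 e = k≉0 (F.trans (F.sym a³≈k) (F.trans (F.*-congˡ e) (F.zeroʳ _)))
        ρk≈1 : ρ k ≈ 1#
        ρk≈1 = trans (ρ-resp (F.sym a³≈k)) (trans (ρ-* _ a) (trans (*-congʳ (ρ-* a a)) (ρ³≈1 a≉0)))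
        scaled : ∀ z → a F.* z F.* (a F.* z) F.* (a F.* z) F.≈ k F.* (z F.* z F.* z)
        scaled z = F.trans (F.solve 2 (λ a z → a F.:* z F.:* (a F.:* z) F.:* (a F.:* z) F.:= a F.:* a F.:* a F.:* (z F.:* z F.:* z)) F.refl a z)
          (F.*-congʳ a³≈k)

      cubeRoots : ∀ {k} → ¬ k F.≈ F.0# → ∑ (λ m → 𝟙 (m F.* m F.* m F.≟ k)) ≈ 1# + ρ k + ρ k * ρ k
      cubeRoots {k} k≉0 = by-cases (any-element? {λ m → m F.* m F.* m F.≈ k}
        (λ x≈y → F.trans (F.sym (F.*-cong (F.*-cong x≈y x≈y) x≈y))) (λ m → m F.* m F.* m F.≟ k))
        where
        by-cases : Dec (∃[ m ] m F.* m F.* m F.≈ k) → ∑ (λ m → 𝟙 (m F.* m F.* m F.≟ k)) ≈ 1# + ρ k + ρ k * ρ k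
        by-cases (yes cube) = cube-cubeRoots k≉0 cube
        by-cases (no ¬cube) = noncube-cubeRoots k≉0 ¬cube

-- The hypergeometric series as a sum over the conic

module Hypergeometric (𝔽 : FiniteField) (𝕂 : CharZeroField) where
  open Sums 𝔽 𝕂
  open Characters 𝔽 𝕂
  open WeierstrassCount 𝔽 𝕂 using (conicDiscriminant)
  open import Relation.Binary.Reasoning.Setoid setoid

  ∑-product : ∀ f h → ∑ f * ∑ h ≈ ∑ (λ x → ∑ (λ y → f x * h y))
  ∑-product f h = trans (sym (∑-*ʳ (∑ h) f)) (∑-cong (λ x → sym (∑-*ˡ (f x) h)))

  -- The quotient x/(1 - x). Its value 0 at x = 1 matches the convention that a conjugate character
  -- vanishes at 0.
  ratio : F.Carrier → F.Carrier
  ratio x = x F.* F.inv (F.1# F.- x)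

  ratio-resp : ∀ {x y} → x F.≈ y → ratio x F.≈ ratio y
  ratio-resp e = F.*-cong e (F.inv-cong (F.+-congˡ (F.-‿cong e)))

  module _ {ρ : Charᶜ} (ρ-char : Is ρ) (l : F.Carrier) where
    open CharacterProperties ρ-char using () renaming (χ-resp to ρ-resp; χ-0 to ρ-0; χ-* to ρ-*)

    weight : F.Carrier → F.Carrier → Carrier
    weight x y = ρ x * (ρ y * ρ y)

    -- The equation z = 1 is the conic λxy = (1 - x)(1 - y); for x = 1 or y = 1 the value of `z` is
    -- 0, so no such point counts.
    z : F.Carrier → F.Carrier → F.Carrier
    z x y = l F.* (ratio x F.* ratio y)

    module _ {χ : Charᶜ} (χ-char : Is χ) where
      open CharacterProperties χ-char

      private
        -1ᶠ = F.- F.1#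

        jacobi₁ : jacobi 𝔽 𝕂 (ρ ·ᶜ χ) χ ≈ χ -1ᶠ * q ⁻¹ * ∑ (λ x → ρ x * χ (ratio x))
        jacobi₁ = *-congˡ (∑-cong (λ x → trans (*-congˡ (bar≈inv _))
          (trans (*-assoc _ _ _) (*-congˡ (sym (χ-* x _))))))

        ε·χ = ε-· χ-char

        jacobi₂ : jacobi 𝔽 𝕂 ((ρ ·ᶜ ρ) ·ᶜ χ) (εᶜ ·ᶜ χ) ≈ χ -1ᶠ * q ⁻¹ * ∑ (λ y → ρ y * ρ y * χ (ratio y))
        jacobi₂ = *-cong (*-congʳ (ε·χ -1ᶠ)) (∑-cong (λ y → trans
          (*-congˡ (trans (CharacterProperties.bar≈inv (·-char ε-char χ-char) _) (ε·χ _)))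
          (trans (*-assoc _ _ _) (*-congˡ (sym (χ-* y _))))))

      -- The two signs χ(-1) multiply to 1, and the values of χ at λ and at the two ratios merge
      -- into the single value χ(z).
      hyp-term : jacobi 𝔽 𝕂 (ρ ·ᶜ χ) χ * jacobi 𝔽 𝕂 ((ρ ·ᶜ ρ) ·ᶜ χ) (εᶜ ·ᶜ χ) * χ l
        ≈ q ⁻¹ * q ⁻¹ * ∑ (λ x → ∑ (λ y → weight x y * χ (z x y)))
      hyp-term = begin
        jacobi 𝔽 𝕂 (ρ ·ᶜ χ) χ * jacobi 𝔽 𝕂 ((ρ ·ᶜ ρ) ·ᶜ χ) (εᶜ ·ᶜ χ) * χ l
          ≈⟨ *-congʳ (*-cong jacobi₁ jacobi₂) ⟩
        χ -1ᶠ * q ⁻¹ * A * (χ -1ᶠ * q ⁻¹ * B) * χ l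
          ≈⟨ lincomb (q ⁻¹ * q ⁻¹ * (χ l * (A * B))) χ-neg1² (solve 5 (λ s i a b c →
               s :* i :* a :* (s :* i :* b) :* c :- i :* i :* (c :* (a :* b)) :=
               i :* i :* (c :* (a :* b)) :* (s :* s :- con 1ℤ)) refl (χ -1ᶠ) (q ⁻¹) A B (χ l)) ⟩
        q ⁻¹ * q ⁻¹ * (χ l * (A * B))
          ≈⟨ *-congˡ (trans (*-congˡ (∑-product _ _)) (trans (sym (∑-*ˡ (χ l) _)) (∑-cong (λ x →
               trans (sym (∑-*ˡ (χ l) _)) (∑-cong (λ y → merge x y)))))) ⟩
        q ⁻¹ * q ⁻¹ * ∑ (λ x → ∑ (λ y → weight x y * χ (z x y))) ∎
        where
        A = ∑ (λ x → ρ x * χ (ratio x))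
        B = ∑ (λ y → ρ y * ρ y * χ (ratio y))
        merge : ∀ x y → χ l * (ρ x * χ (ratio x) * (ρ y * ρ y * χ (ratio y))) ≈ weight x y * χ (z x y)
        merge x y = trans
          (solve 5 (λ l r s a b → l :* (r :* a :* (s :* s :* b)) := r :* (s :* s) :* (l :* (a :* b))) refl
            (χ l) (ρ x) (ρ y) (χ (ratio x)) (χ (ratio y)))
          (*-congˡ (sym (trans (χ-* l _) (*-congˡ (χ-* (ratio x) (ratio y))))))

    conicSum : Carrier
    conicSum = ∑ (λ x → ∑ (λ y → weight x y * 𝟙 (z x y F.≟ F.1#)))

    module _ {ζ : Carrier} (ζ^N≈1 : pow ζ F.order ≈ 1#)
      (ζ-primitive : ∀ k → 0 < k → k < F.order → ¬ pow ζ k ≈ 1#)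
      {chars : List Charᶜ} (chars-all : AllCharacters 𝔽 𝕂 chars) where
      open Orthogonality ζ^N≈1 ζ-primitive chars-all

      -- Orthogonality produces the factor q - 1, and the constants combine to -q · q/(q - 1) · q⁻²
      -- · (q - 1) = -1.
      hyp≈conicSum : - q * hyp2F1 𝔽 𝕂 chars ρ (ρ ·ᶜ ρ) εᶜ l ≈ - conicSum
      hyp≈conicSum = trans (*-congˡ (*-congˡ terms)) (lincomb₂
        (- ((u + 1#) * (order * r) * conicSum)) (- conicSum) u≈1 v≈1
        (solve 5 (λ q i n r s → let u = q :* i in
          :- q :* (q :* r :* (i :* i :* (n :* s))) :- :- s :=
          :- ((u :+ con 1ℤ) :* (n :* r) :* s) :* (u :- con 1ℤ) :+ :- s :* (n :* r :- con 1ℤ)) refl q (q ⁻¹) order r conicSum))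
        where
        r = (q - 1#) ⁻¹
        u = q * q ⁻¹
        q-1≈order : q - 1# ≈ order
        q-1≈order = lincomb 1# q≈1+order (solve 2 (λ q n → q :- con 1ℤ :- n := con 1ℤ :* (q :- (con 1ℤ :+ n))) refl q order)
        fromℕ≉0 : ∀ n → 0 < n → ¬ fromℕ n ≈ 0#
        fromℕ≉0 (suc n) _ = charZero n
        u≈1 : u ≈ 1#
        u≈1 = ⁻¹-inv q (charZero F.order ∘ trans (sym q≈1+order))
        v≈1 : order * r ≈ 1#
        v≈1 = trans (*-congʳ (sym q-1≈order)) (⁻¹-inv (q - 1#) (fromℕ≉0 F.order F.0<order ∘ trans (sym q-1≈order)))
        terms : ⨁ chars (λ χ → jacobi 𝔽 𝕂 (ρ ·ᶜ χ) χ * jacobi 𝔽 𝕂 ((ρ ·ᶜ ρ) ·ᶜ χ) (εᶜ ·ᶜ χ) * χ l)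
          ≈ q ⁻¹ * q ⁻¹ * (order * conicSum)
        terms = begin
          ⨁ chars (λ χ → jacobi 𝔽 𝕂 (ρ ·ᶜ χ) χ * jacobi 𝔽 𝕂 ((ρ ·ᶜ ρ) ·ᶜ χ) (εᶜ ·ᶜ χ) * χ l)
            ≈⟨ ⨁-congᴬ (All.map hyp-term (proj₁ chars-all)) ⟩
          ⨁ chars (λ χ → q ⁻¹ * q ⁻¹ * ∑ (λ x → ∑ (λ y → weight x y * χ (z x y))))
            ≈⟨ ⨁-*ˡ _ chars _ ⟩
          q ⁻¹ * q ⁻¹ * ⨁ chars (λ χ → ∑ (λ x → ∑ (λ y → weight x y * χ (z x y))))
            ≈⟨ *-congˡ (trans (⨁-swap chars F.elements _) (∑-cong (λ x → ⨁-swap chars F.elements _))) ⟩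
          q ⁻¹ * q ⁻¹ * ∑ (λ x → ∑ (λ y → ⨁ chars (λ χ → weight x y * χ (z x y))))
            ≈⟨ *-congˡ (∑-cong (λ x → ∑-cong (λ y → trans (⨁-*ˡ (weight x y) chars _) (trans (*-congˡ (orthogonality (z x y)))
                 (solve 3 (λ w n i → w :* (n :* i) := n :* (w :* i)) refl (weight x y) order (𝟙 (z x y F.≟ F.1#))))))) ⟩
          q ⁻¹ * q ⁻¹ * ∑ (λ x → ∑ (λ y → order * (weight x y * 𝟙 (z x y F.≟ F.1#))))
            ≈⟨ *-congˡ (trans (∑-cong (λ x → ∑-*ˡ order _)) (∑-*ˡ order _)) ⟩
          q ⁻¹ * q ⁻¹ * (order * conicSum) ∎

    module _ (2≉0 : ¬ F.fromℕ 2 F.≈ F.0#) (l≉0 : ¬ l F.≈ F.0#) (l≉1 : ¬ l F.≈ F.1#)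
             (ρ-three : OrderThree 𝔽 𝕂 ρ) where
      open OddCharacteristic 2≉0
      open CubicCharacter ρ-char ρ-three using (ρ³≈1)

      private
        z-resp : ∀ {x y x′ y′} → x F.≈ x′ → y F.≈ y′ → z x y F.≈ z x′ y′
        z-resp e e′ = F.*-congˡ (F.*-cong (ratio-resp e) (ratio-resp e′))

        term : F.Carrier → F.Carrier → Carrier
        term x y = weight x y * 𝟙 (z x y F.≟ F.1#)

        term-resp : ∀ {x y x′ y′} → x F.≈ x′ → y F.≈ y′ → term x y ≈ term x′ y′
        term-resp {x} {y} {x′} {y′} e e′ = *-cong (*-cong (ρ-resp e) (*-cong (ρ-resp e′) (ρ-resp e′)))
          (𝟙-cong (z x y F.≟ F.1#) (z x′ y′ F.≟ F.1#) (F.trans (F.sym (z-resp e e′))) (F.trans (z-resp e e′)))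

        b : F.Carrier → F.Carrier
        b k = F.- (F.1# F.+ k)

        c : F.Carrier → F.Carrier
        c k = (l F.- F.1#) F.* k

        -- The substitution x = k/v, y = 1/v turns λxy = (1 − x)(1 − y) into v² − (1 + k)v = (λ − 1)k.
        module Substitution {v k : F.Carrier} (v≉0 : ¬ v F.≈ F.0#) (k≉0 : ¬ k F.≈ F.0#) where
          i = F.inv v
          vi = F.inv-inverse v≉0
          P = F.1# F.- k F.* i
          Q = F.1# F.- i
          A = F.inv P
          B = F.inv Q

          forward : z (k F.* i) i F.≈ F.1# → v F.* v F.+ b k F.* v F.≈ c k
          forward zz = F.lincomb₂ (F.- (v F.* v)) ((l F.* k F.- k) F.* (v F.* i F.+ F.1#) F.+ (F.1# F.+ k) F.* v) e₁ vi
            (F.solve 4 (λ l k v i → let P = F.con 1ℤ F.:- k F.:* i ; Q = F.con 1ℤ F.:- i in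
              v F.:* v F.:+ F.:- (F.con 1ℤ F.:+ k) F.:* v F.:- (l F.:- F.con 1ℤ) F.:* k F.:=
              F.:- (v F.:* v) F.:* (l F.:* (k F.:* i F.:* i) F.:- P F.:* Q)
                F.:+ ((l F.:* k F.:- k) F.:* (v F.:* i F.:+ F.con 1ℤ) F.:+ (F.con 1ℤ F.:+ k) F.:* v) F.:* (v F.:* i F.:- F.con 1ℤ))
              F.refl l k v i)
            where
            -- A zero denominator has inverse 0 and would give z = 0, not 1.
            P≉0 : ¬ P F.≈ F.0#
            P≉0 e = F.0≉1 (F.trans (F.sym (F.trans (F.*-congˡ (F.*-congʳ (F.*-congˡ (F.inv-0 e))))
              (F.solve 3 (λ l x y → l F.:* (x F.:* F.con 0ℤ F.:* y) F.:= F.con 0ℤ) F.refl l (k F.* i) (i F.* B)))) zz)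
            Q≉0 : ¬ Q F.≈ F.0#
            Q≉0 e = F.0≉1 (F.trans (F.sym (F.trans (F.*-congˡ (F.*-congˡ (F.*-congˡ (F.inv-0 e))))
              (F.solve 3 (λ l x y → l F.:* (x F.:* (y F.:* F.con 0ℤ)) F.:= F.con 0ℤ) F.refl l (k F.* i F.* A) i))) zz)
            w : P F.* A F.* (Q F.* B) F.≈ F.1#
            w = F.trans (F.*-cong (F.inv-inverse P≉0) (F.inv-inverse Q≉0)) (F.*-identityˡ F.1#)
            e₁ : l F.* (k F.* i F.* i) F.≈ P F.* Q
            e₁ = F.lincomb₂ (P F.* Q) (F.- (l F.* (k F.* i F.* i))) zz w (F.solve 7 (λ l k i P Q A B →
              l F.:* (k F.:* i F.:* i) F.:- P F.:* Q F.:=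
              P F.:* Q F.:* (l F.:* (k F.:* i F.:* A F.:* (i F.:* B)) F.:- F.con 1ℤ)
                F.:+ F.:- (l F.:* (k F.:* i F.:* i)) F.:* (P F.:* A F.:* (Q F.:* B) F.:- F.con 1ℤ)) F.refl l k i P Q A B)

          backward : v F.* v F.+ b k F.* v F.≈ c k → z (k F.* i) i F.≈ F.1#
          backward e = F.lincomb₂ (A F.* B) F.1# e₁ w (F.solve 7 (λ l k i P Q A B →
              l F.:* (k F.:* i F.:* A F.:* (i F.:* B)) F.:- F.con 1ℤ F.:=
              A F.:* B F.:* (l F.:* (k F.:* i F.:* i) F.:- P F.:* Q)
                F.:+ F.con 1ℤ F.:* (P F.:* A F.:* (Q F.:* B) F.:- F.con 1ℤ)) F.refl l k i P Q A B)
            where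
            e₁ : l F.* (k F.* i F.* i) F.≈ P F.* Q
            e₁ = F.lincomb₂ (F.- (i F.* i)) (v F.* i F.+ F.1# F.- k F.* i F.- i) e vi
              (F.solve 4 (λ l k v i → let P = F.con 1ℤ F.:- k F.:* i ; Q = F.con 1ℤ F.:- i in
                l F.:* (k F.:* i F.:* i) F.:- P F.:* Q F.:=
                F.:- (i F.:* i) F.:* (v F.:* v F.:+ F.:- (F.con 1ℤ F.:+ k) F.:* v F.:- (l F.:- F.con 1ℤ) F.:* k)
                  F.:+ (v F.:* i F.:+ F.con 1ℤ F.:- k F.:* i F.:- i) F.:* (v F.:* i F.:- F.con 1ℤ)) F.refl l k v i)
            i≉0 = F.inv-≉0 v≉0
            -- In this direction the denominators are nonzero because their product equals λk/v².
            PQ≉0 : ¬ P F.* Q F.≈ F.0#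
            PQ≉0 = F.x*y≉0 l≉0 (F.x*y≉0 (F.x*y≉0 k≉0 i≉0) i≉0) ∘ F.trans e₁
            w : P F.* A F.* (Q F.* B) F.≈ F.1#
            w = F.trans (F.*-cong
                (F.inv-inverse (λ e → PQ≉0 (F.trans (F.*-congʳ e) (F.zeroˡ Q))))
                (F.inv-inverse (λ e → PQ≉0 (F.trans (F.*-congˡ e) (F.zeroʳ P)))))
              (F.*-identityˡ F.1#)

        -- Here y = 1/v, and y = 0 is represented by v = 0. On that row the left side vanishes with
        -- ρ(y), and on the right v = 0 is no root for k ≠ 0, since (λ - 1)k ≠ 0. This is where λ ≠
        -- 1, a consequence of good reduction, enters.
        row : ∀ v → ∑ (λ x → term x (F.inv v)) ≈ ∑ (λ k → ρ k * 𝟙 (v F.* v F.+ b k F.* v F.≟ c k))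
        row v with v F.≟ F.0#
        ... | yes v≈0 = ∑-cong (λ k → trans (*-congʳ (*-congˡ (*-congʳ (ρ-0 (F.inv-0 v≈0)))))
                (trans (solve 3 (λ r s i → r :* (con 0ℤ :* s) :* i := con 0ℤ) refl (ρ k) (ρ (F.inv v)) _) (sym (vanish k))))
          where
          vanish : ∀ k → ρ k * 𝟙 (v F.* v F.+ b k F.* v F.≟ c k) ≈ 0#
          vanish k with k F.≟ F.0#
          ... | yes k≈0 = trans (*-congʳ (ρ-0 k≈0)) (zeroˡ _)
          ... | no k≉0  = trans (*-congˡ (𝟙-no (v F.* v F.+ b k F.* v F.≟ c k) (λ e → F.x*y≉0 (F.x-y≉0 l≉1) k≉0
                  (F.lincomb₂ (F.- F.1#) (v F.+ b k) e v≈0 (F.solve 3 (λ v b c → c F.:- F.con 0ℤ F.:=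
                    F.:- F.con 1ℤ F.:* (v F.:* v F.:+ b F.:* v F.:- c) F.:+ (v F.:+ b) F.:* (v F.:- F.con 0ℤ)) F.refl v (b k) (c k)))))) (zeroʳ _)
        ... | no v≉0 = trans
                (∑-reindex (F._* F.inv v) (λ e → F.*-cancelˡ-≉0 (F.inv-≉0 v≉0) (F.trans (F.*-comm _ _) (F.trans e (F.*-comm _ _))))
                  (λ e → term-resp e F.refl))
                (∑-cong pointwise)
          where
          pointwise : ∀ k → term (k F.* F.inv v) (F.inv v) ≈ ρ k * 𝟙 (v F.* v F.+ b k F.* v F.≟ c k)
          pointwise k with k F.≟ F.0#
          ... | yes k≈0 = trans (trans (*-congʳ (trans (*-congʳ (ρ-0 (F.trans (F.*-congʳ k≈0) (F.zeroˡ _)))) (zeroˡ _))) (zeroˡ _))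
                  (sym (trans (*-congʳ (ρ-0 k≈0)) (zeroˡ _)))
          ... | no k≉0 = *-cong
                  -- As ρ³ is trivial on units, ρ(k/v)ρ(1/v)² = ρ(k): the weight depends only on k =
                  -- x/y.
                  (trans (*-congʳ (ρ-* k (F.inv v))) (lincomb (ρ k) (ρ³≈1 (F.inv-≉0 v≉0))
                    (solve 2 (λ r s → r :* s :* (s :* s) :- r := r :* (s :* s :* s :- con 1ℤ)) refl (ρ k) (ρ (F.inv v)))))
                  (𝟙-cong (z (k F.* F.inv v) (F.inv v) F.≟ F.1#) (v F.* v F.+ b k F.* v F.≟ c k) forward backward)
            where open Substitution v≉0 k≉0

      -- For fixed k the number of v is 1 plus φ of the discriminant, and the constant 1 contributes
      -- the sum of ρ, which is 0.
      conicSum≈ : conicSum ≈ ∑ (λ k → ρ k * φ (conicDiscriminant l k))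
      conicSum≈ = begin
        ∑ (λ x → ∑ (λ y → term x y))
          ≈⟨ ∑-swap term ⟩
        ∑ (λ y → ∑ (λ x → term x y))
          ≈⟨ ∑-reindex F.inv F.inv-injective (λ e → ∑-cong (λ x → term-resp F.refl e)) ⟩
        ∑ (λ v → ∑ (λ x → term x (F.inv v)))
          ≈⟨ ∑-cong row ⟩
        ∑ (λ v → ∑ (λ k → ρ k * 𝟙 (v F.* v F.+ b k F.* v F.≟ c k)))
          ≈⟨ ∑-swap _ ⟩
        ∑ (λ k → ∑ (λ v → ρ k * 𝟙 (v F.* v F.+ b k F.* v F.≟ c k)))
          ≈⟨ ∑-cong (λ k → trans (∑-*ˡ (ρ k) _) (*-congˡ (trans (count-quadratic (b k) (c k)) (+-congˡ (φ-resp (D k)))))) ⟩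
        ∑ (λ k → ρ k * (1# + φ (conicDiscriminant l k)))
          ≈⟨ trans (∑-cong (λ k → trans (distribˡ _ _ _) (+-congʳ (*-identityʳ _)))) (∑-+ _ _) ⟩
        ∑ ρ + ∑ (λ k → ρ k * φ (conicDiscriminant l k))
          ≈⟨ trans (+-congʳ (∑-nontrivial ρ-char (proj₂ ρ-three))) (+-identityˡ _) ⟩
        ∑ (λ k → ρ k * φ (conicDiscriminant l k)) ∎
        where
        D : ∀ k → b k F.* b k F.+ F.fromℕ 4 F.* c k F.≈ conicDiscriminant l k
        D k = F.solve 2 (λ l k → F.:- (F.con 1ℤ F.:+ k) F.:* F.:- (F.con 1ℤ F.:+ k) F.:+ F.con (+ 4) F.:* ((l F.:- F.con 1ℤ) F.:* k) F.:=
          (k F.:- F.con 1ℤ) F.:* (k F.:- F.con 1ℤ) F.:+ F.con (+ 4) F.:* l F.:* k) F.refl l k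

-- The characteristic, a primitive cube root of unity, and reduction of the coefficients

module PrimeField (𝔽 : FiniteField) where
  open FiniteField 𝔽
  open FiniteFieldProperties 𝔽
  open import Relation.Binary.Reasoning.Setoid setoid

  fromℕ-bezout : ∀ {m n} → Bézout.Identity 1 m n → fromℕ m ≈ 0# → ¬ fromℕ n ≈ 0#
  fromℕ-bezout {m} {n} (Bézout.+- u v eq) m≈0 n≈0 = 0≉1 (sym (begin
    1#                             ≈⟨ lincomb (- fromℕ v) n≈0 (solve 2 (λ v n →
                                        con 1ℤ :- (con 1ℤ :+ v :* n) := :- v :* (n :- con 0ℤ)) refl (fromℕ v) (fromℕ n)) ⟩
    1# + fromℕ v * fromℕ n         ≈⟨ +-congˡ (sym (fromℕ-* v n)) ⟩
    fromℕ (1 ℕ.+ v ℕ.* n)          ≡⟨ ≡.cong fromℕ eq ⟩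
    fromℕ (u ℕ.* m)                ≈⟨ trans (fromℕ-* u m) (trans (*-congˡ m≈0) (zeroʳ _)) ⟩
    0#                             ∎))
  fromℕ-bezout (Bézout.-+ u v eq) m≈0 n≈0 = fromℕ-bezout (Bézout.+- v u eq) n≈0 m≈0

  module _ {p : ℕ} (e : ℕ) (p-prime : Prime p) (size≡ : size ≡ p ^ e) where

    -- The image of q = p^e is 0, whereas powers of a nonzero element are nonzero.
    fromℕ-p : fromℕ p ≈ 0#
    fromℕ-p with fromℕ p ≟ 0#
    ... | yes p≈0 = p≈0
    ... | no p≉0  = ⊥-elim (pow-≉0 e p≉0 (trans (sym (fromℕ-^ p e)) (trans (reflexive (≡.cong fromℕ (≡.sym size≡))) fromℕ-size)))

    fromℕ≉0 : ∀ {n} → ¬ p ∣ⁿ n → ¬ fromℕ n ≈ 0#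
    fromℕ≉0 p∤n = fromℕ-bezout (coprime-Bézout (prime∤⇒coprime p-prime p∤n)) fromℕ-p

    fromℤ≉0 : ∀ a → ¬ + p ∣ a → ¬ fromℤ a ≈ 0#
    fromℤ≉0 (+ n)    p∤a e = fromℕ≉0 p∤a e
    fromℤ≉0 -[1+ n ] p∤a e = fromℕ≉0 p∤a (lincomb (- 1#) e
      (solve 1 (λ x → x :- con 0ℤ := :- con 1ℤ :* (:- x :- con 0ℤ)) refl (fromℕ (suc n))))

  module _ (size%3≡1 : size % 3 ≡ 1) where

    size≡1+3m : size ≡ suc ((size / 3) ℕ.* 3)
    size≡1+3m = ≡.trans (m≡m%n+[m/n]*n size 3) (≡.cong (ℕ._+ (size / 3) ℕ.* 3) size%3≡1)

    -- If 3 were 0 in the field, then q = 1 + 3m would have image 1, but its image is 0.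
    3≉0 : ¬ fromℕ 3 ≈ 0#
    3≉0 e = 0≉1 (sym (trans (lincomb (- fromℕ (size / 3)) e
        (solve 2 (λ m t → con 1ℤ :- (con 1ℤ :+ m :* t) := :- m :* (t :- con 0ℤ)) refl (fromℕ (size / 3)) (fromℕ 3)))
      (trans (+-congˡ (sym (fromℕ-* (size / 3) 3))) (trans (reflexive (≡.cong fromℕ (≡.sym size≡1+3m))) fromℕ-size))))

    -- The witness is g^m with m = (q - 1)/3. It is not 1 because m is positive and smaller than the
    -- order of the generator.
    primitiveCubeRoot : ∃[ ω ] (ω * ω + ω + 1# ≈ 0# × ¬ ω ≈ 1#)
    primitiveCubeRoot = ω , x*y≈0⇒y≈0 (x-y≉0 ω≉1) (lincomb 1# ω³≈1 (solve 1 (λ w →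
        (w :- con 1ℤ) :* (w :* w :+ w :+ con 1ℤ) :- con 0ℤ := con 1ℤ :* (w :* (w :* (w :* con 1ℤ)) :- con 1ℤ)) refl ω)) , ω≉1
      where
      m = size / 3
      order≡3m : order ≡ m ℕ.* 3
      order≡3m = ℕₚ.suc-injective (≡.trans (≡.sym size≡suc-order) size≡1+3m)
      g = proj₁ generator
      ω = pow g m
      ω³≈1 : pow ω 3 ≈ 1#
      ω³≈1 = trans (sym (pow-*′ g m 3)) (trans (reflexive (≡.cong (pow g) (≡.sym order≡3m))) (fermat (proj₁ (proj₂ generator))))
      0<m : 0 < m
      0<m = ℕₚ.n≢0⇒n>0 λ m≡0 → ℕₚ.<⇒≢ 0<order (≡.sym (≡.trans order≡3m (≡.cong (ℕ._* 3) m≡0)))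
      ω≉1 : ¬ ω ≈ 1#
      ω≉1 e = ℕₚ.<⇒≱ (≡.subst (m <_) (≡.sym order≡3m) (ℕₚ.m<m*n m 3 {{ℕ.>-nonZero 0<m}} (s≤s (s≤s z≤n))))
        (∣⇒≤ {{ℕ.>-nonZero 0<m}} (proj₂ (proj₂ generator) m e))

  module _ (a₁ a₃ : ℤ) (disc≉0 : ¬ fromℤ (disc a₁ a₃) ≈ 0#) where

    fromℤ-disc : fromℤ (disc a₁ a₃) ≈
      fromℤ a₃ * fromℤ a₃ * fromℤ a₃ * (fromℤ a₁ * fromℤ a₁ * fromℤ a₁ - fromℕ 27 * fromℤ a₃)
    fromℤ-disc = trans (fromℤ-* (a₃ ℤ.* a₃ ℤ.* a₃) _) (*-cong (cube a₃)
      (trans (fromℤ-+ (a₁ ℤ.* a₁ ℤ.* a₁) _) (+-cong (cube a₁) (trans (fromℤ-neg (+ 27 ℤ.* a₃)) (-‿cong (fromℤ-* (+ 27) a₃))))))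
      where
      cube : ∀ a → fromℤ (a ℤ.* a ℤ.* a) ≈ fromℤ a * fromℤ a * fromℤ a
      cube a = trans (fromℤ-* (a ℤ.* a) a) (*-congʳ (fromℤ-* a a))

    a₃≉0 : ¬ fromℤ a₃ ≈ 0#
    a₃≉0 e = disc≉0 (trans fromℤ-disc (trans (*-congʳ (*-congˡ e)) (trans (*-congʳ (zeroʳ _)) (zeroˡ _))))

    module _ (a₁≉0 : ¬ fromℤ a₁ ≈ 0#) where

      -- The value 1 would mean 27a₃ = a₁³, which kills the second factor of the discriminant.
      argument≉1 : ¬ argument 𝔽 a₁ a₃ ≈ 1#
      argument≉1 e = disc≉0 (trans fromℤ-disc (lincomb₂
          (- (A₃ * A₃ * A₃ * (A₁ * A₁ * A₁)))
          (A₃ * A₃ * A₃ * (fromℕ 27 * A₃) * (u * u + u + 1#)) e (⁻¹-inv A₁ a₁≉0)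
          (solve 3 (λ A₁ A₃ b → let u = A₁ :* b ; d = A₃ :* A₃ :* A₃ in
            d :* (A₁ :* A₁ :* A₁ :- con (+ 27) :* A₃) :- con 0ℤ :=
            :- (d :* (A₁ :* A₁ :* A₁)) :* (con (+ 27) :* (b :* (b :* (b :* con 1ℤ))) :* A₃ :- con 1ℤ)
              :+ d :* (con (+ 27) :* A₃) :* (u :* u :+ u :+ con 1ℤ) :* (u :- con 1ℤ)) refl A₁ A₃ (A₁ ⁻¹))))
        where
        A₁ = fromℤ a₁
        A₃ = fromℤ a₃
        u = A₁ * A₁ ⁻¹

      argument≉0 : ¬ fromℕ 3 ≈ 0# → ¬ argument 𝔽 a₁ a₃ ≈ 0#
      argument≉0 3≉0 = x*y≉0 (x*y≉0
        (x*y≉0 3≉0 (x*y≉0 3≉0 3≉0) ∘ trans (sym (trans (fromℕ-* 3 9) (*-congˡ (fromℕ-* 3 3)))))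
        (pow-≉0 3 (x*y≈1⇒x≉0 (trans (*-comm _ _) (⁻¹-inv _ a₁≉0))))) a₃≉0

-- The trace of Frobenius as a double sum

module PointCount (𝔽 : FiniteField) (𝕂 : CharZeroField) where
  open Sums 𝔽 𝕂

  fromℕ-length-filter : ∀ {A : Set} {P : A → Set} (P? : Decidable P) xs → fromℕ (length (filter P? xs)) ≈ ⨁ xs (𝟙 ∘ P?)
  fromℕ-length-filter P? []       = refl
  fromℕ-length-filter P? (x ∷ xs) with P? x
  ... | yes _ = +-congˡ (fromℕ-length-filter P? xs)
  ... | no _  = trans (fromℕ-length-filter P? xs) (sym (+-identityˡ _))

  -- The 1 in q + 1 cancels the point at infinity, leaving q minus the affine count.
  fromℤ-trace : ∀ a₁ a₃ → fromℤ (trace 𝔽 a₁ a₃) ≈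
    q - ∑ (λ x → ∑ (λ y → 𝟙 (y F.* y F.+ F.fromℤ a₁ F.* x F.* y F.+ F.fromℤ a₃ F.* y F.≟ x F.* x F.* x)))
  fromℤ-trace a₁ a₃ = trans (fromℤ-+ (+ F.size ℤ.+ + 1) (ℤ.- + numPoints 𝔽 a₁ a₃)) (trans
    (+-cong (fromℤ-+ (+ F.size) (+ 1)) (trans (fromℤ-neg (+ numPoints 𝔽 a₁ a₃))
      (-‿cong (+-congˡ (trans (fromℕ-length-filter onCurve? (cartesianProduct F.elements F.elements)) (⨁-cartesianProduct F.elements F.elements _))))))
    (solve 2 (λ q n → (q :+ (con 1ℤ :+ con 0ℤ)) :- (con 1ℤ :+ n) := q :- n) refl q _))
    where
    onCurve? : Decidable {A = F.Carrier × F.Carrier} (λ (x , y) →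
      y F.* y F.+ F.fromℤ a₁ F.* x F.* y F.+ F.fromℤ a₃ F.* y F.≈ x F.* x F.* x)
    onCurve? (x , y) = y F.* y F.+ F.fromℤ a₁ F.* x F.* y F.+ F.fromℤ a₃ F.* y F.≟ x F.* x F.* x

-- From the trace through the cubic and conic sums to the series

theorem1p1 : (a1 a3 : ℤ) (p e : ℕ) → Prime p → p ≢ 2
    → ¬ (+ p ∣ disc a1 a3) → ¬ (+ p ∣ a1) → (p ^ e) % 3 ≡ 1
    → (F : FiniteField) → FiniteField.size F ≡ p ^ e
    → (K : CharZeroField) → HasPrimitiveRoot K (p ^ e ∸ 1)
    → (chars : List (Char F K)) → AllCharacters F K chars
    → (ρ : Char F K) → IsCharacter F K ρ → OrderThree F K ρ
    → CharZeroField._≈_ K (CharZeroField.fromℤ K (trace F a1 a3))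
    (CharZeroField._*_ K (CharZeroField.-_ K (qK F K))
    (hyp2F1 F K chars ρ (_·_ F K ρ ρ) (ε F K) (argument F a1 a3)))
theorem1p1 a1 a3 p e p-prime p≢2 p∤disc p∤a1 q%3≡1 𝔽 size≡ 𝕂 (ζ , ζ^N≈1 , ζ-primitive) chars chars-all ρ ρ-char ρ-three =
  begin
    fromℤ (trace 𝔽 a1 a3)
      ≈⟨ fromℤ-trace a1 a3 ⟩
    q - ∑ (λ x → ∑ (λ y → 𝟙 (y F.* y F.+ F.fromℤ a1 F.* x F.* y F.+ F.fromℤ a3 F.* y F.≟ x F.* x F.* x)))
      ≈⟨ +-congˡ (-‿cong (affinePoints 2≉0 d²≈-3 d≉0 (F.⁻¹-inv _ a₁≉0) (a₃≉0 a1 a3 disc≉0))) ⟩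
    q - (q + ∑ (φ ∘ cubicDiscriminant l))
      ≈⟨ solve 2 (λ q s → q :- (q :+ s) := :- s) refl q _ ⟩
    - ∑ (φ ∘ cubicDiscriminant l)
      ≈⟨ -‿cong (cubic≈conic 2≉0 d²≈-3 d≉0 l≉0 ρ-char ρ³≈1 (cubeRoots ω²+ω+1≈0 ω≉1)) ⟩
    - ∑ (λ k → ρ k * φ (conicDiscriminant l k))
      ≈⟨ -‿cong (sym (conicSum≈ ρ-char l 2≉0 l≉0 l≉1 ρ-three)) ⟩
    - conicSum ρ-char l
      ≈⟨ sym (hyp≈conicSum ρ-char l ζ^order≈1 ζ-primitive′ chars-all) ⟩
    - q * hyp2F1 𝔽 𝕂 chars ρ (_·_ 𝔽 𝕂 ρ ρ) (ε 𝔽 𝕂) l ∎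
  where
  open Sums 𝔽 𝕂
  open import Relation.Binary.Reasoning.Setoid setoid
  open PrimeField 𝔽
  open PointCount 𝔽 𝕂
  open WeierstrassCount 𝔽 𝕂 using (affinePoints; cubicDiscriminant; conicDiscriminant; cubic≈conic)
  open Characters 𝔽 𝕂 using (module CubicCharacter)
  open CubicCharacter ρ-char ρ-three using (ρ³≈1; cubeRoots)
  open Hypergeometric 𝔽 𝕂

  l = argument 𝔽 a1 a3
  size%3≡1 = ≡.trans (≡.cong (_% 3) size≡) q%3≡1

  N≡order : p ^ e ∸ 1 ≡ F.order
  N≡order = ≡.cong (_∸ 1) (≡.trans (≡.sym size≡) F.size≡suc-order)

  ζ^order≈1 : pow ζ F.order ≈ 1#
  ζ^order≈1 = ≡.subst (λ n → pow ζ n ≈ 1#) N≡order ζ^N≈1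

  ζ-primitive′ : ∀ k → 0 < k → k < F.order → ¬ pow ζ k ≈ 1#
  ζ-primitive′ = ≡.subst (λ n → ∀ k → 0 < k → k < n → ¬ pow ζ k ≈ 1#) N≡order ζ-primitive

  2≉0 : ¬ F.fromℕ 2 F.≈ F.0#
  2≉0 = fromℕ≉0 e p-prime size≡ (p≢2 ∘ prime∣prime⇒≡ p-prime prime[2])
  a₁≉0 = fromℤ≉0 e p-prime size≡ a1 p∤a1
  disc≉0 = fromℤ≉0 e p-prime size≡ (disc a1 a3) p∤disc
  l≉0 = argument≉0 a1 a3 disc≉0 a₁≉0 (3≉0 size%3≡1)
  l≉1 = argument≉1 a1 a3 disc≉0 a₁≉0

  ω = proj₁ (primitiveCubeRoot size%3≡1)
  ω²+ω+1≈0 = proj₁ (proj₂ (primitiveCubeRoot size%3≡1))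
  ω≉1 = proj₂ (proj₂ (primitiveCubeRoot size%3≡1))

  -- The square root of -3 obtained by completing the square in ω² + ω + 1 = 0.
  d = F.fromℕ 2 F.* ω F.+ F.1#

  d²≈-3 : d F.* d F.≈ F.- F.fromℕ 3
  d²≈-3 = F.lincomb (F.fromℕ 4) ω²+ω+1≈0 (F.solve 1 (λ w →
    (F.con (+ 2) F.:* w F.:+ F.con 1ℤ) F.:* (F.con (+ 2) F.:* w F.:+ F.con 1ℤ) F.:- F.:- F.con (+ 3) F.:=
    F.con (+ 4) F.:* (w F.:* w F.:+ w F.:+ F.con 1ℤ F.:- F.con 0ℤ)) F.refl ω)

  d≉0 : ¬ d F.≈ F.0#
  d≉0 d≈0 = 3≉0 size%3≡1 (F.lincomb₂ F.1# (F.- d) d²≈-3 d≈0 (F.solve 2 (λ d t →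
    t F.:- F.con 0ℤ F.:= F.con 1ℤ F.:* (d F.:* d F.:- F.:- t) F.:+ F.:- d F.:* (d F.:- F.con 0ℤ)) F.refl d (F.fromℕ 3)))
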